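{- Let $d\ge 2$ be an integer, let $\mathcal{I}=[-\tfrac12,\tfrac12]$ and let $\mathcal{B}'$ be the family of all boxes contained in $\mathcal{I}^{d}$ having at least $d-1$ sides of equal length. For every $\epsilon>0$ one can construct a (deterministic) $\epsilon$-net $\mathcal{N}_\epsilon$ in the range space $(\mathcal{I}^{d},\mathcal{B}')$ with cardinality $\#\mathcal{N}_\epsilon=O\left(\epsilon^{ -1}\cdot\ln(\epsilon^{ -1})\right)$ (as $\epsilon\to0^{+}$). Equivalently, one can construct a (deterministic) optical forest in $\mathbb{R}^{d}$ with growth rate $O\left(T^{d}\cdot\ln(T)\right)$ (as $T\to+\infty$).
   Context: A range space is a pair $(\mathcal{S},\mathcal{R})$ where $\mathcal{S}$ is a set and $\mathcal{R}$ is a family of subsets of $\mathcal{S}$ (ranges). A box is a (closed) rectangular parallelepiped in $\mathbb{R}^d$, of arbitrary orientation (the image of a product of $d$ closed intervals under an isometry of $\mathbb{R}^d$). Given $\epsilon>0$, a subset $\mathcal{N}_\epsilon\subseteq\mathcal{I}^{d}$ is an $\epsilon$-net in $(\mathcal{I}^d,\mathcal{R})$ if $\mathcal{N}_\epsilon\cap R\ne\emptyset$ for every $R\in\mathcal{R}$ with $\mu_d(R)\ge\epsilon$, where $\mu_d$ is Lebesgue measure on $\mathcal{I}^d$. The cardinality bound means that there are constants $C>0$, $\epsilon_0\in(0,1)$, depending only on $d$, with $\#\mathcal{N}_\epsilon\le C\epsilon^{ -1}\ln(\epsilon^{ -1})$ for all $\epsilon\in(0,\epsilon_0]$. A set $\mathfrak{F}\subseteq\mathbb{R}^{d}$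 has growth rate $O(g(T))$ if $\#(B_2(0,T)\cap\mathfrak{F})=O(g(T))$, where $B_2(0,T)$ is the Euclidean ball of radius $T$ about the origin. It is an optical forest with growth rate $O(g(T))$ (where $g(T)\gg T^d$) if it has this growth rate and if there is a constant $C>0$ such that for every $\epsilon\in(0,1)$ and every line segment $L\subseteq\mathbb{R}^d$ of length $C\epsilon^{ -(d-1)}$ there is $x\in\mathfrak{F}$ with Euclidean distance $\mathrm{dist}(x,L)\le\epsilon$. "Deterministic" means specified without any random choice. The theorem asserts that both objects exist. -}

module Defs where

open import Algebra.Bundles using (CommutativeRing; Semiring)
import Algebra.Definitions.RawSemiring as RawSemiringDefinitions
open import Algebra.Structures using (IsCommutativeRing)
open import Data.Fin.Base using (Fin; toℕ)
open import Data.List.Base using (List; length)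
open import Data.List.Relation.Unary.Any using (Any)
open import Data.Nat.Base as ℕ using (ℕ; zero; suc)
import Data.Nat.Properties as ℕ
import Data.Rational.Unnormalised.Base as ℚᵘ
import Data.Rational.Unnormalised.Properties as ℚᵘ
open import Data.Nat.Coprimality as Coprime using (1-coprimeTo)
open import Data.Integer.Base as ℤ using (+_; -[1+_])
import Data.Integer.Properties as ℤ
open import Data.Rational.Base as ℚ using (ℚ; 0ℚ; 1ℚ; ½; mkℚ; *≤*; *<*)
import Data.Rational.Properties as ℚ
open import Data.Rational.Solver using (module +-*-Solver)
open import Data.Product.Base using (∃; ∃-syntax; _×_; _,_; proj₁; proj₂)
open import Data.Sum.Base using (_⊎_; inj₁; inj₂)
open import Data.Vec.Functional using (Vector)
open import Data.Vec.Functional.Relation.Binary.Pointwise using (Pointwise)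
open import Level using (0ℓ)
open import Relation.Binary.Core using (Rel)
open import Relation.Binary.Definitions using (Cotransitive; _Respects_)
open import Relation.Binary.PropositionalEquality as ≡ using (_≡_; _≢_; refl)
open import Relation.Binary.Structures using (IsStrictPartialOrder; IsEquivalence)
open import Relation.Nullary using (¬_)
open import Relation.Unary using (Pred; _∈_; _⊆_; _∩_; _≐_; _≬_; ⋃)

-- The reals as an Archimedean, Cauchy complete ordered field.  These axioms
-- determine ℝ up to isomorphism; they are stated so as to make sense without
-- excluded middle, and CauchyReals below is a model.

record RealNumbers : Set₁ where
  field
    commutativeRing : CommutativeRing 0ℓ 0ℓ

  open CommutativeRing commutativeRing public
    using (Carrier; _≈_; _+_; _*_; -_; _-_; 0#; 1#; semiring)
  open RawSemiringDefinitions (Semiring.rawSemiring semiring) public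
    using (sum; product; _^_)
    renaming (_×_ to _·_)

  infix 4 _<_ _≤_

  field
    _<_ : Rel Carrier 0ℓ

  _≤_ : Rel Carrier 0ℓ
  x ≤ y = ¬ (y < x)

  fromℕ : ℕ → Carrier
  fromℕ n = n · 1#

  ConvergesTo : (ℕ → Carrier) → Carrier → Set
  ConvergesTo f l = ∀ e → 0# < e →
    ∃ λ N → ∀ n → N ℕ.≤ n → f n < l + e × l < f n + e

  IsCauchy : (ℕ → Carrier) → Set
  IsCauchy f = ∀ e → 0# < e →
    ∃ λ N → ∀ m n → N ℕ.≤ m → N ℕ.≤ n → f m < f n + e

  field
    <-isStrictPartialOrder : IsStrictPartialOrder _≈_ _<_
    <-cotrans              : Cotransitive _<_
    ≤-antisym              : ∀ {x y} → x ≤ y → y ≤ x → x ≈ y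
    0<1                    : 0# < 1#
    +-monoʳ-<              : ∀ x {y z} → y < z → x + y < x + z
    *-pos                  : ∀ {x y} → 0# < x → 0# < y → 0# < x * y
    recip                  : ∀ x → 0# < x → Carrier
    *-recip                : ∀ x (0<x : 0# < x) → x * recip x 0<x ≈ 1#
    archimedean            : ∀ x → ∃ λ n → x < fromℕ n
    complete               : ∀ f → IsCauchy f → ∃ λ l → ConvergesTo f l

  0<fromℕ-suc : ∀ n → 0# < fromℕ (suc n)
  0<fromℕ-suc zero    = <-respʳ-≈ (sym (+-identityʳ 1#)) 0<1
    where
    open IsStrictPartialOrder <-isStrictPartialOrder
    open CommutativeRing commutativeRing using (sym; +-identityʳ)
  0<fromℕ-suc (suc n) = trans (0<fromℕ-suc zero) (+-monoʳ-< 1# (0<fromℕ-suc n))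
    where open IsStrictPartialOrder <-isStrictPartialOrder

module CauchyReals where

  private
    module Q where
      open import Data.Rational.Base public using (_+_; _*_; _-_; -_; _≤_; _<_; ∣_∣; 1/_; _⊔_)
      open ℚ.≤-Reasoning public

      lin : ∀ {a b c d} → a ≤ b → d - c ≡ b - a → c ≤ d
      lin {a} {b} {c} {d} a≤b eq = begin
        c            ≡⟨ solve 2 (λ a c → c := a :+ (c :- a)) refl a c ⟩
        a + (c - a)  ≤⟨ ℚ.+-monoˡ-≤ (c - a) a≤b ⟩
        b + (c - a)  ≡⟨ solve 3 (λ a b c → b :+ (c :- a) := (b :- a) :+ c) refl a b c ⟩
        (b - a) + c  ≡⟨ ≡.cong (_+ c) eq ⟨
        (d - c) + c  ≡⟨ solve 2 (λ c d → (d :- c) :+ c := d) refl c d ⟩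
        d            ∎
        where open +-*-Solver

      lin< : ∀ {a b c d} → a < b → d - c ≡ b - a → c < d
      lin< {a} {b} {c} {d} a<b eq = begin-strict
        c            ≡⟨ solve 2 (λ a c → c := a :+ (c :- a)) refl a c ⟩
        a + (c - a)  <⟨ ℚ.+-monoˡ-< (c - a) a<b ⟩
        b + (c - a)  ≡⟨ solve 3 (λ a b c → b :+ (c :- a) := (b :- a) :+ c) refl a b c ⟩
        (b - a) + c  ≡⟨ ≡.cong (_+ c) eq ⟨
        (d - c) + c  ≡⟨ solve 2 (λ c d → (d :- c) :+ c := d) refl c d ⟩
        d            ∎
        where open +-*-Solver

      abs≤ : ∀ {a k} → a ≤ k → - a ≤ k → ∣ a ∣ ≤ k
      abs≤ {a} p q with ℚ.∣p∣≡p∨∣p∣≡-p a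
      ... | inj₁ eq = ≡.subst (_≤ _) (≡.sym eq) p
      ... | inj₂ eq = ≡.subst (_≤ _) (≡.sym eq) q

      ≤abs : ∀ a → a ≤ ∣ a ∣
      ≤abs a with ℚ.≤-total 0ℚ a
      ... | inj₁ 0≤a = ℚ.≤-reflexive (≡.sym (ℚ.0≤p⇒∣p∣≡p 0≤a))
      ... | inj₂ a≤0 = ℚ.≤-trans a≤0 (ℚ.0≤∣p∣ a)

      -≤abs : ∀ a → - a ≤ ∣ a ∣
      -≤abs a = ≡.subst (- a ≤_) (ℚ.∣-p∣≡∣p∣ a) (≤abs (- a))

      *-mono : ∀ {a b c d} → 0ℚ ≤ a → 0ℚ ≤ d → a ≤ b → c ≤ d → a * c ≤ b * d
      *-mono {a} {b} {c} {d} 0≤a 0≤d a≤b c≤d = ℚ.≤-trans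
        (ℚ.*-monoˡ-≤-nonNeg a {{ℚ.nonNegative 0≤a}} c≤d)
        (ℚ.*-monoʳ-≤-nonNeg d {{ℚ.nonNegative 0≤d}} a≤b)

      *-pos : ∀ {a b} → 0ℚ < a → 0ℚ < b → 0ℚ < a * b
      *-pos {a} {b} p q = ℚ.positive⁻¹ (a * b)
        {{ℚ.pos*pos⇒pos a {{ℚ.positive p}} b {{ℚ.positive q}}}}

      +-pos : ∀ {a b} → 0ℚ < a → 0ℚ < b → 0ℚ < a + b
      +-pos {a} {b} 0<a 0<b = ℚ.<-trans 0<b
        (lin< 0<a (solve 2 (λ a b → (a :+ b) :- b := a :- con 0ℚ) refl a b))
        where open +-*-Solver

      inv : ∀ a → 0ℚ < a → ℚ
      inv a p = (1/ a) {{ℚ.>-nonZero p}}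

      inv-pos : ∀ a p → 0ℚ < inv a p
      inv-pos a p = ℚ.positive⁻¹ (inv a p) {{ℚ.1/pos⇒pos a {{ℚ.positive p}}}}

      *-inv : ∀ a p → a * inv a p ≡ 1ℚ
      *-inv a p = ℚ.*-inverseʳ a {{ℚ.>-nonZero p}}

      ≤+ʳ : ∀ a {e} → 0ℚ < e → a ≤ a + e
      ≤+ʳ a {e} 0<e = lin (ℚ.<⇒≤ 0<e) (solve 2 (λ a e → (a :+ e) :- a := e :- con 0ℚ) refl a e)
        where open +-*-Solver

      ≤+ˡ : ∀ a {e} → 0ℚ < e → a ≤ e + a
      ≤+ˡ a {e} 0<e = lin (ℚ.<⇒≤ 0<e) (solve 2 (λ a e → (e :+ a) :- a := e :- con 0ℚ) refl a e)
        where open +-*-Solver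

      half : ∀ {e} → 0ℚ < e → 0ℚ < ½ * e
      half p = *-pos (ℚ.positive⁻¹ ½) p

      close⇒abs : ∀ {a b e} → a ≤ b + e → b ≤ a + e → ∣ a - b ∣ ≤ e
      close⇒abs {a} {b} {e} p q = abs≤
        (lin p (solve 3 (λ a b e → e :- (a :- b) := (b :+ e) :- a) refl a b e))
        (lin q (solve 3 (λ a b e → e :- (:- (a :- b)) := (a :+ e) :- b) refl a b e))
        where open +-*-Solver

      mul-close : ∀ {a b a′ b′ k e} → ∣ a ∣ ≤ k → ∣ b′ ∣ ≤ k →
                  ∣ a - a′ ∣ ≤ e → ∣ b - b′ ∣ ≤ e →
                  a * b ≤ a′ * b′ + (k * e + k * e)
      mul-close {a} {b} {a′} {b′} {k} {e} p q r s = lin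
        (ℚ.+-mono-≤ (bound p s) (bound q r))
        (solve 6 (λ a b a′ b′ k e →
           (a′ :* b′ :+ (k :* e :+ k :* e)) :- a :* b :=
           (k :* e :+ k :* e) :- (a :* (b :- b′) :+ b′ :* (a :- a′))) refl a b a′ b′ k e)
        where
        open +-*-Solver
        bound : ∀ {u v} → ∣ u ∣ ≤ k → ∣ v ∣ ≤ e → u * v ≤ k * e
        bound {u} {v} p q = begin
          u * v          ≤⟨ ≤abs (u * v) ⟩
          ∣ u * v ∣      ≡⟨ ℚ.∣p*q∣≡∣p∣*∣q∣ u v ⟩
          ∣ u ∣ * ∣ v ∣  ≤⟨ *-mono (ℚ.0≤∣p∣ u) (ℚ.≤-trans (ℚ.0≤∣p∣ v) q) p q ⟩
          k * e          ∎

      -- for use with mul-close: a tolerance on the factors giving error e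
      tol : ∀ k → 0ℚ < k → ∀ e → 0ℚ < e → ∃ λ t → 0ℚ < t × k * t + k * t ≡ e
      tol k 0<k e 0<e = ½ * (e * i) , half (*-pos 0<e (inv-pos k 0<k)) , (begin-equality
        k * (½ * (e * i)) + k * (½ * (e * i))
          ≡⟨ solve 3 (λ k e i → k :* (con ½ :* (e :* i)) :+ k :* (con ½ :* (e :* i)) :=
                                e :* (k :* i)) refl k e i ⟩
        e * (k * i)  ≡⟨ ≡.cong (e *_) (*-inv k 0<k) ⟩
        e * 1ℚ       ≡⟨ ℚ.*-identityʳ e ⟩
        e            ∎)
        where
        open +-*-Solver
        i : ℚ
        i = inv k 0<k

      unit : ℕ → ℚ
      unit n = mkℚ (+ 1) n (1-coprimeTo (suc n))

      unit-pos : ∀ n → 0ℚ < unit n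
      unit-pos n = ℚ.positive⁻¹ (unit n)

      unit-anti : ∀ {m n} → m ℕ.≤ n → unit n ≤ unit m
      unit-anti {m} {n} m≤n = *≤* (ℤ.*-monoˡ-≤-nonNeg (+ 1) (ℤ.+≤+ (ℕ.s≤s m≤n)))

      unit-small : ∀ e → 0ℚ < e → ∃ λ n → unit n ≤ e
      unit-small (mkℚ (+ zero) d _) (*<* (ℤ.+<+ ()))
      unit-small (mkℚ (+ suc n) d c) _ =
        d , *≤* (ℤ.*-monoʳ-≤-nonNeg (+ suc d) {+ 1} {+ suc n} (ℤ.+≤+ (ℕ.s≤s ℕ.z≤n)))

      inv-anti : ∀ {a b g i} → a * b ≡ 1ℚ → g * i ≡ 1ℚ → 0ℚ ≤ b → 0ℚ ≤ i → g ≤ a → b ≤ i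
      inv-anti {a} {b} {g} {i} ab gi 0≤b 0≤i g≤a = begin
        b            ≡⟨ ℚ.*-identityʳ b ⟨
        b * 1ℚ       ≡⟨ ≡.cong (b *_) gi ⟨
        b * (g * i)  ≤⟨ ℚ.*-monoˡ-≤-nonNeg b {{ℚ.nonNegative 0≤b}}
                          (ℚ.*-monoʳ-≤-nonNeg i {{ℚ.nonNegative 0≤i}} g≤a) ⟩
        b * (a * i)  ≡⟨ solve 3 (λ a b i → b :* (a :* i) := (a :* b) :* i) refl a b i ⟩
        (a * b) * i  ≡⟨ ≡.cong (_* i) ab ⟩
        1ℚ * i       ≡⟨ ℚ.*-identityˡ i ⟩
        i            ∎
        where open +-*-Solver

      inv-close : ∀ {a b c d g i e} → a * b ≡ 1ℚ → c * d ≡ 1ℚ → g * i ≡ 1ℚ →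
                  0ℚ ≤ b → 0ℚ ≤ d → 0ℚ ≤ i → 0ℚ ≤ e * (g * g) → b ≤ i → d ≤ i →
                  c ≤ a + e * (g * g) → b ≤ d + e
      inv-close {a} {b} {c} {d} {g} {i} {e} ab cd gi 0≤b 0≤d 0≤i 0≤t b≤i d≤i c≤ = begin
        b                              ≡⟨ ℚ.*-identityʳ b ⟨
        b * 1ℚ                         ≡⟨ ≡.cong (b *_) cd ⟨
        b * (c * d)                    ≤⟨ ℚ.*-monoˡ-≤-nonNeg b {{ℚ.nonNegative 0≤b}}
                                            (ℚ.*-monoʳ-≤-nonNeg d {{ℚ.nonNegative 0≤d}} c≤) ⟩
        b * ((a + t) * d)              ≡⟨ solve 4 (λ a b d t → b :* ((a :+ t) :* d) :=
                                                   (a :* b) :* d :+ t :* (b :* d)) refl a b d t ⟩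
        (a * b) * d + t * (b * d)      ≤⟨ ℚ.+-monoʳ-≤ ((a * b) * d)
                                            (ℚ.*-monoˡ-≤-nonNeg t {{ℚ.nonNegative 0≤t}} (*-mono 0≤b 0≤i b≤i d≤i)) ⟩
        (a * b) * d + t * (i * i)      ≡⟨ ≡.cong (λ r → (a * b) * d + r)
                                            (solve 3 (λ e g i → e :* (g :* g) :* (i :* i) :=
                                                      e :* ((g :* i) :* (g :* i))) refl e g i) ⟩
        (a * b) * d + e * ((g * i) * (g * i))
                                       ≡⟨ ≡.cong₂ (λ u v → u * d + e * (v * v)) ab gi ⟩
        1ℚ * d + e * (1ℚ * 1ℚ)         ≡⟨ ≡.cong₂ _+_ (ℚ.*-identityˡ d) (ℚ.*-identityʳ e) ⟩
        d + e                          ∎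
        where
        open +-*-Solver
        t : ℚ
        t = e * (g * g)

      nat : ℕ → ℚ
      nat n = mkℚ (+ n) 0 (Coprime.sym (1-coprimeTo n))

      1+nat : ∀ n → 1ℚ + nat n ≡ nat (suc n)
      1+nat n = ℚ.toℚᵘ-injective (ℚᵘ.≃-trans (ℚ.toℚᵘ-homo-+ 1ℚ (nat n))
        (ℚᵘ.*≡* (≡.cong (ℤ._* (+ 1)) (≡.cong (λ i → + 1 ℤ.+ i) (ℤ.*-identityʳ (+ n))))))

      ≤nat : ∀ q → ∃ λ n → q ≤ nat n
      ≤nat (mkℚ (+ n)    d _) = n , *≤* (ℤ.*-monoˡ-≤-nonNeg (+ n) {+ 1} {+ suc d} (ℤ.+≤+ (ℕ.s≤s ℕ.z≤n)))
      ≤nat (mkℚ -[1+ n ] d _) = 0 , *≤* ℤ.-≤+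

  record ℝ : Set where
    no-eta-equality
    constructor mkℝ
    field
      seq    : ℕ → ℚ
      cauchy : ∀ e → 0ℚ ℚ.< e →
        ∃ λ N → ∀ m n → N ℕ.≤ m → N ℕ.≤ n → seq m ℚ.≤ seq n ℚ.+ e

  open ℝ

  record Eventually (P : ℕ → Set) : Set where
    constructor _,_
    field
      from  : ℕ
      holds : ∀ n → from ℕ.≤ n → P n

  private
    infixr 2 _⊗_
    _⊗_ : ∀ {P Q : ℕ → Set} → Eventually P → Eventually Q → Eventually (λ n → P n × Q n)
    (M , p) ⊗ (N , q) = M ℕ.⊔ N , λ n le →
      p n (ℕ.m⊔n≤o⇒m≤o M N le) , q n (ℕ.m⊔n≤o⇒n≤o M N le)

    mapᵉ : ∀ {P Q : ℕ → Set} → (∀ n → P n → Q n) → Eventually P → Eventually Q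
    mapᵉ f (N , p) = N , λ n le → f n (p n le)

  infix 4 _≈_ _<_

  -- Equality, order and arithmetic are computed termwise, up to finitely many
  -- terms and vanishing errors.

  record _≈_ (x y : ℝ) : Set where
    constructor mk≈
    field
      near : ∀ e → 0ℚ ℚ.< e →
        Eventually λ n → seq x n ℚ.≤ seq y n ℚ.+ e × seq y n ℚ.≤ seq x n ℚ.+ e

  record _<_ (x y : ℝ) : Set where
    constructor mk<
    field
      gap      : ℚ
      gap-pos  : 0ℚ ℚ.< gap
      separate : Eventually λ n → seq x n ℚ.+ gap ℚ.≤ seq y n

  open _≈_
  open _<_

  const : ℚ → ℝ
  const q = mkℝ (λ _ → q) λ e 0<e → 0 , λ _ _ _ _ → Q.≤+ʳ q 0<e

  private
    bounded : ∀ x → ∃ λ k → 0ℚ ℚ.< k × Eventually λ n → ℚ.∣ seq x n ∣ ℚ.≤ k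
    bounded x = ∣a∣ Q.+ 1ℚ , pos , N , λ n le → Q.abs≤
      (Q.lin (ℚ.+-mono-≤ (close n N le ℕ.≤-refl) (Q.≤abs a))
         (solve 3 (λ x a k → (k :+ con 1ℚ) :- x := ((a :+ con 1ℚ) :+ k) :- (x :+ a)) refl (seq x n) a ∣a∣))
      (Q.lin (ℚ.+-mono-≤ (close N n ℕ.≤-refl le) (Q.-≤abs a))
         (solve 3 (λ x a k → (k :+ con 1ℚ) :- (:- x) := ((x :+ con 1ℚ) :+ k) :- (a :+ :- a)) refl (seq x n) a ∣a∣))
      where
      open +-*-Solver
      N : ℕ
      N = proj₁ (cauchy x 1ℚ (ℚ.positive⁻¹ 1ℚ))
      close : ∀ m n → N ℕ.≤ m → N ℕ.≤ n → seq x m ℚ.≤ seq x n ℚ.+ 1ℚ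
      close = proj₂ (cauchy x 1ℚ (ℚ.positive⁻¹ 1ℚ))
      a ∣a∣ : ℚ
      a = seq x N
      ∣a∣ = ℚ.∣ a ∣
      pos : 0ℚ ℚ.< ∣a∣ Q.+ 1ℚ
      pos = ℚ.+-mono-≤-< (ℚ.0≤∣p∣ a) (ℚ.positive⁻¹ 1ℚ)

    bounded₂ : ∀ x y → ∃ λ k → 0ℚ ℚ.< k ×
      Eventually λ n → ℚ.∣ seq x n ∣ ℚ.≤ k × ℚ.∣ seq y n ∣ ℚ.≤ k
    bounded₂ x y =
      let j , 0<j , p = bounded x
          k , 0<k , q = bounded y
      in j Q.+ k , Q.+-pos 0<j 0<k ,
         mapᵉ (λ _ (p , q) → ℚ.≤-trans p (Q.≤+ʳ j 0<k) , ℚ.≤-trans q (Q.≤+ˡ k 0<j)) (p ⊗ q)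

  infixl 6 _+_
  infixl 7 _*_
  infix  8 -_

  _+_ : ℝ → ℝ → ℝ
  seq (x + y) n = seq x n ℚ.+ seq y n
  cauchy (x + y) e 0<e =
    let M , p = cauchy x (½ Q.* e) (Q.half 0<e)
        N , q = cauchy y (½ Q.* e) (Q.half 0<e)
    in M ℕ.⊔ N , λ m n le le′ → Q.lin
    (ℚ.+-mono-≤ (p m n (ℕ.m⊔n≤o⇒m≤o M N le) (ℕ.m⊔n≤o⇒m≤o M N le′))
                (q m n (ℕ.m⊔n≤o⇒n≤o M N le) (ℕ.m⊔n≤o⇒n≤o M N le′)))
    (solve 5 (λ a b c d e → ((c :+ d) :+ e) :- (a :+ b) :=
                            ((c :+ con ½ :* e) :+ (d :+ con ½ :* e)) :- (a :+ b))
       refl (seq x m) (seq y m) (seq x n) (seq y n) e)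
    where open +-*-Solver

  -_ : ℝ → ℝ
  seq (- x) n = ℚ.- seq x n
  cauchy (- x) e 0<e = let N , p = cauchy x e 0<e in N , λ m n le le′ → Q.lin (p n m le′ le)
    (solve 3 (λ a b e → (:- b :+ e) :- (:- a) := (a :+ e) :- b) refl (seq x m) (seq x n) e)
    where open +-*-Solver

  _*_ : ℝ → ℝ → ℝ
  seq (x * y) n = seq x n ℚ.* seq y n
  cauchy (x * y) e 0<e =
    let k , 0<k , (K , b) = bounded₂ x y
        t , 0<t , eq      = Q.tol k 0<k e 0<e
        M , p             = cauchy x t 0<t
        N , q             = cauchy y t 0<t
    in K ℕ.⊔ (M ℕ.⊔ N) , λ m n le le′ →
    let K≤m = ℕ.m⊔n≤o⇒m≤o K (M ℕ.⊔ N) le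
        K≤n = ℕ.m⊔n≤o⇒m≤o K (M ℕ.⊔ N) le′
        u   = ℕ.m⊔n≤o⇒n≤o K (M ℕ.⊔ N) le
        u′  = ℕ.m⊔n≤o⇒n≤o K (M ℕ.⊔ N) le′
        M≤m = ℕ.m⊔n≤o⇒m≤o M N u
        M≤n = ℕ.m⊔n≤o⇒m≤o M N u′
        N≤m = ℕ.m⊔n≤o⇒n≤o M N u
        N≤n = ℕ.m⊔n≤o⇒n≤o M N u′
    in ≡.subst (λ r → seq x m Q.* seq y m Q.≤ seq x n Q.* seq y n Q.+ r) eq
         (Q.mul-close (proj₁ (b m K≤m)) (proj₂ (b n K≤n))
            (Q.close⇒abs (p m n M≤m M≤n) (p n m M≤n M≤m))
            (Q.close⇒abs (q m n N≤m N≤n) (q n m N≤n N≤m)))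

  private
    termwise : ∀ {x y} → (∀ n → seq x n ≡ seq y n) → x ≈ y
    near (termwise {x} {y} eq) e 0<e = 0 , λ n _ → step (eq n) , step (≡.sym (eq n))
      where
      step : ∀ {a b} → a ≡ b → a ℚ.≤ b ℚ.+ e
      step {a} refl = Q.≤+ʳ a 0<e

    ≈-isEquivalence : IsEquivalence _≈_
    ≈-isEquivalence = record
      { refl  = termwise λ _ → refl
      ; sym   = λ p → mk≈ λ e 0<e → mapᵉ (λ _ (a , b) → b , a) (near p e 0<e)
      ; trans = λ {x} {y} {z} p q → mk≈ λ e 0<e →
          mapᵉ (λ n ((a , b) , (c , d)) →
            glue (seq x n) (seq y n) (seq z n) a c , glue (seq z n) (seq y n) (seq x n) d b)
            (near p (½ Q.* e) (Q.half 0<e) ⊗ near q (½ Q.* e) (Q.half 0<e))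
      }
      where
      open +-*-Solver
      glue : ∀ a b c {e} → a ℚ.≤ b ℚ.+ ½ Q.* e → b ℚ.≤ c ℚ.+ ½ Q.* e → a ℚ.≤ c ℚ.+ e
      glue a b c {e} p q = Q.lin (ℚ.+-mono-≤ p q)
        (solve 4 (λ a b c e → (c :+ e) :- a :=
           ((b :+ con ½ :* e) :+ (c :+ con ½ :* e)) :- (a :+ b)) refl a b c e)

    +-cong : ∀ {x y u v} → x ≈ y → u ≈ v → x + u ≈ y + v
    near (+-cong {x} {y} {u} {v} p q) e 0<e =
      mapᵉ (λ n ((a , b) , (c , d)) →
        glue (seq x n) (seq y n) (seq u n) (seq v n) a c , glue (seq y n) (seq x n) (seq v n) (seq u n) b d)
        (near p (½ Q.* e) (Q.half 0<e) ⊗ near q (½ Q.* e) (Q.half 0<e))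
      where
      open +-*-Solver
      glue : ∀ a b c d → a ℚ.≤ b ℚ.+ ½ Q.* e → c ℚ.≤ d ℚ.+ ½ Q.* e → a ℚ.+ c ℚ.≤ (b ℚ.+ d) ℚ.+ e
      glue a b c d p q = Q.lin (ℚ.+-mono-≤ p q)
        (solve 5 (λ a b c d e → ((b :+ d) :+ e) :- (a :+ c) :=
           ((b :+ con ½ :* e) :+ (d :+ con ½ :* e)) :- (a :+ c)) refl a b c d e)

    -‿cong : ∀ {x y} → x ≈ y → - x ≈ - y
    near (-‿cong {x} {y} p) e 0<e =
      mapᵉ (λ n (a , b) → flip (seq x n) (seq y n) b , flip (seq y n) (seq x n) a) (near p e 0<e)
      where
      open +-*-Solver
      flip : ∀ a b → b ℚ.≤ a ℚ.+ e → ℚ.- a ℚ.≤ ℚ.- b ℚ.+ e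
      flip a b p = Q.lin p
        (solve 3 (λ a b e → (:- b :+ e) :- (:- a) := (a :+ e) :- b) refl a b e)

    *-cong : ∀ {x y u v} → x ≈ y → u ≈ v → x * u ≈ y * v
    near (*-cong {x} {y} {u} {v} p q) e 0<e =
      let j , 0<j , b  = bounded₂ x y
          k , 0<k , c  = bounded₂ u v
          t , 0<t , eq = Q.tol (j Q.+ k) (Q.+-pos 0<j 0<k) e 0<e
          j≤           = Q.≤+ʳ j 0<k
          k≤           = Q.≤+ˡ k 0<j
      in mapᵉ
        (λ n (((bx , by) , (bu , bv)) , ((xy , yx) , (uv , vu))) →
          ≡.subst (λ r → seq x n Q.* seq u n Q.≤ seq y n Q.* seq v n Q.+ r) eq
            (Q.mul-close (ℚ.≤-trans bx j≤) (ℚ.≤-trans bv k≤) (Q.close⇒abs xy yx) (Q.close⇒abs uv vu)) ,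
          ≡.subst (λ r → seq y n Q.* seq v n Q.≤ seq x n Q.* seq u n Q.+ r) eq
            (Q.mul-close (ℚ.≤-trans by j≤) (ℚ.≤-trans bu k≤) (Q.close⇒abs yx xy) (Q.close⇒abs vu uv)))
        ((b ⊗ c) ⊗ (near p t 0<t ⊗ near q t 0<t))

    isCommutativeRing : IsCommutativeRing _≈_ _+_ _*_ -_ (const 0ℚ) (const 1ℚ)
    isCommutativeRing = record
      { isRing = record
        { +-isAbelianGroup = record
          { isGroup = record
            { isMonoid = record
              { isSemigroup = record
                { isMagma = record { isEquivalence = ≈-isEquivalence ; ∙-cong = +-cong }
                ; assoc   = λ x y z → termwise λ n → ℚ.+-assoc (seq x n) (seq y n) (seq z n)
                }
              ; identity = (λ x → termwise λ n → ℚ.+-identityˡ (seq x n))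
                         , (λ x → termwise λ n → ℚ.+-identityʳ (seq x n))
              }
            ; inverse = (λ x → termwise λ n → ℚ.+-inverseˡ (seq x n))
                      , (λ x → termwise λ n → ℚ.+-inverseʳ (seq x n))
            ; ⁻¹-cong = -‿cong
            }
          ; comm = λ x y → termwise λ n → ℚ.+-comm (seq x n) (seq y n)
          }
        ; *-cong     = *-cong
        ; *-assoc    = λ x y z → termwise λ n → ℚ.*-assoc (seq x n) (seq y n) (seq z n)
        ; *-identity = (λ x → termwise λ n → ℚ.*-identityˡ (seq x n))
                     , (λ x → termwise λ n → ℚ.*-identityʳ (seq x n))
        ; distrib    = (λ x y z → termwise λ n → ℚ.*-distribˡ-+ (seq x n) (seq y n) (seq z n))
                     , (λ x y z → termwise λ n → ℚ.*-distribʳ-+ (seq x n) (seq y n) (seq z n))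
        }
      ; *-comm = λ x y → termwise λ n → ℚ.*-comm (seq x n) (seq y n)
      }

    ring : CommutativeRing 0ℓ 0ℓ
    ring = record { isCommutativeRing = isCommutativeRing }

    0ᴿ : ℝ
    0ᴿ = const 0ℚ

    Steady : ℝ → ℚ → ℕ → Set
    Steady x e N = ∀ m n → N ℕ.≤ m → N ℕ.≤ n → seq x m ℚ.≤ seq x n ℚ.+ e

    steady₂ : ∀ x y {e} → 0ℚ ℚ.< e → ∃ λ N → Steady x e N × Steady y e N
    steady₂ x y {e} 0<e =
      let M , p = cauchy x e 0<e
          N , q = cauchy y e 0<e
      in M ℕ.⊔ N
       , (λ m n le le′ → p m n (ℕ.m⊔n≤o⇒m≤o M N le) (ℕ.m⊔n≤o⇒m≤o M N le′))
       , (λ m n le le′ → q m n (ℕ.m⊔n≤o⇒n≤o M N le) (ℕ.m⊔n≤o⇒n≤o M N le′))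

    ⅛ : ℚ
    ⅛ = ½ Q.* (½ Q.* ½)

    eighth : ∀ {e} → 0ℚ ℚ.< e → 0ℚ ℚ.< ⅛ Q.* e
    eighth p = Q.*-pos (ℚ.positive⁻¹ ⅛) p

    separated : ∀ {x y e N} → 0ℚ ℚ.< e → Steady x (⅛ Q.* e) N → Steady y (⅛ Q.* e) N →
                ∀ M → N ℕ.≤ M → seq x M ℚ.+ ½ Q.* e ℚ.≤ seq y M → x < y
    separated {x} {y} {e} {N} 0<e p q M N≤M le = mk< (½ Q.* (½ Q.* e)) (Q.half (Q.half 0<e)) (N , λ n N≤n →
      Q.lin (ℚ.+-mono-≤ le (ℚ.+-mono-≤ (p n M N≤n N≤M) (q M n N≤M N≤n)))
        (solve 5 (λ a b c d e →
           d :- (c :+ con ½ :* (con ½ :* e)) :=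
           (b :+ ((a :+ con ⅛ :* e) :+ (d :+ con ⅛ :* e))) :- ((a :+ con ½ :* e) :+ (c :+ b)))
           refl (seq x M) (seq y M) (seq x n) (seq y n) e))
      where open +-*-Solver

    <-irrefl : ∀ {x y} → x ≈ y → ¬ x < y
    <-irrefl {x} {y} p (mk< g 0<g q) =
      let (N , r) = near p (½ Q.* g) (Q.half 0<g) ⊗ q
          ((_ , yx) , lt) = r N ℕ.≤-refl
      in ℚ.<-irrefl refl (ℚ.<-≤-trans (Q.half 0<g)
           (Q.lin (ℚ.+-mono-≤ yx lt)
             (solve 3 (λ a b g → con 0ℚ :- con ½ :* g :=
                ((a :+ con ½ :* g) :+ b) :- (b :+ (a :+ g))) refl (seq x N) (seq y N) g)))
      where open +-*-Solver

    <-trans : ∀ {x y z} → x < y → y < z → x < z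
    <-trans {x} {y} {z} (mk< g 0<g p) (mk< h 0<h q) = mk< g 0<g
      (mapᵉ (λ n (a , b) → ℚ.≤-trans a (ℚ.≤-trans (Q.≤+ʳ (seq y n) 0<h) b)) (p ⊗ q))

    <-respʳ : ∀ {x y z} → y ≈ z → x < y → x < z
    <-respʳ {x} {y} {z} p (mk< g 0<g q) = mk< (½ Q.* g) (Q.half 0<g)
      (mapᵉ (λ n ((a , _) , b) → Q.lin (ℚ.+-mono-≤ a b)
         (solve 4 (λ x y z g → z :- (x :+ con ½ :* g) :=
            ((z :+ con ½ :* g) :+ y) :- (y :+ (x :+ g))) refl (seq x n) (seq y n) (seq z n) g))
         (near p (½ Q.* g) (Q.half 0<g) ⊗ q))
      where open +-*-Solver

    <-respˡ : ∀ {x y z} → y ≈ z → y < x → z < x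
    <-respˡ {x} {y} {z} p (mk< g 0<g q) = mk< (½ Q.* g) (Q.half 0<g)
      (mapᵉ (λ n ((_ , a) , b) → Q.lin (ℚ.+-mono-≤ a b)
         (solve 4 (λ x y z g → x :- (z :+ con ½ :* g) :=
            ((y :+ con ½ :* g) :+ x) :- (z :+ (y :+ g))) refl (seq x n) (seq y n) (seq z n) g))
         (near p (½ Q.* g) (Q.half 0<g) ⊗ q))
      where open +-*-Solver

    <-cotrans : Cotransitive _<_
    <-cotrans {x} {y} (mk< g 0<g (G , p)) z = go (ℚ.≤-total (seq x N Q.+ ½ Q.* g) (seq z N))
      where
      open +-*-Solver
      xz = steady₂ x z (eighth 0<g)
      zy = steady₂ z y (eighth 0<g)
      J K N : ℕ
      J = proj₁ xz
      K = proj₁ zy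
      N = G ℕ.⊔ (J ℕ.⊔ K)
      G≤ : G ℕ.≤ N
      G≤ = ℕ.m≤m⊔n G (J ℕ.⊔ K)
      J≤ : J ℕ.≤ N
      J≤ = ℕ.≤-trans (ℕ.m≤m⊔n J K) (ℕ.m≤n⊔m G (J ℕ.⊔ K))
      K≤ : K ℕ.≤ N
      K≤ = ℕ.≤-trans (ℕ.m≤n⊔m J K) (ℕ.m≤n⊔m G (J ℕ.⊔ K))
      go : seq x N Q.+ ½ Q.* g Q.≤ seq z N ⊎ seq z N Q.≤ seq x N Q.+ ½ Q.* g → x < z ⊎ z < y
      go (inj₁ le) = inj₁ (separated 0<g (proj₁ (proj₂ xz)) (proj₂ (proj₂ xz)) N J≤ le)
      go (inj₂ le) = inj₂ (separated 0<g (proj₁ (proj₂ zy)) (proj₂ (proj₂ zy)) N K≤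
        (Q.lin (ℚ.+-mono-≤ le (p N G≤))
          (solve 4 (λ x y z g → y :- (z :+ con ½ :* g) :=
             ((x :+ con ½ :* g) :+ y) :- (z :+ (x :+ g))) refl (seq x N) (seq y N) (seq z N) g)))

    ≤-antisym : ∀ {x y} → ¬ (y < x) → ¬ (x < y) → x ≈ y
    near (≤-antisym {x} {y} y≮x x≮y) e 0<e = N , λ n N≤n → bound sx sy y≮x n N≤n , bound sy sx x≮y n N≤n
      where
      open +-*-Solver
      xy = steady₂ x y (eighth 0<e)
      N : ℕ
      N = proj₁ xy
      sx : Steady x (⅛ Q.* e) N
      sx = proj₁ (proj₂ xy)
      sy : Steady y (⅛ Q.* e) N
      sy = proj₂ (proj₂ xy)
      bound : ∀ {x y} → Steady x (⅛ Q.* e) N → Steady y (⅛ Q.* e) N → ¬ (y < x) →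
              ∀ n → N ℕ.≤ n → seq x n ℚ.≤ seq y n ℚ.+ e
      bound {x} {y} sx sy y≮x n N≤n = ℚ.≮⇒≥ λ lt → y≮x (separated 0<e sy sx n N≤n
        (ℚ.<⇒≤ (ℚ.≤-<-trans
          (Q.lin (ℚ.<⇒≤ (Q.half 0<e))
            (solve 2 (λ y e → (y :+ e) :- (y :+ con ½ :* e) := con ½ :* e :- con 0ℚ) refl (seq y n) e))
          lt)))

    0<1 : 0ᴿ < const 1ℚ
    0<1 = mk< 1ℚ (ℚ.positive⁻¹ 1ℚ) (0 , λ _ _ → ℚ.≤-refl)

    +-monoʳ-< : ∀ x {y z} → y < z → x + y < x + z
    +-monoʳ-< x {y} {z} (mk< g 0<g p) = mk< g 0<g
      (mapᵉ (λ n le → Q.lin le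
         (solve 4 (λ x y z g → (x :+ z) :- ((x :+ y) :+ g) := z :- (y :+ g)) refl (seq x n) (seq y n) (seq z n) g)) p)
      where open +-*-Solver

    drop0 : ∀ {a b} → 0ℚ ℚ.+ a ℚ.≤ b → a ℚ.≤ b
    drop0 {a} {b} = ≡.subst (ℚ._≤ b) (ℚ.+-identityˡ a)

    add0 : ∀ {a b} → a ℚ.≤ b → 0ℚ ℚ.+ a ℚ.≤ b
    add0 {a} {b} = ≡.subst (ℚ._≤ b) (≡.sym (ℚ.+-identityˡ a))

    positive-tail : ∀ {x} (0<x : 0ᴿ < x) → Eventually λ n → gap 0<x ℚ.≤ seq x n
    positive-tail 0<x = mapᵉ (λ _ → drop0) (separate 0<x)

    *-pos : ∀ {x y} → 0ᴿ < x → 0ᴿ < y → 0ᴿ < x * y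
    *-pos {x} {y} (mk< g 0<g p) (mk< h 0<h q) = mk< (g Q.* h) (Q.*-pos 0<g 0<h)
      (mapᵉ (λ n (a , b) → add0
         (Q.*-mono (ℚ.<⇒≤ 0<g) (ℚ.≤-trans (ℚ.<⇒≤ 0<h) (drop0 b)) (drop0 a) (drop0 b))) (p ⊗ q))

    module Reciprocal (x : ℝ) (g : ℚ) (0<g : 0ℚ ℚ.< g) (p : Eventually λ n → g ℚ.≤ seq x n) where
      open +-*-Solver

      -- x, with its finitely many small terms raised to g
      den : ℕ → ℚ
      den n = seq x n Q.⊔ g

      den-pos : ∀ n → 0ℚ ℚ.< den n
      den-pos n = ℚ.<-≤-trans 0<g (ℚ.p≤q⊔p (seq x n) g)

      inv-den : ℕ → ℚ
      inv-den n = Q.inv (den n) (den-pos n)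

      den-eq : Eventually λ n → den n ≡ seq x n
      den-eq = mapᵉ (λ n le → ℚ.p≥q⇒p⊔q≡p le) p

      i : ℚ
      i = Q.inv g 0<g

      0≤inv-den : ∀ n → 0ℚ ℚ.≤ inv-den n
      0≤inv-den n = ℚ.<⇒≤ (Q.inv-pos (den n) (den-pos n))

      0≤i : 0ℚ ℚ.≤ i
      0≤i = ℚ.<⇒≤ (Q.inv-pos g 0<g)

      inv-den≤i : ∀ n → inv-den n ℚ.≤ i
      inv-den≤i n = Q.inv-anti {a = den n} {g = g} (Q.*-inv (den n) (den-pos n)) (Q.*-inv g 0<g)
        (0≤inv-den n) 0≤i (ℚ.p≤q⊔p (seq x n) g)

      inverse-close : ∀ m n e → 0ℚ ℚ.< e → den n ℚ.≤ den m ℚ.+ e Q.* (g Q.* g) → inv-den m ℚ.≤ inv-den n ℚ.+ e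
      inverse-close m n e 0<e = Q.inv-close {a = den m} {c = den n} {g = g}
        (Q.*-inv (den m) (den-pos m)) (Q.*-inv (den n) (den-pos n)) (Q.*-inv g 0<g)
        (0≤inv-den m) (0≤inv-den n) 0≤i (ℚ.<⇒≤ (Q.*-pos 0<e (Q.*-pos 0<g 0<g)))
        (inv-den≤i m) (inv-den≤i n)

      value : ℝ
      seq value = inv-den
      cauchy value e 0<e =
        let M , r = cauchy x (e Q.* (g Q.* g)) (Q.*-pos 0<e (Q.*-pos 0<g 0<g))
            K , s = den-eq
        in M ℕ.⊔ K , λ m n le le′ → inverse-close m n e 0<e
             (≡.subst₂ (λ u v → u Q.≤ v Q.+ e Q.* (g Q.* g))
               (≡.sym (s n (ℕ.m⊔n≤o⇒n≤o M K le′))) (≡.sym (s m (ℕ.m⊔n≤o⇒n≤o M K le)))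
               (r n m (ℕ.m⊔n≤o⇒m≤o M K le′) (ℕ.m⊔n≤o⇒m≤o M K le)))

      inverse : x * value ≈ const 1ℚ
      near inverse e 0<e = mapᵉ (λ n eq → within (eq′ n eq)) den-eq
        where
        eq′ : ∀ n → den n ≡ seq x n → seq x n Q.* inv-den n ≡ 1ℚ
        eq′ n eq = ≡.trans (≡.cong (Q._* inv-den n) (≡.sym eq)) (Q.*-inv (den n) (den-pos n))
        within : ∀ {a} → a ≡ 1ℚ → a ℚ.≤ 1ℚ ℚ.+ e × 1ℚ ℚ.≤ a ℚ.+ e
        within refl = Q.≤+ʳ 1ℚ 0<e , Q.≤+ʳ 1ℚ 0<e

    recip : ∀ x → 0ᴿ < x → ℝ
    recip x 0<x = Reciprocal.value x (gap 0<x) (gap-pos 0<x) (positive-tail 0<x)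

    *-recip : ∀ x (0<x : 0ᴿ < x) → x * recip x 0<x ≈ const 1ℚ
    *-recip x 0<x = Reciprocal.inverse x (gap 0<x) (gap-pos 0<x) (positive-tail 0<x)

    open RawSemiringDefinitions (Semiring.rawSemiring (CommutativeRing.semiring ring))
      using () renaming (_×_ to _·_)

    seq-· : ∀ n i → seq (n · const 1ℚ) i ≡ Q.nat n
    seq-· zero    i = refl
    seq-· (suc n) i = ≡.trans (≡.cong (1ℚ Q.+_) (seq-· n i)) (Q.1+nat n)

    archimedean : ∀ x → ∃ λ n → x < n · const 1ℚ
    archimedean x =
      let k , _ , b = bounded x
          n , le    = Q.≤nat (k Q.+ 1ℚ)
      in n , mk< 1ℚ (ℚ.positive⁻¹ 1ℚ) (mapᵉ (λ i ∣x∣≤k →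
           ≡.subst (seq x i Q.+ 1ℚ Q.≤_) (≡.sym (seq-· n i))
             (ℚ.≤-trans (ℚ.+-monoˡ-≤ 1ℚ (ℚ.≤-trans (Q.≤abs (seq x i)) ∣x∣≤k)) le)) b)

    small : ∀ e → 0ℚ ℚ.< e → ∃ λ N → ∀ n → N ℕ.≤ n → Q.unit n ℚ.≤ e
    small e 0<e = let N , le = Q.unit-small e 0<e in N , λ n N≤n → ℚ.≤-trans (Q.unit-anti N≤n) le

    0<const : ∀ {q} → 0ℚ ℚ.< q → 0ᴿ < const q
    0<const {q} 0<q = mk< q 0<q (0 , λ _ _ → ℚ.≤-reflexive (ℚ.+-identityˡ q))

    module Limit (f : ℕ → ℝ)
      (fc : ∀ e → 0ᴿ < e → ∃ λ N → ∀ m n → N ℕ.≤ m → N ℕ.≤ n → f m < f n + e) where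
      open +-*-Solver

      index : ℕ → ℕ
      index k = proj₁ (cauchy (f k) (Q.unit k) (Q.unit-pos k))

      approx : ℕ → ℚ
      approx k = seq (f k) (index k)

      approx-close : ∀ k i → index k ℕ.≤ i →
        seq (f k) i ℚ.≤ approx k ℚ.+ Q.unit k × approx k ℚ.≤ seq (f k) i ℚ.+ Q.unit k
      approx-close k i le = p i (index k) le ℕ.≤-refl , p (index k) i ℕ.≤-refl le
        where
        p : Steady (f k) (Q.unit k) (index k)
        p = proj₂ (cauchy (f k) (Q.unit k) (Q.unit-pos k))

      limit : ℝ
      seq limit = approx
      cauchy limit e 0<e = K ℕ.⊔ J , λ m n le le′ →
        bound m n (ℕ.m⊔n≤o⇒n≤o K J le) (ℕ.m⊔n≤o⇒n≤o K J le′)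
          (proj₂ F m n (ℕ.m⊔n≤o⇒m≤o K J le) (ℕ.m⊔n≤o⇒m≤o K J le′))
        where
        q : ℚ
        q = ½ Q.* (½ Q.* e)
        0<q : 0ℚ ℚ.< q
        0<q = Q.half (Q.half 0<e)
        F = fc (const q) (0<const 0<q)
        S = small q 0<q
        K J : ℕ
        K = proj₁ F
        J = proj₁ S
        bound : ∀ m n → J ℕ.≤ m → J ℕ.≤ n → f m < f n + const q → approx m ℚ.≤ approx n ℚ.+ e
        bound m n J≤m J≤n (mk< g 0<g (G , p)) =
          chain (approx m) (approx n) (seq (f m) i) (seq (f n) i) (Q.unit m) (Q.unit n)
            (proj₂ (approx-close m i (ℕ.≤-trans (ℕ.m≤m⊔n (index m) (index n)) (ℕ.m≤n⊔m G _))))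
            (ℚ.≤-trans (Q.≤+ʳ (seq (f m) i) 0<g) (p i (ℕ.m≤m⊔n G _)))
            (proj₁ (approx-close n i (ℕ.≤-trans (ℕ.m≤n⊔m (index m) (index n)) (ℕ.m≤n⊔m G _))))
            (proj₂ S m J≤m) (proj₂ S n J≤n)
          where
          i : ℕ
          i = G ℕ.⊔ (index m ℕ.⊔ index n)
          chain : ∀ a b c d u v → a ℚ.≤ c ℚ.+ u → c ℚ.≤ d ℚ.+ q → d ℚ.≤ b ℚ.+ v →
                  u ℚ.≤ q → v ℚ.≤ q → a ℚ.≤ b ℚ.+ e
          chain a b c d u v h₁ h₂ h₃ h₄ h₅ = Q.lin
            (ℚ.+-mono-≤ (ℚ.+-mono-≤ h₁ h₂) (ℚ.+-mono-≤ h₃ (ℚ.+-mono-≤ (ℚ.+-mono-≤ h₄ h₅) (ℚ.<⇒≤ 0<q))))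
            (solve 7 (λ a b c d u v e → let q = con ½ :* (con ½ :* e) in
               (b :+ e) :- a :=
               (((c :+ u) :+ (d :+ q)) :+ ((b :+ v) :+ ((q :+ q) :+ q))) :-
               ((a :+ c) :+ (d :+ ((u :+ v) :+ con 0ℚ)))) refl a b c d u v e)

      converges : ∀ e → 0ᴿ < e →
        ∃ λ N → ∀ n → N ℕ.≤ n → f n < limit + e × limit < f n + e
      converges e 0<e = K ℕ.⊔ J , λ n le →
        both n (ℕ.m⊔n≤o⇒m≤o K J le) (ℕ.m⊔n≤o⇒n≤o K J le)
        where
        g q : ℚ
        g = gap 0<e
        q = ½ Q.* (½ Q.* g)
        0<q : 0ℚ ℚ.< q
        0<q = Q.half (Q.half (gap-pos 0<e))
        C = cauchy limit q 0<q
        S = small q 0<q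
        K J : ℕ
        K = proj₁ C
        J = proj₁ S
        chain : ∀ a b c u w → a ℚ.≤ b ℚ.+ u → b ℚ.≤ c ℚ.+ q → u ℚ.≤ q → g ℚ.≤ w →
                a ℚ.+ ½ Q.* g ℚ.≤ c ℚ.+ w
        chain a b c u w h₁ h₂ h₃ h₄ = Q.lin (ℚ.+-mono-≤ (ℚ.+-mono-≤ h₁ h₂) (ℚ.+-mono-≤ h₃ h₄))
          (solve 6 (λ a b c u w g → let q = con ½ :* (con ½ :* g) in
             (c :+ w) :- (a :+ con ½ :* g) :=
             (((b :+ u) :+ (c :+ q)) :+ (q :+ w)) :- ((a :+ b) :+ (u :+ g))) refl a b c u w g)
        chain′ : ∀ a b c u w → c ℚ.≤ b ℚ.+ q → b ℚ.≤ a ℚ.+ u → u ℚ.≤ q → g ℚ.≤ w →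
                 c ℚ.+ ½ Q.* g ℚ.≤ a ℚ.+ w
        chain′ a b c u w h₁ h₂ h₃ h₄ = Q.lin (ℚ.+-mono-≤ (ℚ.+-mono-≤ h₁ h₂) (ℚ.+-mono-≤ h₃ h₄))
          (solve 6 (λ a b c u w g → let q = con ½ :* (con ½ :* g) in
             (a :+ w) :- (c :+ con ½ :* g) :=
             (((b :+ q) :+ (a :+ u)) :+ (q :+ w)) :- ((c :+ b) :+ (u :+ g))) refl a b c u w g)
        both : ∀ n → K ℕ.≤ n → J ℕ.≤ n → f n < limit + e × limit < f n + e
        both n K≤n J≤n =
          mk< (½ Q.* g) (Q.half (gap-pos 0<e))
            (mapᵉ (λ i ((K≤i , ix≤i) , g≤e) →
               chain (seq (f n) i) (approx n) (approx i) (Q.unit n) (seq e i)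
                 (proj₁ (approx-close n i ix≤i)) (proj₂ C n i K≤n K≤i) (proj₂ S n J≤n) g≤e) tail) ,
          mk< (½ Q.* g) (Q.half (gap-pos 0<e))
            (mapᵉ (λ i ((K≤i , ix≤i) , g≤e) →
               chain′ (seq (f n) i) (approx n) (approx i) (Q.unit n) (seq e i)
                 (proj₂ C i n K≤i K≤n) (proj₂ (approx-close n i ix≤i)) (proj₂ S n J≤n) g≤e) tail)
          where
          from : ∀ N → Eventually (λ i → N ℕ.≤ i)
          from N = N , λ _ le → le
          tail : Eventually λ i → (K ℕ.≤ i × index n ℕ.≤ i) × g ℚ.≤ seq e i
          tail = (from K ⊗ from (index n)) ⊗ positive-tail 0<e

  ℝ-numbers : RealNumbers
  ℝ-numbers = record
    { commutativeRing        = ring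
    ; _<_                    = _<_
    ; <-isStrictPartialOrder = record
      { isEquivalence = ≈-isEquivalence
      ; irrefl        = <-irrefl
      ; trans         = <-trans
      ; <-resp-≈      = <-respʳ , <-respˡ
      }
    ; <-cotrans   = <-cotrans
    ; ≤-antisym   = ≤-antisym
    ; 0<1         = 0<1
    ; +-monoʳ-<   = +-monoʳ-<
    ; *-pos       = *-pos
    ; recip       = recip
    ; *-recip     = *-recip
    ; archimedean = archimedean
    ; complete    = λ f c → Limit.limit f c , Limit.converges f c
    }

module Geometry (R : RealNumbers) where
  open RealNumbers R

  ½ᴿ : Carrier
  ½ᴿ = recip (fromℕ 2) (0<fromℕ-suc 1)

  -- y = eᵗ = lim (1 + t/n)ⁿ
  IsExp : Carrier → Carrier → Set
  IsExp t y = ConvergesTo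
    (λ n → (1# + t * recip (fromℕ (suc n)) (0<fromℕ-suc n)) ^ suc n) y

  -- ℓ = ln x
  IsLn : Carrier → Carrier → Set
  IsLn x ℓ = IsExp ℓ x

  Point : ℕ → Set
  Point d = Vector Carrier d

  -- Sets of points are predicates that respect this equality.
  infix 4 _≋_
  _≋_ : ∀ {d} → Rel (Point d) 0ℓ
  _≋_ = Pointwise _≈_

  PointSet : ℕ → Set₁
  PointSet d = Pred (Point d) 0ℓ

  distSq : ∀ {d} → Point d → Point d → Carrier
  distSq x y = sum λ i → (x i - y i) ^ 2

  IsDist Dist≤ : ∀ {d} → Point d → Point d → Carrier → Set
  IsDist x y r = 0# ≤ r × distSq x y ≈ r ^ 2
  Dist≤  x y r = 0# ≤ r × distSq x y ≤ r ^ 2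

  Ball : ∀ d → Carrier → PointSet d
  Ball d T x = Dist≤ x (λ _ → 0#) T

  Segment : ∀ {d} → Point d → Point d → PointSet d
  Segment p q x = ∃[ t ] 0# ≤ t × t ≤ 1# × x ≋ (λ i → p i + t * (q i - p i))

  -- dist(x, L) ≤ r, where dist(x, L) is the infimum of the distances from x to
  -- the points of L
  DistToSet≤ : ∀ {d} → Point d → PointSet d → Carrier → Set
  DistToSet≤ x L r = ∀ δ → 0# < δ → ∃[ y ] y ∈ L × Dist≤ x y (r + δ)

  -- #A ≤ r.  The list may contain points outside A: without excluded middle one
  -- cannot in general single out its members that lie in A.
  Card≤ : ∀ {d} → PointSet d → Carrier → Set
  Card≤ A r = ∃[ xs ] (∀ x → x ∈ A → Any (x ≋_) xs) × fromℕ (length xs) ≤ r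

  record Intervals (d : ℕ) : Set where
    field
      lo hi : Point d
      lo≤hi : ∀ i → lo i ≤ hi i

    side : Fin d → Carrier
    side i = hi i - lo i

    volume : Carrier
    volume = product side

    region : PointSet d
    region x = ∀ i → lo i ≤ x i × x i ≤ hi i

  open Intervals

  IsIsometry : ∀ {d} → (Point d → Point d) → Set
  IsIsometry φ = (∀ x y → distSq (φ x) (φ y) ≈ distSq x y) × (∀ z → ∃[ x ] φ x ≋ z)

  record Box (d : ℕ) : Set where
    field
      intervals : Intervals d
      φ         : Point d → Point d
      isometry  : IsIsometry φ

    image : PointSet d
    image x = ∃[ y ] y ∈ region intervals × φ y ≋ x

  Cube : ∀ d → PointSet d
  Cube d x = ∀ i → - ½ᴿ ≤ x i × x i ≤ ½ᴿ

  Ranges : ℕ → Set₁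
  Ranges d = Pred (PointSet d) 0ℓ

  𝓑′ : ∀ d → Ranges d
  𝓑′ d S = S ⊆ Cube d × ∃[ b ] S ≐ Box.image b ×
    ∃[ j ] (∀ i k → i ≢ j → k ≢ j → side (Box.intervals b) i ≈ side (Box.intervals b) k)

  -- r ≤ μ(A) for the Lebesgue (outer) measure μ: r is at most the total volume
  -- of every countable cover of A by products of intervals.  Covers of infinite
  -- total volume impose nothing; asking for convergence of the series, and not
  -- just for bounded partial sums, keeps the notion correct constructively,
  -- where a cover of [0,1] may have all its partial sums below 1/2.
  infix 4 _≤μ_
  _≤μ_ : ∀ {d} → Carrier → PointSet d → Set
  _≤μ_ {d} r A = ∀ (Q : ℕ → Intervals d) → A ⊆ ⋃ ℕ (λ n → region (Q n)) →
    ∀ s → ConvergesTo (λ N → sum {N} λ i → volume (Q (toℕ i))) s → r ≤ s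

  IsNet : ∀ {d} → Ranges d → Carrier → PointSet d → Set₁
  IsNet {d} 𝓡 ε N = N Respects _≋_ × N ⊆ Cube d × (∀ S → 𝓡 S → ε ≤μ S → N ≬ S)

  -- A growth function g is given by its graph.

  Graph : Set₁
  Graph = Carrier → Carrier → Set

  HasGrowthRate : ∀ {d} → Graph → PointSet d → Set
  HasGrowthRate {d} g F = ∃[ C ] 0# < C × ∃[ T₀ ] (∀ T → T₀ ≤ T → ∀ v → g T v →
    Card≤ (Ball d T ∩ F) (C * v))

  _≫T^_ : Graph → ℕ → Set
  g ≫T^ d = ∃[ c ] 0# < c × ∃[ T₀ ] (∀ T → T₀ ≤ T → ∀ v → g T v → c * T ^ d ≤ v)

  record IsOpticalForest {d} (g : Graph) (F : PointSet d) : Set where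
    field
      respects : F Respects _≋_
      g≫T^d    : g ≫T^ d
      growth   : HasGrowthRate g F
      visible  : ∃[ C ] 0# < C × (∀ ε (0<ε : 0# < ε) → ε < 1# → ∀ p q →
                   IsDist p q (C * recip ε 0<ε ^ (d ℕ.∸ 1)) →
                   ∃[ x ] x ∈ F × DistToSet≤ x (Segment p q) ε)

  T^_lnT : ℕ → Graph
  T^ d lnT = λ T v → ∃[ ℓ ] IsLn T ℓ × v ≈ T ^ d * ℓ

open RealNumbers CauchyReals.ℝ-numbers public
open Geometry CauchyReals.ℝ-numbers public

{-# OPTIONS --safe #-}

-- For every p, a finite set of O(2ᵖ p) points of the unit cube meets every box
-- inside the cube, of arbitrary orientation, whose volume is at least 2⁻ᵖ and
-- whose sides are not much shorter than 2⁻ᵖ.  Work on a grid of mesh u ≈ 2⁻ᵖ.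
-- Images of sufficiently separated lattice points of the box round to distinct
-- grid points; they make up a fraction of order 2⁻ᵖ of the grid and satisfy
-- d pairs of linear inequalities with integer coefficients, which force any
-- grid point satisfying them into the box.  As there are only 2^O(p) such
-- systems of inequalities, choosing greedily a grid point which satisfies most
-- of the remaining systems yields a hitting set of size O(2ᵖ p).
--
-- Epsilon-nets: covering a box by cubes centred at a lattice of the box bounds
-- its outer measure by a multiple of the product of its sides, so that a box of
-- measure ε has volume and sides of order at least ε.
--
-- Optical forests: take the union over k of the dilations by 2ᵏ⁺² of the sets
-- with p = d (k + 2), each without the points close to the origin.  A segment of
-- length C ε^-(d-1) has a fixed fraction in one dyadic shell, and the
-- ε-neighbourhood of that fraction contains a box, obtained by reflecting the
-- first coordinate axis to the segment, of volume bounded below.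

module Submission where

-- Boxes form a continuum and comparisons of reals cannot be decided, whereas a greedy choice needs
-- a finite list of decidable tests. So the reals are gone before the choice starts: a test consists
-- of natural numbers, is evaluated on natural numbers, and the list of tests depends on p alone.
-- Reals return only to show that every box yields a test that is passed often, and only inside the
-- box. A real inequality and its integer version agree up to an error. This is why there is a
-- second length r, a fixed multiple of the mesh u: it is the margin between faces, test hyperplanes
-- and lattice layers. The logarithm has a single source: at most 2^j tests, each passed by 1/k of
-- the grid, are exhausted by k j + 1 greedy points, with k = O(2^p) and j = O(p). In the forest,
-- the length of order ε^-(d-1) is the one for which the volume of the box no longer depends on ε;
-- the constant makes it exactly 2^-p. Constructively, case distinctions on reals are made between
-- overlapping alternatives and decided by cotransitivity. Roundings, binary logarithms and dyadic
-- shells therefore carry some slack, which explains many of the constants.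

module Combinatorics where

  open import Data.Bool.Base using (Bool; true; false; not; if_then_else_)
  open import Data.Empty using (⊥-elim)
  open import Data.Fin.Base as Fin using (Fin; remQuot; combine)
  import Data.Fin.Properties as Fin
  open import Data.List.Base using (List; []; _∷_; length; map; _++_; cartesianProductWith; filter; filterᵇ; lookup)
  open import Data.List.Membership.Propositional using (_∈_)
  open import Data.List.Membership.Propositional.Properties using (∈-cartesianProductWith⁺; ∈-cartesianProductWith⁻; ∈-filter⁺)
  import Data.List.Properties as List
  open import Data.List.Relation.Unary.All as All using (All; []; _∷_)
  open import Data.List.Relation.Unary.Any as Any using (Any; here; there)
  open import Data.List.Relation.Unary.Any.Properties as Any using (++⁺ˡ; ++⁺ʳ; lookup-index)
  open import Data.List.Relation.Unary.All.Properties using (++⁺; all-filter)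
  open import Data.Nat.Base using (ℕ; zero; suc; _+_; _*_; _^_; _≤_; _<_; z≤n; s≤s)
  open import Data.Nat.ListAction using (sum)
  open import Data.Nat.Properties
  open import Data.Nat.Tactic.RingSolver using (solve-∀)
  open import Data.Product.Base using (∃-syntax; _×_; _,_; proj₁; proj₂)
  open import Data.Sum.Base using (_⊎_; inj₁; inj₂)
  open import Data.Vec.Base as Vec using (Vec; []; _∷_; tabulate)
  open import Function.Base using (_∘_)
  open import Relation.Binary.PropositionalEquality
  open import Relation.Nullary using (Dec; yes; no; does)
  open import Relation.Unary using (Decidable)

  -- Counting and averaging over lists

  private variable
    A B Θ : Set

  productℕ : ∀ {d} → (Fin d → ℕ) → ℕ
  productℕ {zero}  m = 1
  productℕ {suc d} m = m Fin.zero * productℕ (m ∘ Fin.suc)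

  -- A sum of indicators, and not the length of a filtered list, so that double counting is an
  -- interchange of two sums.
  count : (A → Bool) → List A → ℕ
  count p xs = sum (map (λ x → if p x then 1 else 0) xs)

  sum-map-+ : ∀ (f g : A → ℕ) xs → sum (map (λ x → f x + g x) xs) ≡ sum (map f xs) + sum (map g xs)
  sum-map-+ f g []       = refl
  sum-map-+ f g (x ∷ xs) = trans (cong (f x + g x +_) (sum-map-+ f g xs))
    (lemma (f x) (g x) (sum (map f xs)) (sum (map g xs)))
    where
    lemma : ∀ a b c d → a + b + (c + d) ≡ a + c + (b + d)
    lemma = solve-∀

  sum-map-0 : ∀ (xs : List A) → sum (map (λ _ → 0) xs) ≡ 0
  sum-map-0 []       = refl
  sum-map-0 (x ∷ xs) = sum-map-0 xs

  double-counting : ∀ (b : A → B → Bool) xs ys →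
    sum (map (λ x → count (b x) ys) xs) ≡ sum (map (λ y → count (λ x → b x y) xs) ys)
  double-counting b []       ys = sym (sum-map-0 ys)
  double-counting b (x ∷ xs) ys = trans (cong (count (b x) ys +_) (double-counting b xs ys))
    (sym (sum-map-+ (λ y → if b x y then 1 else 0) (λ y → count (λ x → b x y) xs) ys))

  count-not : ∀ (p : A → Bool) xs → length (filterᵇ (not ∘ p) xs) + count p xs ≡ length xs
  count-not p []       = refl
  count-not p (x ∷ xs) with p x
  ... | true  = trans (+-suc _ _) (cong suc (count-not p xs))
  ... | false = cong suc (count-not p xs)

  count-filter : ∀ (p : A → Bool) xs → length (filterᵇ p xs) ≡ count p xs
  count-filter p []       = refl
  count-filter p (x ∷ xs) with p x
  ... | true  = cong suc (count-filter p xs)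
  ... | false = count-filter p xs

  ∈-filterᵇ : ∀ (p : A → Bool) {x xs} → x ∈ xs → p x ≡ true → x ∈ filterᵇ p xs
  ∈-filterᵇ p {xs = y ∷ xs} (here refl) px with p y
  ∈-filterᵇ p {xs = y ∷ xs} (here refl) refl | true = here refl
  ∈-filterᵇ p {xs = y ∷ xs} (there x∈xs) px with p y
  ... | true  = there (∈-filterᵇ p x∈xs px)
  ... | false = ∈-filterᵇ p x∈xs px

  All-filterᵇ : ∀ {P : A → Set} (p : A → Bool) {xs} → All P xs → All P (filterᵇ p xs)
  All-filterᵇ p {[]}     []         = []
  All-filterᵇ p {x ∷ xs} (px ∷ pxs) with p x
  ... | true  = px ∷ All-filterᵇ p pxs
  ... | false = All-filterᵇ p pxs

  -- Pigeonhole on positions in the filtered list: a position determines its entry, so distinct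
  -- values of `f` occupy distinct positions, even if the list has repetitions.
  injection⇒count : ∀ {n} (f : Fin n → A) → (∀ {i j} → f i ≡ f j → i ≡ j) →
                    ∀ p xs → (∀ i → f i ∈ xs) → (∀ i → p (f i) ≡ true) → n ≤ count p xs
  injection⇒count f inj p xs f∈ pf = subst (_ ≤_) (count-filter p xs)
    (Fin.injective⇒≤ {f = index} λ {i} {j} eq →
      inj (trans (lookup-index (f∈′ i)) (trans (cong (lookup (filterᵇ p xs)) eq) (sym (lookup-index (f∈′ j))))))
    where
    f∈′ : ∀ i → f i ∈ filterᵇ p xs
    f∈′ i = ∈-filterᵇ p (f∈ i) (pf i)
    index : Fin _ → Fin (length (filterᵇ p xs))
    index i = Any.index (f∈′ i)

  -- If the head falls below `m`, the tail still averages at least `m`, for otherwise two strict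
  -- inequalities would add up to contradict the hypothesis. The comparisons are decidable, so the
  -- witness is found by search.
  averaging : ∀ m (f : A → ℕ) xs → 0 < length xs → length xs * m ≤ sum (map f xs) →
              ∃[ y ] y ∈ xs × m ≤ f y
  averaging m f (x ∷ xs) _ p with m ≤? f x
  ... | yes m≤fx = x , here refl , m≤fx
  averaging m f (x ∷ []) _ p | no m≰fx = ⊥-elim (m≰fx (subst₂ _≤_ (+-identityʳ m) (+-identityʳ (f x)) p))
  averaging m f (x ∷ xs@(_ ∷ _)) _ p | no m≰fx =
    let y , y∈ , m≤fy = averaging m f xs (s≤s z≤n)
          (≮⇒≥ λ q → <-irrefl refl (≤-<-trans p (+-mono-< (≰⇒> m≰fx) q)))
    in y , there y∈ , m≤fy

  -- Greedy hitting sets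

  module _ (hits : Θ → A → Bool) (X : List A) (nonempty : 0 < length X) (k : ℕ) where

    -- A density of at least 1/`k`, with the division cleared so that it is a decidable comparison
    -- of natural numbers.
    Fat : Θ → Set
    Fat θ = length X ≤ k * count (hits θ) X

    HitBy : List A → Θ → Set
    HitBy N θ = Any (λ x → hits θ x ≡ true) N

    private
      fat-sum : ∀ {𝓣} → All Fat 𝓣 → length X * length 𝓣 ≤ k * sum (map (λ θ → count (hits θ) X) 𝓣)
      fat-sum {[]}    []          = ≤-trans (≤-reflexive (*-zeroʳ (length X))) z≤n
      fat-sum {θ ∷ 𝓣} (fat ∷ fats) = begin
        length X * suc (length 𝓣)  ≡⟨ *-suc (length X) (length 𝓣) ⟩
        length X + length X * length 𝓣  ≤⟨ +-mono-≤ fat (fat-sum fats) ⟩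
        k * count (hits θ) X + k * _  ≡⟨ *-distribˡ-+ k (count (hits θ) X) _ ⟨
        k * (count (hits θ) X + _)  ∎
        where open ≤-Reasoning

      *-sum-map : ∀ (f : B → ℕ) ys → k * sum (map f ys) ≡ sum (map (λ y → k * f y) ys)
      *-sum-map f []       = *-zeroʳ k
      *-sum-map f (y ∷ ys) = trans (*-distribˡ-+ k (f y) _) (cong (k * f y +_) (*-sum-map f ys))

      -- Counted by tests, at least 1/`k` of all pairs of a point and a test are incidences; counted
      -- by points, some point attains at least the average.
      best : ∀ 𝓣 → All Fat 𝓣 → ∃[ x ] x ∈ X × length 𝓣 ≤ k * count (λ θ → hits θ x) 𝓣
      best 𝓣 fats = averaging (length 𝓣) (λ x → k * count (λ θ → hits θ x) 𝓣) X nonempty (begin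
        length X * length 𝓣  ≤⟨ fat-sum fats ⟩
        k * sum (map (λ θ → count (hits θ) X) 𝓣)  ≡⟨ cong (k *_) (double-counting hits 𝓣 X) ⟩
        k * sum (map (λ x → count (λ θ → hits θ x) 𝓣) X)  ≡⟨ *-sum-map _ X ⟩
        sum (map (λ x → k * count (λ θ → hits θ x) 𝓣) X)  ∎)
        where open ≤-Reasoning

      -- Fatness refers to the fixed list `X` and not to the tests still unhit, so the survivors in
      -- `left` can be fed to the next round.
      record Reduction (s b : ℕ) (𝓣 : List Θ) : Set where
        field
          chosen    : List A
          chosen≤   : length chosen ≤ s
          chosen∈   : All (_∈ X) chosen
          left      : List Θ
          left≤     : length left ≤ b
          left-fat  : All Fat left
          covers    : ∀ {θ} → θ ∈ 𝓣 → HitBy chosen θ ⊎ θ ∈ left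

      open Reduction

      survives : ∀ x {θ 𝓣} → θ ∈ 𝓣 → hits θ x ≡ true ⊎ θ ∈ filterᵇ (λ θ → not (hits θ x)) 𝓣
      survives x {θ} θ∈ with hits θ x in eq
      ... | true  = inj₁ refl
      ... | false = inj₂ (∈-filterᵇ _ θ∈ (cong not eq))

      -- As long as more than b tests are left, a best point hits at least b/k of them.
      reduce : ∀ s b 𝓣 → All Fat 𝓣 → k * length 𝓣 ≤ k * b + s * b → 0 < k → Reduction s b 𝓣
      reduce s b 𝓣 fats p 0<k with length 𝓣 ≤? b
      ... | yes q = record
        { chosen = [] ; chosen≤ = z≤n ; chosen∈ = [] ; left = 𝓣 ; left≤ = q ; left-fat = fats ; covers = inj₂ }
      reduce zero    b 𝓣 fats p 0<k@(s≤s {n = k-1} _) | no q =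
        ⊥-elim (q (*-cancelˡ-≤ k (subst (k * length 𝓣 ≤_) (+-identityʳ (k * b)) p)))
      reduce (suc s) b 𝓣 fats p 0<k | no q =
        let x , x∈ , best≤ = best 𝓣 fats
            𝓣′ = filterᵇ (λ θ → not (hits θ x)) 𝓣
            c  = count (λ θ → hits θ x) 𝓣
            -- The hypothesis works as a budget of `b` per round: the `c` tests hit by `x` satisfy b
            -- < length 𝓣 ≤ k c, so deleting them lowers k · length 𝓣 by at least `b`.
            r  = reduce s b 𝓣′ (All-filterᵇ _ fats) (+-cancelʳ-≤ b _ _ (begin
              k * length 𝓣′ + b  ≤⟨ +-monoʳ-≤ _ (≤-trans (<⇒≤ (≰⇒> q)) best≤) ⟩
              k * length 𝓣′ + k * c  ≡⟨ *-distribˡ-+ k (length 𝓣′) c ⟨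
              k * (length 𝓣′ + c)  ≡⟨ cong (k *_) (count-not (λ θ → hits θ x) 𝓣) ⟩
              k * length 𝓣  ≤⟨ p ⟩
              k * b + (b + s * b)  ≡⟨ lemma (k * b) b (s * b) ⟩
              k * b + s * b + b  ∎)) 0<k
        in record
          { chosen   = x ∷ chosen r
          ; chosen≤  = s≤s (chosen≤ r)
          ; chosen∈  = x∈ ∷ chosen∈ r
          ; left     = left r
          ; left≤    = left≤ r
          ; left-fat = left-fat r
          ; covers   = λ θ∈ → case (survives x θ∈) (covers r)
          }
        where
        open ≤-Reasoning
        lemma : ∀ a b c → a + (b + c) ≡ a + c + b
        lemma = solve-∀
        case : ∀ {θ x 𝓣′ N} {L : Set} → hits θ x ≡ true ⊎ θ ∈ 𝓣′ → (θ ∈ 𝓣′ → HitBy N θ ⊎ L) → HitBy (x ∷ N) θ ⊎ L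
        case (inj₁ hit) f = inj₁ (here hit)
        case (inj₂ θ∈)  f with f θ∈
        ... | inj₁ hit = inj₁ (there hit)
        ... | inj₂ l   = inj₂ l

      positive-count : ∀ p (ys : List A) → 0 < count p ys → ∃[ y ] y ∈ ys × p y ≡ true
      positive-count p (y ∷ ys) lt with p y in eq
      ... | true  = y , here refl , eq
      ... | false = let z , z∈ , pz = positive-count p ys lt in z , there z∈ , pz

      -- The last test costs at most one point: being fat over a nonempty `X`, it is passed by some
      -- point.
      finish : ∀ 𝓣 → All Fat 𝓣 → length 𝓣 ≤ 1 →
               ∃[ N ] length N ≤ 1 × All (_∈ X) N × (∀ {θ} → θ ∈ 𝓣 → HitBy N θ)
      finish []          fats       le = [] , z≤n , [] , λ ()
      finish (θ ∷ [])    (fat ∷ []) le with count (hits θ) X in eq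
      ... | zero  = ⊥-elim (<-irrefl refl (subst (1 ≤_) (*-zeroʳ k) (≤-trans nonempty fat)))
      ... | suc c =
        let y , y∈ , hit = positive-count (hits θ) X (subst (0 <_) (sym eq) (s≤s z≤n))
        in y ∷ [] , ≤-refl , y∈ ∷ [] , λ { (here refl) → here hit }
      finish (_ ∷ _ ∷ _) fats (s≤s ())

      -- While more than 2 ^ j tests remain, each greedy point removes at least 2 ^ j / k of them,
      -- so `k` points lead from 2 ^ (j + 1) tests to 2 ^ j. After all the halvings one test is
      -- left, whence the final 1.
      halve : ∀ j 𝓣 → All Fat 𝓣 → length 𝓣 ≤ 2 ^ j → 0 < k →
              ∃[ N ] length N ≤ k * j + 1 × All (_∈ X) N × (∀ {θ} → θ ∈ 𝓣 → HitBy N θ)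
      halve zero    𝓣 fats le 0<k = let N , N≤ , r = finish 𝓣 fats le in N , ≤-trans N≤ (m≤n+m 1 (k * 0)) , r
      halve (suc j) 𝓣 fats le 0<k =
        let r = reduce k (2 ^ j) 𝓣 fats (≤-trans (*-monoʳ-≤ k le) (≤-reflexive (lemma k (2 ^ j)))) 0<k
            N , N≤ , N∈ , hit = halve j (left r) (left-fat r) (left≤ r) 0<k
        in chosen r ++ N ,
           (begin
             length (chosen r ++ N)  ≡⟨ List.length-++ (chosen r) ⟩
             length (chosen r) + length N  ≤⟨ +-mono-≤ (chosen≤ r) N≤ ⟩
             k + (k * j + 1)  ≡⟨ lemma′ k j ⟩
             k * suc j + 1  ∎) ,
           ++⁺ (chosen∈ r) N∈ ,
           λ θ∈ → either (covers r θ∈) hit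
        where
        open ≤-Reasoning
        lemma : ∀ k b → k * (b + (b + 0)) ≡ k * b + k * b
        lemma = solve-∀
        lemma′ : ∀ k j → k + (k * j + 1) ≡ k * suc j + 1
        lemma′ = solve-∀
        either : ∀ {θ L N} {Z : Set} → HitBy L θ ⊎ Z → (Z → HitBy N θ) → HitBy (L ++ N) θ
        either (inj₁ h) f = ++⁺ˡ h
        either {L = L} (inj₂ h) f = ++⁺ʳ L (f h)

    -- Fatness can be checked by counting, so the thin tests are discarded beforehand and the set is
    -- built without reference to the boxes that the tests come from.
    hitting-set : ∀ j 𝓣 → length 𝓣 ≤ 2 ^ j → 0 < k →
      ∃[ N ] length N ≤ k * j + 1 × All (_∈ X) N × (∀ {θ} → θ ∈ 𝓣 → Fat θ → HitBy N θ)
    hitting-set j 𝓣 le 0<k =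
      let N , N≤ , N∈ , hit = halve j (filter Fat? 𝓣) (all-filter Fat? 𝓣) (≤-trans (List.length-filter Fat? 𝓣) le) 0<k
      in N , N≤ , N∈ , λ θ∈ fat → hit (∈-filter⁺ Fat? θ∈ fat)
      where
      Fat? : Decidable Fat
      Fat? θ = _ ≤? _

  -- Enumeration of vectors, and mixed-radix codes of tuples

  allVecs : List A → ∀ n → List (Vec A n)
  allVecs xs zero    = [] ∷ []
  allVecs xs (suc n) = cartesianProductWith _∷_ xs (allVecs xs n)

  length-cartesianProductWith : ∀ {C : Set} (f : A → B → C) xs ys →
                                length (cartesianProductWith f xs ys) ≡ length xs * length ys
  length-cartesianProductWith f []       ys = refl
  length-cartesianProductWith f (x ∷ xs) ys = trans (List.length-++ (map (f x) ys))
    (cong₂ _+_ (List.length-map (f x) ys) (length-cartesianProductWith f xs ys))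

  length-allVecs : ∀ (xs : List A) n → length (allVecs xs n) ≡ length xs ^ n
  length-allVecs xs zero    = refl
  length-allVecs xs (suc n) = trans (length-cartesianProductWith _∷_ xs (allVecs xs n))
    (cong (length xs *_) (length-allVecs xs n))

  ∈-allVecs⁺ : ∀ {xs : List A} {n} (f : Fin n → A) → (∀ i → f i ∈ xs) → tabulate f ∈ allVecs xs n
  ∈-allVecs⁺ {n = zero}  f p = here refl
  ∈-allVecs⁺ {n = suc n} f p = ∈-cartesianProductWith⁺ _∷_ (p Fin.zero) (∈-allVecs⁺ (f ∘ Fin.suc) (p ∘ Fin.suc))

  ∈-allVecs⁻ : ∀ {xs : List A} {n} {v} → v ∈ allVecs xs n → ∀ i → Vec.lookup v i ∈ xs
  ∈-allVecs⁻ {xs = xs} {suc n} v∈ i with ∈-cartesianProductWith⁻ _∷_ xs (allVecs xs n) v∈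
  ∈-allVecs⁻ v∈ Fin.zero    | _ , _ , x∈ , _  , refl = x∈
  ∈-allVecs⁻ v∈ (Fin.suc i) | _ , _ , _  , w∈ , refl = ∈-allVecs⁻ w∈ i

  does⇒ : ∀ {P : Set} (P? : Dec P) → does P? ≡ true → P
  does⇒ (yes p) _ = p

  sumℕ : ∀ {d} → (Fin d → ℕ) → ℕ
  sumℕ {zero}  m = 0
  sumℕ {suc d} m = m Fin.zero + sumℕ (m ∘ Fin.suc)

  -- Digits in mixed radix. A number in `Fin (productℕ m)` stands for a tuple because numbers can be
  -- counted and compared, whereas propositional equality of functions `∀ i → Fin (m i)` is not
  -- pointwise.
  decode : ∀ {d} (m : Fin d → ℕ) → Fin (productℕ m) → ∀ i → Fin (m i)
  decode m x Fin.zero    = proj₁ (remQuot (productℕ (m ∘ Fin.suc)) x)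
  decode m x (Fin.suc i) = decode (m ∘ Fin.suc) (proj₂ (remQuot {m Fin.zero} (productℕ (m ∘ Fin.suc)) x)) i

  decode-injective : ∀ {d} (m : Fin d → ℕ) {x y} → (∀ i → decode m x i ≡ decode m y i) → x ≡ y
  decode-injective {zero}  m {Fin.zero} {Fin.zero} _ = refl
  decode-injective {suc d} m {x} {y} eq = trans (sym (Fin.combine-remQuot {m Fin.zero} n x))
    (trans (cong₂ combine (eq Fin.zero) (decode-injective (m ∘ Fin.suc) (eq ∘ Fin.suc)))
      (Fin.combine-remQuot {m Fin.zero} n y))
    where
    n : ℕ
    n = productℕ (m ∘ Fin.suc)

  encode : ∀ {d} (m : Fin d → ℕ) → (∀ i → Fin (m i)) → Fin (productℕ m)
  encode {zero}  m f = Fin.zero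
  encode {suc d} m f = combine (f Fin.zero) (encode (m ∘ Fin.suc) (f ∘ Fin.suc))

  decode-encode : ∀ {d} (m : Fin d → ℕ) f i → decode m (encode m f) i ≡ f i
  decode-encode m f Fin.zero    = cong proj₁ (Fin.remQuot-combine (f Fin.zero) (encode (m ∘ Fin.suc) (f ∘ Fin.suc)))
  decode-encode m f (Fin.suc i) = trans
    (cong (λ z → decode (m ∘ Fin.suc) (proj₂ z) i) (Fin.remQuot-combine (f Fin.zero) (encode (m ∘ Fin.suc)
        (f ∘ Fin.suc))))
    (decode-encode (m ∘ Fin.suc) (f ∘ Fin.suc) i)

open import Defs using (RealNumbers; module Geometry; module CauchyReals)
open import Algebra.Bundles using (CommutativeRing)
import Algebra.Properties.CommutativeMonoid.Sum as CommutativeMonoidSum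
import Algebra.Properties.CommutativeSemiring.Exp as CommutativeSemiringExp
import Algebra.Properties.Ring as RingProperties
import Algebra.Properties.Semiring.Exp as SemiringExp
import Algebra.Properties.Semiring.Mult as SemiringMult
import Algebra.Properties.Semiring.Sum as SemiringSum
import Algebra.Solver.Ring as RingSolver
open import Algebra.Solver.Ring.AlmostCommutativeRing using (_-Raw-AlmostCommutative⟶_; fromCommutativeRing)
open import Data.Bool.Base using (Bool; if_then_else_; true)
open import Data.Empty using (⊥; ⊥-elim)
open import Data.Fin.Base as Fin using (Fin; punchIn; suc; toℕ; zero)
import Data.Fin.Properties as Fin
open import Data.Integer.Base as ℤ using (+_; -[1+_]; ℤ)
import Data.Integer.Properties as ℤ
open import Data.List.Base as List using (List; _++_; cartesianProductWith; length; upTo)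
open import Data.List.Membership.Propositional using (_∈_; find)
open import Data.List.Membership.Propositional.Properties using (∈-cartesianProductWith⁺; ∈-upTo⁺; ∈-upTo⁻)
import Data.List.Properties as List
open import Data.List.Relation.Unary.All as All using (All; _∷_)
import Data.List.Relation.Unary.All.Properties as All
open import Data.List.Relation.Unary.Any as Any using (Any; here; there)
import Data.List.Relation.Unary.Any.Properties as Any
open import Data.Maybe.Base using (Maybe; just; nothing)
open import Data.Nat.Base as ℕ using (suc; zero; ℕ)
import Data.Nat.Properties as ℕ
open import Data.Nat.Tactic.RingSolver using (solve-∀)
open import Data.Product.Base using (_,_; _×_; proj₁; proj₂; ∃; ∃-syntax)
open import Data.Sum.Base using ([_,_]′; _⊎_; inj₁; inj₂)
open import Data.Vec.Base as Vec using (Vec; lookup; tabulate)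
open import Data.Vec.Functional using (Vector; removeAt)
open import Data.Vec.Properties using (lookup∘tabulate; tabulate∘lookup)
open import Function.Base using (_∘_; const)
open import Relation.Binary.PropositionalEquality as ≡ using (_≡_; _≢_; refl)
import Relation.Binary.Reasoning.Base.Triple as Triple
import Relation.Binary.Reasoning.Setoid as SetoidReasoning
open import Relation.Binary.Structures using (IsPreorder; IsStrictPartialOrder)
open import Relation.Nullary using (Dec; _×-dec_; does; no; yes; ¬_)
open import Relation.Nullary.Decidable using (dec-true)
open import Relation.Unary using (_∩_; _≐_; _≬_; _⊆_)

module Proof (R : RealNumbers) where

  open Combinatorics
  open RealNumbers R
  open Geometry R

  -- Ordered fields

  open CommutativeRing commutativeRing public
    using (setoid; ring; commutativeSemiring; +-cong; +-congˡ; +-congʳ; *-cong; *-congˡ; *-congʳ;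
           +-assoc; +-comm; +-identityˡ; +-identityʳ; *-assoc; *-comm; *-identityˡ; *-identityʳ;
           zeroˡ; zeroʳ; distribˡ; distribʳ; -‿cong; -‿inverseˡ; -‿inverseʳ)
    renaming (refl to ≈-refl; sym to ≈-sym; trans to ≈-trans; reflexive to ≈-reflexive)
  open IsStrictPartialOrder <-isStrictPartialOrder public
    using (<-respʳ-≈; <-respˡ-≈; <-resp-≈; asym)
    renaming (irrefl to <-irrefl; trans to <-trans)
  open SemiringExp semiring public using (^-congˡ; ^-homo-*; ^-assocʳ)
  open CommutativeSemiringExp commutativeSemiring public using (^-distrib-*)

  module _ where
    open SemiringMult semiring using (×-homo-+; ×1-homo-*)

    fromℕ-+ : ∀ m n → fromℕ (m ℕ.+ n) ≈ fromℕ m + fromℕ n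
    fromℕ-+ = ×-homo-+ 1#

    fromℕ-* : ∀ m n → fromℕ (m ℕ.* n) ≈ fromℕ m * fromℕ n
    fromℕ-* = ×1-homo-*

  fromℕ-1 : fromℕ 1 ≈ 1#
  fromℕ-1 = +-identityʳ 1#

  fromℕ-^ : ∀ m n → fromℕ (m ℕ.^ n) ≈ fromℕ m ^ n
  fromℕ-^ m zero    = fromℕ-1
  fromℕ-^ m (suc n) = ≈-trans (fromℕ-* m (m ℕ.^ n)) (*-congˡ (fromℕ-^ m n))

  module ℤCoefficients where
    open RingProperties ring using (-‿distribˡ-*; -‿distribʳ-*; -‿involutive; -0#≈0#; -‿+-comm)

    fromℤ : ℤ → Carrier
    fromℤ (+ n)    = fromℕ n
    fromℤ -[1+ n ] = - fromℕ (suc n)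

    open SetoidReasoning setoid

    fromℤ-⊖ : ∀ m n → fromℤ (m ℤ.⊖ n) ≈ fromℕ m + - fromℕ n
    fromℤ-⊖ zero    zero    = ≈-sym (-‿inverseʳ 0#)
    fromℤ-⊖ zero    (suc n) = ≈-sym (+-identityˡ _)
    fromℤ-⊖ (suc m) zero    = ≈-sym (≈-trans (+-congˡ -0#≈0#) (+-identityʳ _))
    fromℤ-⊖ (suc m) (suc n) = begin
      fromℤ (suc m ℤ.⊖ suc n)  ≡⟨ ≡.cong fromℤ (ℤ.[1+m]⊖[1+n]≡m⊖n m n) ⟩
      fromℤ (m ℤ.⊖ n)  ≈⟨ fromℤ-⊖ m n ⟩
      fromℕ m + - fromℕ n  ≈⟨ +-congʳ (+-identityʳ _) ⟨
      (fromℕ m + 0#) + - fromℕ n  ≈⟨ +-congʳ (+-congˡ (-‿inverseʳ 1#)) ⟨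
      (fromℕ m + (1# + - 1#)) + - fromℕ n  ≈⟨ +-congʳ (+-assoc _ _ _) ⟨
      ((fromℕ m + 1#) + - 1#) + - fromℕ n  ≈⟨ +-assoc _ _ _ ⟩
      (fromℕ m + 1#) + (- 1# + - fromℕ n)  ≈⟨ +-cong (+-comm _ _) (-‿+-comm _ _) ⟩
      (1# + fromℕ m) + - (1# + fromℕ n)  ∎

    fromℤ-+ : ∀ i j → fromℤ (i ℤ.+ j) ≈ fromℤ i + fromℤ j
    fromℤ-+ (+ m)    (+ n)    = fromℕ-+ m n
    fromℤ-+ (+ m)    -[1+ n ] = fromℤ-⊖ m (suc n)
    fromℤ-+ -[1+ m ] (+ n)    = ≈-trans (fromℤ-⊖ n (suc m)) (+-comm _ _)
    fromℤ-+ -[1+ m ] -[1+ n ] = begin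
      - fromℕ (suc (suc (m ℕ.+ n)))  ≡⟨ ≡.cong (λ k → - fromℕ k) (≡.sym (ℕ.+-suc (suc m) n)) ⟩
      - fromℕ (suc m ℕ.+ suc n)  ≈⟨ -‿cong (fromℕ-+ (suc m) (suc n)) ⟩
      - (fromℕ (suc m) + fromℕ (suc n))  ≈⟨ -‿+-comm _ _ ⟨
      - fromℕ (suc m) + - fromℕ (suc n)  ∎

    fromℤ-neg : ∀ i → fromℤ (ℤ.- i) ≈ - fromℤ i
    fromℤ-neg (+ zero)  = ≈-sym -0#≈0#
    fromℤ-neg (+ suc n) = ≈-refl
    fromℤ-neg -[1+ n ]  = ≈-sym (-‿involutive _)

    fromℤ-*⁺ : ∀ m j → fromℤ (+ m ℤ.* j) ≈ fromℕ m * fromℤ j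
    fromℤ-*⁺ m (+ n)    = ≈-trans (≈-reflexive (≡.cong fromℤ (≡.sym (ℤ.pos-* m n)))) (fromℕ-* m n)
    fromℤ-*⁺ m -[1+ n ] = begin
      fromℤ (+ m ℤ.* -[1+ n ])  ≡⟨ ≡.cong fromℤ (≡.sym (ℤ.neg-distribʳ-* (+ m) (+ suc n))) ⟩
      fromℤ (ℤ.- (+ m ℤ.* + suc n))  ≈⟨ fromℤ-neg (+ m ℤ.* + suc n) ⟩
      - fromℤ (+ m ℤ.* + suc n)  ≈⟨ -‿cong (fromℤ-*⁺ m (+ suc n)) ⟩
      - (fromℕ m * fromℕ (suc n))  ≈⟨ -‿distribʳ-* _ _ ⟩
      fromℕ m * - fromℕ (suc n)  ∎

    fromℤ-* : ∀ i j → fromℤ (i ℤ.* j) ≈ fromℤ i * fromℤ j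
    fromℤ-* (+ m)    j = fromℤ-*⁺ m j
    fromℤ-* -[1+ m ] j = begin
      fromℤ (-[1+ m ] ℤ.* j)  ≡⟨ ≡.cong fromℤ (≡.sym (ℤ.neg-distribˡ-* (+ suc m) j)) ⟩
      fromℤ (ℤ.- (+ suc m ℤ.* j))  ≈⟨ fromℤ-neg (+ suc m ℤ.* j) ⟩
      - fromℤ (+ suc m ℤ.* j)  ≈⟨ -‿cong (fromℤ-*⁺ (suc m) j) ⟩
      - (fromℕ (suc m) * fromℤ j)  ≈⟨ -‿distribˡ-* _ _ ⟩
      - fromℕ (suc m) * fromℤ j  ∎

    ⟦_⟧ : ℤ → Carrier
    ⟦ + 1 ⟧ = 1#
    ⟦ i ⟧   = fromℤ i

    ⟦⟧≈ : ∀ i → ⟦ i ⟧ ≈ fromℤ i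
    ⟦⟧≈ (+ 0)           = ≈-refl
    ⟦⟧≈ (+ 1)           = ≈-sym fromℕ-1
    ⟦⟧≈ (+ suc (suc n)) = ≈-refl
    ⟦⟧≈ -[1+ n ]        = ≈-refl

    morphism : ℤ.+-*-rawRing -Raw-AlmostCommutative⟶ fromCommutativeRing commutativeRing
    morphism = record
      { ⟦_⟧    = ⟦_⟧
      ; +-homo = λ i j → ≈-trans (⟦⟧≈ (i ℤ.+ j)) (≈-trans (fromℤ-+ i j) (≈-sym (+-cong (⟦⟧≈ i) (⟦⟧≈ j))))
      ; *-homo = λ i j → ≈-trans (⟦⟧≈ (i ℤ.* j)) (≈-trans (fromℤ-* i j) (≈-sym (*-cong (⟦⟧≈ i) (⟦⟧≈ j))))
      ; -‿homo = λ i → ≈-trans (⟦⟧≈ (ℤ.- i)) (≈-trans (fromℤ-neg i) (≈-sym (-‿cong (⟦⟧≈ i))))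
      ; 0-homo = ≈-refl
      ; 1-homo = ≈-refl
      }

    _≟_ : ∀ i j → Maybe (⟦ i ⟧ ≈ ⟦ j ⟧)
    i ≟ j with i ℤ.≟ j
    ... | yes i≡j = just (≈-reflexive (≡.cong ⟦_⟧ i≡j))
    ... | no  _   = nothing

  -- The coefficient con (+ 1) is 1# and not fromℕ 1, which is 1# + 0#; for n ≠ 1,
  -- con (+ n) is fromℕ n.
  module Solver = RingSolver ℤ.+-*-rawRing
      (fromCommutativeRing commutativeRing) ℤCoefficients.morphism ℤCoefficients._≟_
  open Solver public using (solve; _:=_; _:+_; _:*_; _:-_; :-_; _:^_; con; Polynomial)

  ≤-refl : ∀ {x} → x ≤ x
  ≤-refl = <-irrefl ≈-refl

  <⇒≤ : ∀ {x y} → x < y → x ≤ y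
  <⇒≤ x<y y<x = asym x<y y<x

  ≈⇒≤ : ∀ {x y} → x ≈ y → x ≤ y
  ≈⇒≤ x≈y y<x = <-irrefl (≈-sym x≈y) y<x

  <-≤-trans : ∀ {x y z} → x < y → y ≤ z → x < z
  <-≤-trans {z = z} x<y y≤z with <-cotrans x<y z
  ... | inj₁ x<z = x<z
  ... | inj₂ z<y = ⊥-elim (y≤z z<y)

  ≤-<-trans : ∀ {x y z} → x ≤ y → y < z → x < z
  ≤-<-trans {x} x≤y y<z with <-cotrans y<z x
  ... | inj₁ y<x = ⊥-elim (x≤y y<x)
  ... | inj₂ x<z = x<z

  ≤-trans : ∀ {x y z} → x ≤ y → y ≤ z → x ≤ z
  ≤-trans x≤y y≤z z<x = y≤z (<-≤-trans z<x x≤y)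

  ≤-isPreorder : IsPreorder _≈_ _≤_
  ≤-isPreorder = record
    { isEquivalence = IsStrictPartialOrder.isEquivalence <-isStrictPartialOrder
    ; reflexive     = ≈⇒≤
    ; trans         = ≤-trans
    }

  module Reasoning = Triple ≤-isPreorder asym <-trans <-resp-≈ <⇒≤ <-≤-trans ≤-<-trans

  -- Two reals cannot be compared by a decision, but `_≤_` is a negation, so a proof of such an
  -- inequality may argue as if they could.
  ¬¬-total : ∀ x y → ¬ ¬ (x ≤ y ⊎ y ≤ x)
  ¬¬-total x y n = n (inj₁ λ y<x → n (inj₂ (<⇒≤ y<x)))

  +-mono-< : ∀ {x y u v} → x < y → u < v → x + u < y + v
  +-mono-< {x} {y} {u} {v} x<y u<v = <-trans (+-monoʳ-< x u<v)
    (<-respˡ-≈ (+-comm v x) (<-respʳ-≈ (+-comm v y) (+-monoʳ-< v x<y)))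

  -- An inequality depends only on the difference of its sides, so a linear consequence of added-up
  -- hypotheses amounts to one identity for the ring solver. Most estimates below go through this
  -- lemma and `lin`.
  lin< : ∀ {a b c d} → a < b → d - c ≈ b - a → c < d
  lin< {a} {b} {c} {d} a<b eq = <-respˡ-≈ (solve 2 (λ a c → (c :- a) :+ a := c) ≈-refl a c)
    (<-respʳ-≈ e (+-monoʳ-< (c - a) a<b))
    where
    open Reasoning
    e : (c - a) + b ≈ d
    e = begin-equality
      (c - a) + b  ≈⟨ solve 3 (λ a b c → (c :- a) :+ b := c :+ (b :- a)) ≈-refl a b c ⟩
      c + (b - a)  ≈⟨ +-congˡ eq ⟨
      c + (d - c)  ≈⟨ solve 2 (λ c d → c :+ (d :- c) := d) ≈-refl c d ⟩
      d  ∎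

  lin : ∀ {a b c d} → a ≤ b → d - c ≈ b - a → c ≤ d
  lin {a} {b} {c} {d} a≤b eq d<c = a≤b (lin< d<c (begin-equality
    a - b  ≈⟨ solve 2 (λ a b → a :- b := :- (b :- a)) ≈-refl a b ⟩
    - (b - a)  ≈⟨ -‿cong eq ⟨
    - (d - c)  ≈⟨ solve 2 (λ c d → :- (d :- c) := c :- d) ≈-refl c d ⟩
    c - d  ∎))
    where open Reasoning

  +-mono-≤ : ∀ {x y u v} → x ≤ y → u ≤ v → x + u ≤ y + v
  +-mono-≤ {x} {y} {u} {v} x≤y u≤v = ≤-trans
    (lin x≤y (solve 3 (λ x y u → (y :+ u) :- (x :+ u) := y :- x) ≈-refl x y u))
    (lin u≤v (solve 3 (λ y u v → (y :+ v) :- (y :+ u) := v :- u) ≈-refl y u v))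

  +-mono-<-≤ : ∀ {x y u v} → x < y → u ≤ v → x + u < y + v
  +-mono-<-≤ {x} {y} {u} {v} x<y u≤v = <-≤-trans
    (lin< x<y (solve 3 (λ x y u → (y :+ u) :- (x :+ u) := y :- x) ≈-refl x y u))
    (lin u≤v (solve 3 (λ y u v → (y :+ v) :- (y :+ u) := v :- u) ≈-refl y u v))

  0≤-⇒≤ : ∀ {x y} → 0# ≤ y - x → x ≤ y
  0≤-⇒≤ {x} {y} p = lin p (solve 2 (λ x y → y :- x := (y :- x) :- con (+ 0)) ≈-refl x y)

  ≤⇒0≤- : ∀ {x y} → x ≤ y → 0# ≤ y - x
  ≤⇒0≤- {x} {y} p = lin p (solve 2 (λ x y → (y :- x) :- con (+ 0) := y :- x) ≈-refl x y)

  <⇒0<- : ∀ {x y} → x < y → 0# < y - x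
  <⇒0<- {x} {y} p = lin< p (solve 2 (λ x y → (y :- x) :- con (+ 0) := y :- x) ≈-refl x y)

  0<-⇒< : ∀ {x y} → 0# < y - x → x < y
  0<-⇒< {x} {y} p = lin< p (solve 2 (λ x y → y :- x := (y :- x) :- con (+ 0)) ≈-refl x y)

  -- If the product were negative, neither factor could be zero, so each would be positive up to
  -- double negation, and this is enough to contradict `*-pos`.
  *-nonneg : ∀ {x y} → 0# ≤ x → 0# ≤ y → 0# ≤ x * y
  *-nonneg {x} {y} 0≤x 0≤y xy<0 = 0≮x λ 0<x → 0≮y λ 0<y → asym xy<0 (*-pos 0<x 0<y)
    where
    0≮x : ¬ ¬ (0# < x)
    0≮x x≤0 = <-irrefl (≈-trans (*-congʳ (≤-antisym x≤0 0≤x)) (zeroˡ y)) xy<0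
    0≮y : ¬ ¬ (0# < y)
    0≮y y≤0 = <-irrefl (≈-trans (*-congˡ (≤-antisym y≤0 0≤y)) (zeroʳ x)) xy<0

  *-monoˡ-≤ : ∀ {x y z} → 0# ≤ x → y ≤ z → x * y ≤ x * z
  *-monoˡ-≤ {x} {y} {z} 0≤x y≤z = 0≤-⇒≤ (≤-trans (*-nonneg 0≤x (≤⇒0≤- y≤z))
    (≈⇒≤ (solve 3 (λ x y z → x :* (z :- y) := x :* z :- x :* y) ≈-refl x y z)))

  *-monoʳ-≤ : ∀ {x y z} → 0# ≤ x → y ≤ z → y * x ≤ z * x
  *-monoʳ-≤ {x} {y} {z} 0≤x y≤z = 0≤-⇒≤ (≤-trans (*-nonneg 0≤x (≤⇒0≤- y≤z))
    (≈⇒≤ (solve 3 (λ x y z → x :* (z :- y) := z :* x :- y :* x) ≈-refl x y z)))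

  *-mono-≤ : ∀ {x y u v} → 0# ≤ x → 0# ≤ v → x ≤ y → u ≤ v → x * u ≤ y * v
  *-mono-≤ 0≤x 0≤v x≤y u≤v = ≤-trans (*-monoˡ-≤ 0≤x u≤v) (*-monoʳ-≤ 0≤v x≤y)

  *-monoˡ-< : ∀ {x y z} → 0# < x → y < z → x * y < x * z
  *-monoˡ-< {x} {y} {z} 0<x y<z = 0<-⇒< (<-respʳ-≈
    (solve 3 (λ x y z → x :* (z :- y) := x :* z :- x :* y) ≈-refl x y z) (*-pos 0<x (<⇒0<- y<z)))

  *-cancelˡ-≤ : ∀ {x y z} → 0# < x → x * y ≤ x * z → y ≤ z
  *-cancelˡ-≤ 0<x xy≤xz z<y = xy≤xz (*-monoˡ-< 0<x z<y)

  0≤-neg : ∀ {x} → x ≤ 0# → 0# ≤ - x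
  0≤-neg {x} p = lin p (solve 1 (λ x → :- x :- con (+ 0) := con (+ 0) :- x) ≈-refl x)

  square-nonneg : ∀ x → 0# ≤ x * x
  square-nonneg x xx<0 = ¬¬-total 0# x λ where
    (inj₁ 0≤x) → *-nonneg 0≤x 0≤x xx<0
    (inj₂ x≤0) → *-nonneg (0≤-neg x≤0) (0≤-neg x≤0)
      (<-respˡ-≈ (solve 1 (λ x → x :* x := :- x :* :- x) ≈-refl x) xx<0)

  0≤^2 : ∀ x → 0# ≤ x ^ 2
  0≤^2 x = ≤-trans (square-nonneg x) (≈⇒≤ (solve 1 (λ x → x :* x := x :^ 2) ≈-refl x))

  1*-cancel : ∀ {a x} → a ≈ 1# → a * x ≈ x
  1*-cancel {x = x} a≈1 = ≈-trans (*-congʳ a≈1) (*-identityˡ x)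

  0≤1 : 0# ≤ 1#
  0≤1 = <⇒≤ 0<1

  0<fromℕ* : ∀ n {x} → 0# < fromℕ n * x → 0# < x
  0<fromℕ* zero    {x} p = ⊥-elim (<-irrefl (≈-sym (zeroˡ x)) p)
  0<fromℕ* (suc n) {x} p with <-cotrans p x
  ... | inj₁ 0<x = 0<x
  ... | inj₂ x<  = 0<fromℕ* n (lin< x< (solve 2 (λ n x → n :* x :- con (+ 0) := (con (+ 1) :+ n) :* x :- x) ≈-refl
      (fromℕ n) x))

  -- The axioms give only the equation x · recip x ≈ 1, and positivity asks for more than the
  -- absence of a contradiction. The Archimedean bound x < n yields 1 ≤ n · recip x, and `0<fromℕ*`
  -- peels off summands by cotransitivity until a single copy is seen to be positive.
  recip-pos : ∀ x (0<x : 0# < x) → 0# < recip x 0<x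
  recip-pos x 0<x = 0<fromℕ* n 0<n*r
    where
    open Reasoning
    r : Carrier
    r = recip x 0<x
    n : ℕ
    n = proj₁ (archimedean x)
    0≤r : 0# ≤ r
    0≤r r<0 = asym 0<1 (begin-strict
      1#  ≈⟨ *-recip x 0<x ⟨
      x * r  <⟨ *-monoˡ-< 0<x r<0 ⟩
      x * 0#  ≈⟨ zeroʳ x ⟩
      0#  ∎)
    0<n*r : 0# < fromℕ n * r
    0<n*r = begin-strict
      0#  <⟨ 0<1 ⟩
      1#  ≈⟨ *-recip x 0<x ⟨
      x * r  ≤⟨ *-monoʳ-≤ 0≤r (<⇒≤ (proj₂ (archimedean x))) ⟩
      fromℕ n * r  ∎

  -- Sums, products, rounding and logarithms

  fromℕ-nonneg : ∀ n → 0# ≤ fromℕ n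
  fromℕ-nonneg zero    = ≤-refl
  fromℕ-nonneg (suc n) = <⇒≤ (0<fromℕ-suc n)

  fromℕ-mono-≤ : ∀ {m n} → m ℕ.≤ n → fromℕ m ≤ fromℕ n
  fromℕ-mono-≤ {n = n} ℕ.z≤n = fromℕ-nonneg n
  fromℕ-mono-≤ (ℕ.s≤s m≤n) = +-mono-≤ ≤-refl (fromℕ-mono-≤ m≤n)

  fromℕ-mono-< : ∀ {m n} → m ℕ.< n → fromℕ m < fromℕ n
  fromℕ-mono-< {m} m<n = <-≤-trans
    (lin< 0<1 (solve 1 (λ m → (con (+ 1) :+ m) :- m := con (+ 1) :- con (+ 0)) ≈-refl (fromℕ m)))
    (fromℕ-mono-≤ m<n)

  fromℕ-cancel-≤ : ∀ {m n} → fromℕ m ≤ fromℕ n → m ℕ.≤ n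
  fromℕ-cancel-≤ {m} {n} p with m ℕ.≤? n
  ... | yes m≤n = m≤n
  ... | no  m≰n = ⊥-elim (p (fromℕ-mono-< (ℕ.≰⇒> m≰n)))

  1≤fromℕ : ∀ {n} → 1 ℕ.≤ n → 1# ≤ fromℕ n
  1≤fromℕ p = ≤-trans (≈⇒≤ (≈-sym fromℕ-1)) (fromℕ-mono-≤ p)

  ^-nonneg : ∀ {x} n → 0# ≤ x → 0# ≤ x ^ n
  ^-nonneg zero    0≤x = 0≤1
  ^-nonneg (suc n) 0≤x = *-nonneg 0≤x (^-nonneg n 0≤x)

  ^-pos : ∀ {x} n → 0# < x → 0# < x ^ n
  ^-pos zero    0<x = 0<1
  ^-pos (suc n) 0<x = *-pos 0<x (^-pos n 0<x)

  ^-mono-≤ : ∀ {x y} n → 0# ≤ x → x ≤ y → x ^ n ≤ y ^ n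
  ^-mono-≤ zero    0≤x x≤y = ≤-refl
  ^-mono-≤ (suc n) 0≤x x≤y = *-mono-≤ 0≤x (^-nonneg n (≤-trans 0≤x x≤y)) x≤y (^-mono-≤ n 0≤x x≤y)

  1^n : ∀ n → 1# ^ n ≈ 1#
  1^n zero    = ≈-refl
  1^n (suc n) = ≈-trans (*-identityˡ _) (1^n n)

  square-cancel-≤ : ∀ {x y} → 0# ≤ y → x ^ 2 ≤ y ^ 2 → x ≤ y
  square-cancel-≤ {x} {y} 0≤y p y<x = p (begin-strict
    y ^ 2  ≈⟨ solve 1 (λ y → y :^ 2 := y :* y) ≈-refl y ⟩
    y * y  ≤⟨ *-monoˡ-≤ 0≤y (<⇒≤ y<x) ⟩
    y * x  ≈⟨ *-comm y x ⟩
    x * y  <⟨ *-monoˡ-< (≤-<-trans 0≤y y<x) y<x ⟩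
    x * x  ≈⟨ solve 1 (λ y → y :^ 2 := y :* y) ≈-refl x ⟨
    x ^ 2  ∎)
    where open Reasoning

  infix 4 ∣_∣≤_
  ∣_∣≤_ : Carrier → Carrier → Set
  ∣ x ∣≤ e = x ≤ e × - x ≤ e

  abs-bound-nonneg : ∀ {x e} → ∣ x ∣≤ e → 0# ≤ e
  abs-bound-nonneg {x} {e} (p , q) e<0 = ≤-trans
    (≈⇒≤ (solve 1 (λ x → con (+ 0) := x :+ :- x) ≈-refl x)) (+-mono-≤ p q)
    (<-respʳ-≈ (+-identityˡ 0#) (+-mono-< e<0 e<0))

  abs-cong : ∀ {x y e} → x ≈ y → ∣ x ∣≤ e → ∣ y ∣≤ e
  abs-cong x≈y (p , q) = ≤-trans (≈⇒≤ (≈-sym x≈y)) p , ≤-trans (≈⇒≤ (-‿cong (≈-sym x≈y))) q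

  abs-weaken : ∀ {x e e′} → e ≤ e′ → ∣ x ∣≤ e → ∣ x ∣≤ e′
  abs-weaken e≤e′ (p , q) = ≤-trans p e≤e′ , ≤-trans q e≤e′

  abs-neg : ∀ {x e} → ∣ x ∣≤ e → ∣ - x ∣≤ e
  abs-neg {x} (p , q) = q , ≤-trans (≈⇒≤ (solve 1 (λ x → :- (:- x) := x) ≈-refl x)) p

  abs-+ : ∀ {x y a b} → ∣ x ∣≤ a → ∣ y ∣≤ b → ∣ x + y ∣≤ a + b
  abs-+ {x} {y} (p , q) (r , s) = +-mono-≤ p r ,
    ≤-trans (≈⇒≤ (solve 2 (λ x y → :- (x :+ y) := :- x :+ :- y) ≈-refl x y)) (+-mono-≤ q s)

  abs-* : ∀ {x y a b} → ∣ x ∣≤ a → ∣ y ∣≤ b → ∣ x * y ∣≤ a * b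
  abs-* {x} {y} {a} {b} p q = upper p q ,
    ≤-trans (≈⇒≤ (solve 2 (λ x y → :- (x :* y) := :- x :* y) ≈-refl x y)) (upper (abs-neg p) q)
    where
    upper : ∀ {x} → ∣ x ∣≤ a → ∣ y ∣≤ b → x * y ≤ a * b
    upper {x} p@(x≤a , -x≤a) q@(y≤b , -y≤b) lt = ¬¬-total 0# y λ
      { (inj₁ 0≤y) → bound 0≤y x≤a y≤b lt
      ; (inj₂ y≤0) → bound (0≤-neg y≤0) -x≤a -y≤b
                       (<-respʳ-≈ (solve 2 (λ x y → x :* y := :- x :* :- y) ≈-refl x y) lt)
      }
      where
      bound : ∀ {x y} → 0# ≤ y → x ≤ a → y ≤ b → x * y ≤ a * b
      bound 0≤y x≤a y≤b = ≤-trans (*-monoʳ-≤ 0≤y x≤a) (*-monoˡ-≤ (abs-bound-nonneg p) y≤b)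

  square⇒abs : ∀ {x e} → 0# ≤ e → x ^ 2 ≤ e ^ 2 → ∣ x ∣≤ e
  square⇒abs {x} 0≤e p = square-cancel-≤ 0≤e p ,
    square-cancel-≤ 0≤e (≤-trans (≈⇒≤ (solve 1 (λ x → (:- x) :^ 2 := x :^ 2) ≈-refl x)) p)

  abs⇒square : ∀ {x e} → ∣ x ∣≤ e → x ^ 2 ≤ e ^ 2
  abs⇒square {x} {e} p = ≤-trans (≈⇒≤ (solve 1 (λ x → x :^ 2 := x :* x) ≈-refl x))
    (≤-trans (proj₁ (abs-* p p)) (≈⇒≤ (solve 1 (λ x → x :* x := x :^ 2) ≈-refl e)))

  abs-nonneg : ∀ {x e} → 0# ≤ x → x ≤ e → ∣ x ∣≤ e
  abs-nonneg {x} 0≤x x≤e = x≤e , ≤-trans (lin 0≤x (solve 1 (λ x → con (+ 0) :- :- x := x :- con (+ 0)) ≈-refl x))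
      (≤-trans 0≤x x≤e)

  module _ where
    private
      module S = SemiringSum semiring
      module P = CommutativeMonoidSum (CommutativeRing.*-commutativeMonoid commutativeRing)

    sum-cong : ∀ {n} {f g : Vector Carrier n} → (∀ i → f i ≈ g i) → sum f ≈ sum g
    sum-cong = S.sum-cong-≋

    sum-+ : ∀ {n} (f g : Vector Carrier n) → sum (λ i → f i + g i) ≈ sum f + sum g
    sum-+ = S.∑-distrib-+

    *-sum : ∀ {n} c (f : Vector Carrier n) → sum (λ i → c * f i) ≈ c * sum f
    *-sum c f = ≈-sym (S.*-distribˡ-sum c f)

    sum-const : ∀ n c → sum {n} (const c) ≈ fromℕ n * c
    sum-const zero    c = ≈-sym (zeroˡ c)
    sum-const (suc n) c = ≈-trans (+-congˡ (sum-const n c))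
      (solve 2 (λ n c → c :+ n :* c := (con (+ 1) :+ n) :* c) ≈-refl (fromℕ n) c)

    sum-remove : ∀ {n} (i : Fin (suc n)) f → sum f ≈ f i + sum (removeAt f i)
    sum-remove i f = S.sum-remove {i = i} f

    product-cong : ∀ {n} {f g : Vector Carrier n} → (∀ i → f i ≈ g i) → product f ≈ product g
    product-cong = P.sum-cong-≋

    product-* : ∀ {n} (f g : Vector Carrier n) → product (λ i → f i * g i) ≈ product f * product g
    product-* = P.∑-distrib-+

    product-const : ∀ n c → product {n} (const c) ≈ c ^ n
    product-const zero    c = ≈-refl
    product-const (suc n) c = *-congˡ (product-const n c)

    product-remove : ∀ {n} (i : Fin (suc n)) f → product f ≈ f i * product (removeAt f i)
    product-remove i f = P.sum-remove {i = i} f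

  sum-neg : ∀ {n} (f : Vector Carrier n) → sum (λ i → - f i) ≈ - sum f
  sum-neg {zero}  f = solve 0 (con (+ 0) := :- con (+ 0)) ≈-refl
  sum-neg {suc n} f = ≈-trans (+-congˡ (sum-neg (f ∘ suc)))
    (solve 2 (λ x y → :- x :+ :- y := :- (x :+ y)) ≈-refl (f zero) (sum (f ∘ suc)))

  sum-- : ∀ {n} (f g : Vector Carrier n) → sum (λ i → f i - g i) ≈ sum f - sum g
  sum-- f g = ≈-trans (sum-+ f (λ i → - g i)) (+-congˡ (sum-neg g))

  sum-mono-≤ : ∀ {n} {f g : Vector Carrier n} → (∀ i → f i ≤ g i) → sum f ≤ sum g
  sum-mono-≤ {zero}  p = ≤-refl
  sum-mono-≤ {suc n} p = +-mono-≤ (p zero) (sum-mono-≤ (p ∘ suc))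

  sum-nonneg : ∀ {n} {f : Vector Carrier n} → (∀ i → 0# ≤ f i) → 0# ≤ sum f
  sum-nonneg {zero}  p = ≤-refl
  sum-nonneg {suc n} p = ≤-trans (≈⇒≤ (≈-sym (+-identityˡ 0#))) (+-mono-≤ (p zero) (sum-nonneg (p ∘ suc)))

  sum-zero : ∀ {n} {f : Vector Carrier n} → (∀ i → f i ≈ 0#) → sum f ≈ 0#
  sum-zero {n} p = ≈-trans (sum-cong p) (≈-trans (sum-const n 0#) (zeroʳ _))

  sum-single : ∀ {n} (i : Fin n) {f : Vector Carrier n} → (∀ k → k ≢ i → f k ≈ 0#) → sum f ≈ f i
  sum-single {suc n} i {f} p = ≈-trans (sum-remove i f)
    (≈-trans (+-congˡ (sum-zero λ k → p (punchIn i k) (Fin.punchInᵢ≢i i k))) (+-identityʳ (f i)))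

  term≤sum : ∀ {n} {f : Vector Carrier n} → (∀ i → 0# ≤ f i) → ∀ i → f i ≤ sum f
  term≤sum {suc n} {f} p i = begin
    f i  ≈⟨ +-identityʳ (f i) ⟨
    f i + 0#  ≤⟨ +-mono-≤ ≤-refl (sum-nonneg λ k → p (punchIn i k)) ⟩
    f i + sum (removeAt f i)  ≈⟨ sum-remove i f ⟨
    sum f  ∎
    where open Reasoning

  abs-sum : ∀ {n} {f : Vector Carrier n} {e} → (∀ i → ∣ f i ∣≤ e) → ∣ sum f ∣≤ fromℕ n * e
  abs-sum {n} {f} {e} p =
    ≤-trans (sum-mono-≤ (proj₁ ∘ p)) (≈⇒≤ (sum-const n e)) ,
    ≤-trans (≈⇒≤ (≈-sym (sum-neg f))) (≤-trans (sum-mono-≤ (proj₂ ∘ p)) (≈⇒≤ (sum-const n e)))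

  product-nonneg : ∀ {n} {f : Vector Carrier n} → (∀ i → 0# ≤ f i) → 0# ≤ product f
  product-nonneg {zero}  p = 0≤1
  product-nonneg {suc n} p = *-nonneg (p zero) (product-nonneg (p ∘ suc))

  product-mono-≤ : ∀ {n} {f g : Vector Carrier n} → (∀ i → 0# ≤ f i) → (∀ i → f i ≤ g i) →
                   product f ≤ product g
  product-mono-≤ {zero}  p q = ≤-refl
  product-mono-≤ {suc n} p q = *-mono-≤ (p zero)
    (product-nonneg λ i → ≤-trans (p (suc i)) (q (suc i))) (q zero) (product-mono-≤ (p ∘ suc) (q ∘ suc))

  product-scale : ∀ {n} c (f : Vector Carrier n) → product (λ i → c * f i) ≈ c ^ n * product f
  product-scale {n} c f = ≈-trans (product-* (const c) f) (*-congʳ (product-const n c))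

  sum-fromℕ : ∀ {n} (m : Vector ℕ n) → sum (λ i → fromℕ (m i)) ≈ fromℕ (sumℕ m)
  sum-fromℕ {zero}  m = ≈-refl
  sum-fromℕ {suc n} m = ≈-trans (+-congˡ (sum-fromℕ (m ∘ suc)))
    (≈-sym (fromℕ-+ (m zero) (sumℕ (m ∘ suc))))

  product-fromℕ : ∀ {n} (m : Vector ℕ n) → product (λ i → fromℕ (m i)) ≈ fromℕ (productℕ m)
  product-fromℕ {zero}  m = ≈-sym fromℕ-1
  product-fromℕ {suc n} m = ≈-trans (*-congˡ (product-fromℕ (m ∘ suc)))
    (≈-sym (fromℕ-* (m zero) (productℕ (m ∘ suc))))

  -- An exact integer part would require deciding comparisons with integers. Intervals of length 2
  -- overlap, so cotransitivity at two consecutive integers can choose between stopping and going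
  -- down; `N` bounds the descent.
  floor : ∀ N x → 0# ≤ x → x ≤ fromℕ (2 ℕ.+ N) → ∃[ n ] n ℕ.≤ N × fromℕ n ≤ x × x ≤ fromℕ (2 ℕ.+ n)
  floor zero    x 0≤x x≤2 = 0 , ℕ.z≤n , 0≤x , x≤2
  floor (suc N) x 0≤x x≤  = [ above , below ]′ (<-cotrans (fromℕ-mono-< {suc N} {suc (suc N)} (ℕ.n<1+n (suc N))) x)
    where
    Goal : Set
    Goal = ∃[ n ] n ℕ.≤ suc N × fromℕ n ≤ x × x ≤ fromℕ (2 ℕ.+ n)
    above : fromℕ (suc N) < x → Goal
    above N<x = suc N , ℕ.≤-refl , <⇒≤ N<x , x≤
    below : x < fromℕ (2 ℕ.+ N) → Goal
    below x< =
      let n , n≤N , lo , hi = floor N x 0≤x (<⇒≤ x<)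
      in n , ℕ.m≤n⇒m≤1+n n≤N , lo , hi

  round : ∀ {M} → 1 ℕ.≤ M → ∀ x → 0# ≤ x → x ≤ fromℕ M → ∃[ n ] n ℕ.≤ M × ∣ fromℕ n - x ∣≤ 1#
  round {suc N} _ x 0≤x x≤ =
    let n , n≤N , lo , hi = floor N x 0≤x (≤-trans x≤ (fromℕ-mono-≤ (ℕ.n≤1+n (suc N))))
    -- The midpoint of the interval from n to n + 2 found by `floor`.
    in suc n , ℕ.s≤s n≤N ,
       lin lo (solve 2 (λ n x → con (+ 1) :- ((con (+ 1) :+ n) :- x) := x :- n) ≈-refl (fromℕ n) x) ,
       lin hi (solve 2 (λ n x → con (+ 1) :- :- ((con (+ 1) :+ n) :- x) := (con (+ 1) :+ (con (+ 1) :+ n)) :- x)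
                 ≈-refl (fromℕ n) x)

  n<2^n : ∀ n → n ℕ.< 2 ℕ.^ n
  n<2^n zero    = ℕ.s≤s ℕ.z≤n
  n<2^n (suc n) = begin
    1 ℕ.+ suc n  ≤⟨ ℕ.+-mono-≤ (ℕ.m^n>0 2 n) (n<2^n n) ⟩
    2 ℕ.^ n ℕ.+ 2 ℕ.^ n  ≡⟨ ≡.cong (2 ℕ.^ n ℕ.+_) (≡.sym (ℕ.+-identityʳ _)) ⟩
    2 ℕ.^ suc n  ∎
    where open ℕ.≤-Reasoning

  2^[1+n] : ∀ n → fromℕ (2 ℕ.^ suc n) ≈ fromℕ 2 * fromℕ (2 ℕ.^ n)
  2^[1+n] n = fromℕ-* 2 (2 ℕ.^ n)

  0<2 : 0# < fromℕ 2
  0<2 = 0<fromℕ-suc 1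

  -- From a power above `x` the exponent is lowered for as long as 2 x is seen to be below 2 ^ (p +
  -- 1). The comparison with both 2 ^ p and 2 ^ (p + 1) leaves an overlap, hence the factor 4 in
  -- place of 2; the summand 1 serves the case in which the exponent reaches 0.
  log₂ : ∀ x → 0# ≤ x → ∃[ p ] x ≤ fromℕ (2 ℕ.^ p) × fromℕ (2 ℕ.^ p) ≤ fromℕ 4 * x + 1#
  log₂ x 0≤x =
    let n , x<n = archimedean x
    in search n (≤-trans (<⇒≤ x<n) (fromℕ-mono-≤ (ℕ.<⇒≤ (n<2^n n))))
    where
    open Reasoning
    search : ∀ p → x ≤ fromℕ (2 ℕ.^ p) → ∃[ p ] x ≤ fromℕ (2 ℕ.^ p) × fromℕ (2 ℕ.^ p) ≤ fromℕ 4 * x + 1#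
    search zero    x≤ = 0 , x≤ , (begin
      fromℕ 1  ≈⟨ solve 0 (con (+ 1) :+ con (+ 0) := con (+ 0) :+ con (+ 1)) ≈-refl ⟩
      0# + 1#  ≤⟨ +-mono-≤ (*-nonneg (fromℕ-nonneg 4) 0≤x) ≤-refl ⟩
      fromℕ 4 * x + 1#  ∎)
    search (suc p) x≤ = [ above , below ]′
      (<-cotrans (fromℕ-mono-< {2 ℕ.^ p} {2 ℕ.^ suc p} (ℕ.^-monoʳ-< 2 (ℕ.s≤s (ℕ.s≤s ℕ.z≤n)) (ℕ.n<1+n p)))
          (fromℕ 2 * x))
      where
      Goal : Set
      Goal = ∃[ p ] x ≤ fromℕ (2 ℕ.^ p) × fromℕ (2 ℕ.^ p) ≤ fromℕ 4 * x + 1#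
      above : fromℕ (2 ℕ.^ p) < fromℕ 2 * x → Goal
      above 2^p<2x = suc p , x≤ , (begin
        fromℕ (2 ℕ.^ suc p)  ≈⟨ 2^[1+n] p ⟩
        fromℕ 2 * fromℕ (2 ℕ.^ p)  ≤⟨ *-monoˡ-≤ (fromℕ-nonneg 2) (<⇒≤ 2^p<2x) ⟩
        fromℕ 2 * (fromℕ 2 * x)  ≈⟨ solve 1 (λ x → con (+ 2) :* (con (+ 2) :* x) := con (+ 4) :* x :+ con (+ 0))
            ≈-refl x ⟩
        fromℕ 4 * x + 0#  ≤⟨ +-mono-≤ ≤-refl 0≤1 ⟩
        fromℕ 4 * x + 1#  ∎)
      below : fromℕ 2 * x < fromℕ (2 ℕ.^ suc p) → Goal
      below 2x< = search p (*-cancelˡ-≤ 0<2 (≤-trans (<⇒≤ 2x<) (≈⇒≤ (2^[1+n] p))))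

  -- An upper counterpart of Bernoulli's inequality. Multiplying 1 + 2 k x by 1 + x adds x and a
  -- cross term 2 k x · x, which is at most another x as long as 2 k x ≤ 1: hence the factor 2.
  bernoulli : ∀ x k → 0# ≤ x → fromℕ 2 * (fromℕ k * x) ≤ 1# →
              (1# + x) ^ k ≤ 1# + fromℕ 2 * (fromℕ k * x)
  bernoulli x zero    0≤x _ = ≈⇒≤ (solve 1 (λ x → con (+ 1) := con (+ 1) :+ con (+ 2) :* (con (+ 0) :* x)) ≈-refl x)
  bernoulli x (suc k) 0≤x p = begin
    (1# + x) * (1# + x) ^ k  ≤⟨ *-monoˡ-≤ (≤-trans 0≤x x≤1+x) (bernoulli x k 0≤x (≤-trans q p)) ⟩
    (1# + x) * (1# + y)  ≈⟨ solve 2 (λ x y → (con (+ 1) :+ x) :* (con (+ 1) :+ y) :=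
                                                   ((con (+ 1) :+ x) :+ y) :+ x :* y) ≈-refl x y ⟩
    ((1# + x) + y) + x * y  ≤⟨ +-mono-≤ ≤-refl (*-monoˡ-≤ 0≤x (≤-trans q p)) ⟩
    ((1# + x) + y) + x * 1#  ≈⟨ solve 2 (λ x k → ((con (+ 1) :+ x) :+ con (+ 2) :* (k :* x)) :+ x :* con (+ 1) :=
                                     con (+ 1) :+ con (+ 2) :* ((con (+ 1) :+ k) :* x)) ≈-refl x (fromℕ k) ⟩
    1# + fromℕ 2 * (fromℕ (suc k) * x)  ∎
    where
    open Reasoning
    y : Carrier
    y = fromℕ 2 * (fromℕ k * x)
    x≤1+x : x ≤ 1# + x
    x≤1+x = lin 0≤1 (solve 1 (λ x → (con (+ 1) :+ x) :- x := con (+ 1) :- con (+ 0)) ≈-refl x)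
    q : y ≤ fromℕ 2 * (fromℕ (suc k) * x)
    q = *-monoˡ-≤ (fromℕ-nonneg 2) (*-monoʳ-≤ 0≤x (fromℕ-mono-≤ (ℕ.n≤1+n k)))

  -- The sequence defining the exponential is read at n + 1 = (m + 1) Q with Q = q + 1. If 2 ℓ < Q,
  -- its base is at most 1 + x with 2 (m + 1) x = 1, so `bernoulli` bounds each block of m + 1
  -- factors by 2 and the power by 2 ^ Q. The tolerance 1 of the convergence at most doubles this
  -- bound, which would give y < 2 ^ (2 + q).
  ln-lower : ∀ q {y ℓ} → IsLn y ℓ → fromℕ (2 ℕ.^ (2 ℕ.+ q)) ≤ y → fromℕ (suc q) ≤ fromℕ 2 * ℓ
  ln-lower q {y} {ℓ} ln 2^≤y 2ℓ<Q = <-irrefl ≈-refl (begin-strict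
    fromℕ (2 ℕ.^ (2 ℕ.+ q))  ≤⟨ 2^≤y ⟩
    y  <⟨ proj₂ (proj₂ (ln 1# 0<1) n N≤n) ⟩
    b ^ suc n + 1#  ≤⟨ +-mono-≤ power≤ (1≤fromℕ (ℕ.m^n>0 2 (suc q))) ⟩
    fromℕ (2 ℕ.^ Q) + fromℕ (2 ℕ.^ Q)
                                ≈⟨ solve 1 (λ x → x :+ x := con (+ 2) :* x) ≈-refl (fromℕ (2 ℕ.^ Q)) ⟩
    fromℕ 2 * fromℕ (2 ℕ.^ Q)  ≈⟨ 2^[1+n] Q ⟨
    fromℕ (2 ℕ.^ (2 ℕ.+ q))  ∎)
    where
    open Reasoning
    N L m n Q : ℕ
    N = proj₁ (ln 1# 0<1)
    L = proj₁ (archimedean (- ℓ))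
    -- `N` puts the index beyond the threshold of convergence, `L` makes the base 1 + ℓ r
    -- nonnegative even for negative ℓ.
    m = N ℕ.+ L
    Q = suc q
    n = q ℕ.+ m ℕ.* Q
    r b x : Carrier
    r = recip (fromℕ (suc n)) (0<fromℕ-suc n)
    b = 1# + ℓ * r
    0<r : 0# < r
    0<r = recip-pos _ _
    N+L≤n : N ℕ.+ L ℕ.≤ n
    N+L≤n = ℕ.≤-trans (ℕ.m≤m*n m Q) (ℕ.m≤n+m _ q)
    N≤n : N ℕ.≤ n
    N≤n = ℕ.≤-trans (ℕ.m≤m+n N L) N+L≤n
    n*r : fromℕ (suc n) * r ≈ 1#
    n*r = *-recip _ _
    x = ½ᴿ * (fromℕ Q * r)
    0≤b : 0# ≤ b
    0≤b = begin
      0#  ≈⟨ solve 0 (con (+ 0) := con (+ 1) :+ :- con (+ 1)) ≈-refl ⟩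
      1# + - 1#  ≈⟨ +-congˡ (-‿cong n*r) ⟨
      1# + - (fromℕ (suc n) * r) ≤⟨ +-mono-≤ ≤-refl (lin (*-monoʳ-≤ (<⇒≤ 0<r) -ℓ≤) (solve 3 (λ n ℓ r → ℓ :* r :- :-
          (n :* r) := n :* r :- :- ℓ :* r) ≈-refl (fromℕ (suc n)) ℓ r)) ⟩
      1# + ℓ * r  ∎
      where
      -ℓ≤ : - ℓ ≤ fromℕ (suc n)
      -ℓ≤ = ≤-trans (<⇒≤ (proj₂ (archimedean (- ℓ))))
        (fromℕ-mono-≤ (ℕ.m≤n⇒m≤1+n (ℕ.≤-trans (ℕ.m≤n+m L N) N+L≤n)))
    0≤x : 0# ≤ x
    0≤x = *-nonneg (<⇒≤ (recip-pos _ _)) (*-nonneg (fromℕ-nonneg Q) (<⇒≤ 0<r))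
    2½ : fromℕ 2 * ½ᴿ ≈ 1#
    2½ = *-recip _ _
    2mx : fromℕ 2 * (fromℕ (suc m) * x) ≈ 1#
    2mx = begin-equality
      fromℕ 2 * (fromℕ (suc m) * (½ᴿ * (fromℕ Q * r)))
        ≈⟨ solve 5 (λ two m h q r → two :* (m :* (h :* (q :* r))) := (two :* h) :* ((m :* q) :* r)) ≈-refl
             (fromℕ 2) (fromℕ (suc m)) ½ᴿ (fromℕ Q) r ⟩
      (fromℕ 2 * ½ᴿ) * ((fromℕ (suc m) * fromℕ Q) * r)
        ≈⟨ *-cong 2½ (*-congʳ (≈-sym (fromℕ-* (suc m) Q))) ⟩
      1# * (fromℕ (suc m ℕ.* Q) * r)  ≈⟨ *-congˡ n*r ⟩
      1# * 1#  ≈⟨ *-identityˡ 1# ⟩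
      1#  ∎
    b≤ : b ≤ 1# + x
    b≤ = +-mono-≤ ≤-refl (begin
      ℓ * r  ≈⟨ *-identityˡ _ ⟨
      1# * (ℓ * r)  ≈⟨ *-congʳ 2½ ⟨
      (fromℕ 2 * ½ᴿ) * (ℓ * r)  ≈⟨ solve 4 (λ two h ℓ r → (two :* h) :* (ℓ :* r) := h :* ((two :* ℓ) :* r)) ≈-refl
          (fromℕ 2) ½ᴿ ℓ r ⟩
      ½ᴿ * ((fromℕ 2 * ℓ) * r)  ≤⟨ *-monoˡ-≤ (<⇒≤ (recip-pos _ _)) (*-monoʳ-≤ (<⇒≤ 0<r) (<⇒≤ 2ℓ<Q)) ⟩
      x  ∎)
    power≤ : b ^ suc n ≤ fromℕ (2 ℕ.^ Q)
    power≤ = begin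
      b ^ (suc m ℕ.* Q)  ≈⟨ ^-assocʳ b (suc m) Q ⟨
      (b ^ suc m) ^ Q  ≤⟨ ^-mono-≤ Q (^-nonneg (suc m) 0≤b) (^-mono-≤ (suc m) 0≤b b≤) ⟩
      ((1# + x) ^ suc m) ^ Q  ≤⟨ ^-mono-≤ Q (^-nonneg (suc m) (≤-trans 0≤b b≤)) (bernoulli x (suc m) 0≤x (≈⇒≤ 2mx)) ⟩
      (1# + fromℕ 2 * (fromℕ (suc m) * x)) ^ Q
                                      ≈⟨ ^-congˡ Q (+-cong ≈-refl 2mx) ⟩
      (1# + 1#) ^ Q  ≈⟨ ^-congˡ Q (solve 0 (con (+ 1) :+ con (+ 1) := con (+ 2)) ≈-refl) ⟩
      fromℕ 2 ^ Q  ≈⟨ fromℕ-^ 2 Q ⟨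
      fromℕ (2 ℕ.^ Q)  ∎

  *-cancelˡ-≈ : ∀ {x y z} → 0# < x → x * y ≈ x * z → y ≈ z
  *-cancelˡ-≈ 0<x eq = ≤-antisym (*-cancelˡ-≤ 0<x (≈⇒≤ eq)) (*-cancelˡ-≤ 0<x (≈⇒≤ (≈-sym eq)))

  2*½ : fromℕ 2 * ½ᴿ ≈ 1#
  2*½ = *-recip (fromℕ 2) 0<2

  ½+½ : ½ᴿ + ½ᴿ ≈ 1#
  ½+½ = ≈-trans (solve 1 (λ h → h :+ h := con (+ 2) :* h) ≈-refl ½ᴿ) 2*½

  -- Isometries of Euclidean space

  infix 8 _∙_
  _∙_ : ∀ {d} → Point d → Point d → Carrier
  x ∙ y = sum λ k → x k * y k

  infixl 6 _⊖_
  _⊖_ : ∀ {d} → Point d → Point d → Point d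
  (x ⊖ y) k = x k - y k

  ∙-cong : ∀ {d} {x x′ y y′ : Point d} → x ≋ x′ → y ≋ y′ → x ∙ y ≈ x′ ∙ y′
  ∙-cong p q = sum-cong λ k → *-cong (p k) (q k)

  ∙-comm : ∀ {d} (x y : Point d) → x ∙ y ≈ y ∙ x
  ∙-comm x y = sum-cong λ k → *-comm (x k) (y k)

  ∙-⊖ˡ : ∀ {d} (x y z : Point d) → (x ⊖ y) ∙ z ≈ x ∙ z - y ∙ z
  ∙-⊖ˡ x y z = ≈-trans
    (sum-cong λ k → solve 3 (λ x y z → (x :- y) :* z := x :* z :- y :* z) ≈-refl (x k) (y k) (z k))
    (sum-- (λ k → x k * z k) (λ k → y k * z k))

  ∙-scaleʳ : ∀ {d} c (x y : Point d) → x ∙ (λ k → c * y k) ≈ c * (x ∙ y)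
  ∙-scaleʳ c x y = ≈-trans
    (sum-cong λ k → solve 3 (λ c x y → x :* (c :* y) := c :* (x :* y)) ≈-refl c (x k) (y k))
    (*-sum c (λ k → x k * y k))

  distSq≈∙ : ∀ {d} (x y : Point d) → distSq x y ≈ (x ⊖ y) ∙ (x ⊖ y)
  distSq≈∙ x y = sum-cong λ k → solve 1 (λ a → a :^ 2 := a :* a) ≈-refl (x k - y k)

  distSq-sym : ∀ {d} (x y : Point d) → distSq x y ≈ distSq y x
  distSq-sym x y = sum-cong λ k → solve 2 (λ a b → (a :- b) :^ 2 := (b :- a) :^ 2) ≈-refl (x k) (y k)

  -- The law of cosines in the triangle with apex z. It expresses inner products of differences by
  -- distances, so that isometries preserve them.
  polarization : ∀ {d} (x y z : Point d) →
                 fromℕ 2 * ((x ⊖ z) ∙ (y ⊖ z)) ≈ (distSq x z + distSq y z) - distSq x y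
  polarization x y z = begin-equality
    fromℕ 2 * ((x ⊖ z) ∙ (y ⊖ z))
      ≈⟨ *-sum (fromℕ 2) (λ k → (x k - z k) * (y k - z k)) ⟨
    sum (λ k → fromℕ 2 * ((x k - z k) * (y k - z k)))
      ≈⟨ sum-cong (λ k → solve 3 (λ x y z → con (+ 2) :* ((x :- z) :* (y :- z)) :=
           ((x :- z) :^ 2 :+ (y :- z) :^ 2) :- (x :- y) :^ 2) ≈-refl (x k) (y k) (z k)) ⟩
    sum (λ k → ((x k - z k) ^ 2 + (y k - z k) ^ 2) - (x k - y k) ^ 2)
      ≈⟨ sum-- (λ k → (x k - z k) ^ 2 + (y k - z k) ^ 2) (λ k → (x k - y k) ^ 2) ⟩
    sum (λ k → (x k - z k) ^ 2 + (y k - z k) ^ 2) - distSq x y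
      ≈⟨ +-congʳ (sum-+ (λ k → (x k - z k) ^ 2) (λ k → (y k - z k) ^ 2)) ⟩
    (distSq x z + distSq y z) - distSq x y  ∎
    where open Reasoning

  basis : ∀ {d} → Fin d → Point d
  basis i k = if does (k Fin.≟ i) then 1# else 0#

  basis-self : ∀ {d} (i : Fin d) → basis i i ≡ 1#
  basis-self i with i Fin.≟ i
  ... | yes _   = refl
  ... | no  i≢i = ⊥-elim (i≢i refl)

  basis-other : ∀ {d} {i k : Fin d} → k ≢ i → basis i k ≡ 0#
  basis-other {i = i} {k} k≢i with k Fin.≟ i
  ... | yes k≡i = ⊥-elim (k≢i k≡i)
  ... | no  _   = refl

  ∙-basis : ∀ {d} (x : Point d) i → x ∙ basis i ≈ x i
  ∙-basis x i = ≈-trans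
    (sum-single i λ k k≢i → ≈-trans (*-congˡ (≈-reflexive (basis-other k≢i))) (zeroʳ (x k)))
    (≈-trans (*-congˡ (≈-reflexive (basis-self i))) (*-identityʳ (x i)))

  infix 6 _+[_]_
  _+[_]_ : ∀ {d} → Point d → Fin d → Carrier → Point d
  (x +[ i ] t) k = x k + t * basis i k

  +[]-self : ∀ {d} (x : Point d) i t → (x +[ i ] t) i ≈ x i + t
  +[]-self x i t = +-congˡ (≈-trans (*-congˡ (≈-reflexive (basis-self i))) (*-identityʳ t))

  +[]-⊖ : ∀ {d} (x : Point d) i t → ((x +[ i ] t) ⊖ x) ≋ (λ k → t * basis i k)
  +[]-⊖ x i t k = solve 2 (λ x b → (x :+ b) :- x := b) ≈-refl (x k) (t * basis i k)

  coordinate≤dist : ∀ {d} {x y : Point d} {e} → 0# ≤ e → distSq x y ≤ e ^ 2 → ∀ k → ∣ x k - y k ∣≤ e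
  coordinate≤dist {x = x} {y} 0≤e p k =
    square⇒abs 0≤e (≤-trans (term≤sum {f = λ k → (x k - y k) ^ 2} (λ k → 0≤^2 (x k - y k)) k) p)

  dist≤coordinates : ∀ {d} {x y : Point d} {e} → (∀ k → ∣ x k - y k ∣≤ e) → distSq x y ≤ fromℕ d * e ^ 2
  dist≤coordinates {d} {e = e} p =
    ≤-trans (sum-mono-≤ λ k → abs⇒square (p k)) (≈⇒≤ (sum-const d (e ^ 2)))

  d≤d² : ∀ d {x} → 0# ≤ x → fromℕ d * x ≤ fromℕ d ^ 2 * x
  d≤d² zero    {x} 0≤x = ≈⇒≤ (solve 1 (λ x → con (+ 0) :* x := con (+ 0) :^ 2 :* x) ≈-refl x)
  d≤d² (suc d) {x} 0≤x = *-monoʳ-≤ 0≤x (begin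
    fromℕ (suc d)  ≈⟨ *-identityʳ _ ⟨
    fromℕ (suc d) * 1#  ≤⟨ *-monoˡ-≤ (fromℕ-nonneg (suc d)) (1≤fromℕ {suc d} (ℕ.s≤s ℕ.z≤n)) ⟩
    fromℕ (suc d) * fromℕ (suc d)  ≈⟨ solve 1 (λ x → x :* x := x :^ 2) ≈-refl (fromℕ (suc d)) ⟩
    fromℕ (suc d) ^ 2  ∎)
    where open Reasoning

  -- The natural factor would be the square root of d; with d in its place the bound is the square
  -- of a multiple of `e`, and no roots occur.
  dist≤coordinates′ : ∀ {d} {x y : Point d} {e} → (∀ k → ∣ x k - y k ∣≤ e) → distSq x y ≤ (fromℕ d * e) ^ 2
  dist≤coordinates′ {d} {e = e} p = ≤-trans (dist≤coordinates p)
    (≤-trans (d≤d² d (0≤^2 e)) (≈⇒≤ (≈-sym (^-distrib-* (fromℕ d) e 2))))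

  module Isometry {d} {φ : Point d → Point d} (isometry : IsIsometry φ) where

    private
      preserves : ∀ x y → distSq (φ x) (φ y) ≈ distSq x y
      preserves = proj₁ isometry

    preserves-∙ : ∀ x y z → (φ x ⊖ φ z) ∙ (φ y ⊖ φ z) ≈ (x ⊖ z) ∙ (y ⊖ z)
    preserves-∙ x y z = *-cancelˡ-≈ 0<2 (begin-equality
      fromℕ 2 * ((φ x ⊖ φ z) ∙ (φ y ⊖ φ z))  ≈⟨ polarization (φ x) (φ y) (φ z) ⟩
      (distSq (φ x) (φ z) + distSq (φ y) (φ z)) - distSq (φ x) (φ y)  ≈⟨ +-cong (+-cong (preserves x z)
          (preserves y z)) (-‿cong (preserves x y)) ⟩
      (distSq x z + distSq y z) - distSq x y  ≈⟨ polarization x y z ⟨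
      fromℕ 2 * ((x ⊖ z) ∙ (y ⊖ z))  ∎)
      where open Reasoning

    -- `IsIsometry` does not presuppose linearity. This difference is the i-th column of the linear
    -- part, the normal of the faces across the i-th side.
    normal : Point d → Fin d → Point d
    normal o i = φ (o +[ i ] 1#) ⊖ φ o

    normal-bound : ∀ o i k → ∣ normal o i k ∣≤ 1#
    normal-bound o i k = coordinate≤dist 0≤1 (begin
      distSq (φ (o +[ i ] 1#)) (φ o)  ≈⟨ preserves (o +[ i ] 1#) o ⟩
      distSq (o +[ i ] 1#) o  ≈⟨ distSq≈∙ (o +[ i ] 1#) o ⟩
      ((o +[ i ] 1#) ⊖ o) ∙ ((o +[ i ] 1#) ⊖ o) ≈⟨ ∙-cong (λ k → ≈-trans (+[]-⊖ o i 1# k) (*-identityˡ _)) (λ k →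
          ≈-trans (+[]-⊖ o i 1# k) (*-identityˡ _)) ⟩
      basis i ∙ basis i  ≈⟨ ∙-basis (basis i) i ⟩
      basis i i  ≈⟨ ≈-reflexive (basis-self i) ⟩
      1#  ≈⟨ solve 0 (con (+ 1) := con (+ 1) :^ 2) ≈-refl ⟩
      1# ^ 2  ∎) k
      where open Reasoning

    -- Inner products based at `o` are preserved, and before applying φ the normal is a basis
    -- vector. Bounds on the coordinates in a box thus become linear inequalities for the points of
    -- its image.
    coordinate : ∀ o i x y → (φ x ⊖ φ y) ∙ normal o i ≈ x i - y i
    coordinate o i x y = begin-equality
      (φ x ⊖ φ y) ∙ n  ≈⟨ ∙-cong (λ k → solve 3 (λ x y o → x :- y := (x :- o) :- (y :- o)) ≈-refl (φ x k) (φ y k)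
          (φ o k)) (λ k → ≈-refl) ⟩
      ((φ x ⊖ φ o) ⊖ (φ y ⊖ φ o)) ∙ n  ≈⟨ ∙-⊖ˡ (φ x ⊖ φ o) (φ y ⊖ φ o) n ⟩
      (φ x ⊖ φ o) ∙ n - (φ y ⊖ φ o) ∙ n  ≈⟨ +-cong (from-o x) (-‿cong (from-o y)) ⟩
      (x i - o i) - (y i - o i)  ≈⟨ solve 3 (λ x y o → (x :- o) :- (y :- o) := x :- y) ≈-refl (x i) (y i) (o i) ⟩
      x i - y i  ∎
      where
      open Reasoning
      n : Point d
      n = normal o i
      from-o : ∀ x → (φ x ⊖ φ o) ∙ n ≈ x i - o i
      from-o x = begin-equality
        (φ x ⊖ φ o) ∙ n  ≈⟨ preserves-∙ x (o +[ i ] 1#) o ⟩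
        (x ⊖ o) ∙ ((o +[ i ] 1#) ⊖ o)  ≈⟨ ∙-cong (λ k → ≈-refl {x k - o k}) (λ k → ≈-trans (+[]-⊖ o i 1# k)
            (*-identityˡ _)) ⟩
        (x ⊖ o) ∙ basis i  ≈⟨ ∙-basis (x ⊖ o) i ⟩
        x i - o i  ∎

    close : ∀ {x y e} → (∀ k → ∣ x k - y k ∣≤ e) → ∀ k → ∣ φ x k - φ y k ∣≤ fromℕ d * e
    close {x} {y} {e} p k = coordinate≤dist 0≤de (≤-trans (≈⇒≤ (preserves x y)) (dist≤coordinates′ p)) k
      where
      0≤de : 0# ≤ fromℕ d * e
      0≤de = *-nonneg (fromℕ-nonneg d) (abs-bound-nonneg (p k))

    close⁻¹ : ∀ {x y e} → (∀ k → ∣ φ x k - φ y k ∣≤ e) → ∀ k → ∣ x k - y k ∣≤ fromℕ d * e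
    close⁻¹ {x} {y} {e} p k = coordinate≤dist 0≤de (≤-trans (≈⇒≤ (≈-sym (preserves x y))) (dist≤coordinates′ p)) k
      where
      0≤de : 0# ≤ fromℕ d * e
      0≤de = *-nonneg (fromℕ-nonneg d) (abs-bound-nonneg (p k))

  -- Boxes and systems of inequalities on a grid

  -- Two lengths are in play: the mesh u = 1/M and r = μ u = 1/K. With μ = 1 + 3 d, r exceeds both
  -- the error 3 d u of an integer test and the distance 2 d u within which two lattice points might
  -- round to the same grid point. The factor κ adapts r to the thinnest boxes to be met.
  module Grid (d κ : ℕ) (0<κ : 1 ℕ.≤ κ) (p : ℕ) where

    μ K M : ℕ
    μ = suc (3 ℕ.* d)
    K = κ ℕ.* 2 ℕ.^ p
    M = μ ℕ.* K

    1≤K : 1 ℕ.≤ K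
    1≤K = ℕ.*-mono-≤ 0<κ (ℕ.m^n>0 2 p)

    1≤M : 1 ℕ.≤ M
    1≤M = ℕ.*-mono-≤ (ℕ.s≤s (ℕ.z≤n {3 ℕ.* d})) 1≤K

    m u r : Carrier
    m = fromℕ M

    0<m : 0# < m
    0<m = <-≤-trans 0<1 (1≤fromℕ 1≤M)

    u = recip m 0<m
    r = fromℕ μ * u

    0≤m : 0# ≤ m
    0≤m = fromℕ-nonneg M

    0<u : 0# < u
    0<u = recip-pos m 0<m

    mu≈1 : m * u ≈ 1#
    mu≈1 = *-recip m 0<m

    0<r : 0# < r
    0<r = *-pos (0<fromℕ-suc (3 ℕ.* d)) 0<u

    Kr≈1 : fromℕ K * r ≈ 1#
    Kr≈1 = begin-equality
      fromℕ K * (fromℕ μ * u)  ≈⟨ solve 3 (λ k μ u → k :* (μ :* u) := (μ :* k) :* u) ≈-refl (fromℕ K) (fromℕ μ) u ⟩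
      (fromℕ μ * fromℕ K) * u  ≈⟨ *-congʳ (fromℕ-* μ K) ⟨
      m * u  ≈⟨ mu≈1 ⟩
      1#  ∎
      where open Reasoning

    fromℕ-μ : fromℕ μ ≈ 1# + fromℕ 3 * fromℕ d
    fromℕ-μ = +-congˡ (fromℕ-* 3 d)

    pt : Vec ℕ d → Point d
    pt g k = fromℕ (lookup g k) * u - ½ᴿ

    Small : ℕ → Vec ℕ d → Set
    Small B g = ∀ k → lookup g k ℕ.≤ B

    dot : Vec ℕ d → Vec ℕ d → ℕ
    dot a g = sumℕ λ k → lookup a k ℕ.* lookup g k

    total : Vec ℕ d → ℕ
    total g = sumℕ (lookup g)

    -- ⟨a − (M, …, M), g⟩ ≤ ⟨a − (M, …, M), h⟩, without subtraction; shifting by M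
    -- lets a vector with entries in [−M, M] be coded by natural numbers.
    Before : Vec ℕ d → Vec ℕ d → Vec ℕ d → Set
    Before a g h = dot a g ℕ.+ M ℕ.* total h ℕ.≤ dot a h ℕ.+ M ℕ.* total g

    -- If `a` codes a normal n as M + M n, and `g` and `h` round x and y, this is close to M² times
    -- the inner product of y - x with n: one factor M comes from the code, the other from the grid
    -- coordinates.
    advance : Vec ℕ d → Vec ℕ d → Vec ℕ d → Carrier
    advance a g h = sum λ k → (fromℕ (lookup a k) - m) * (fromℕ (lookup h k) - fromℕ (lookup g k))

    private
      fromℕ-side : ∀ a g h → fromℕ (dot a g ℕ.+ M ℕ.* total h) ≈
                   sum λ k → fromℕ (lookup a k) * fromℕ (lookup g k) + m * fromℕ (lookup h k)
      fromℕ-side a g h = begin-equality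
        fromℕ (dot a g ℕ.+ M ℕ.* total h)  ≈⟨ fromℕ-+ (dot a g) (M ℕ.* total h) ⟩
        fromℕ (dot a g) + fromℕ (M ℕ.* total h)  ≈⟨ +-cong (sum-fromℕ (λ k → lookup a k ℕ.* lookup g k)) (≈-trans
            (*-congˡ (sum-fromℕ (lookup h))) (≈-sym (fromℕ-* M (total h)))) ⟨
        sum (λ k → fromℕ (lookup a k ℕ.* lookup g k)) + m * sum (λ k → fromℕ (lookup h k))
          ≈⟨ +-cong (sum-cong λ k → fromℕ-* (lookup a k) (lookup g k)) (≈-sym (*-sum m (λ k → fromℕ (lookup h k)))) ⟩
        sum (λ k → fromℕ (lookup a k) * fromℕ (lookup g k)) + sum (λ k → m * fromℕ (lookup h k))
          ≈⟨ sum-+ (λ k → fromℕ (lookup a k) * fromℕ (lookup g k)) (λ k → m * fromℕ (lookup h k)) ⟨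
        sum (λ k → fromℕ (lookup a k) * fromℕ (lookup g k) + m * fromℕ (lookup h k)) ∎
        where open Reasoning

    advance≈ : ∀ a g h → advance a g h ≈ fromℕ (dot a h ℕ.+ M ℕ.* total g) - fromℕ (dot a g ℕ.+ M ℕ.* total h)
    advance≈ a g h = begin-equality
      advance a g h
        ≈⟨ sum-cong (λ k → solve 4 (λ a m h g → (a :- m) :* (h :- g) := (a :* h :+ m :* g) :- (a :* g :+ m :* h))
             ≈-refl (fromℕ (lookup a k)) m (fromℕ (lookup h k)) (fromℕ (lookup g k))) ⟩
      sum (λ k → side a h g k - side a g h k)  ≈⟨ sum-- (side a h g) (side a g h) ⟩
      sum (side a h g) - sum (side a g h)  ≈⟨ +-cong (fromℕ-side a h g) (-‿cong (fromℕ-side a g h)) ⟨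
      fromℕ (dot a h ℕ.+ M ℕ.* total g) - fromℕ (dot a g ℕ.+ M ℕ.* total h)  ∎
      where
      open Reasoning
      side : Vec ℕ d → Vec ℕ d → Vec ℕ d → Point d
      side a g h k = fromℕ (lookup a k) * fromℕ (lookup g k) + m * fromℕ (lookup h k)

    before⁺ : ∀ a g h → 0# ≤ advance a g h → Before a g h
    before⁺ a g h p = fromℕ-cancel-≤ (0≤-⇒≤ (≤-trans p (≈⇒≤ (advance≈ a g h))))

    before⁻ : ∀ a g h → Before a g h → 0# ≤ advance a g h
    before⁻ a g h p = ≤-trans (≤⇒0≤- (fromℕ-mono-≤ p)) (≈⇒≤ (≈-sym (advance≈ a g h)))

    Approximates : Vec ℕ d → Point d → Set
    Approximates g z = Small M g × (∀ k → ∣ pt g k - z k ∣≤ u)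

    ApproximatesNormal : Vec ℕ d → Point d → Set
    ApproximatesNormal a n = ∀ k → ∣ fromℕ (lookup a k) - (m + m * n k) ∣≤ 1#

    module _ (a g h : Vec ℕ d) {n x y : Point d} (n≤1 : ∀ k → ∣ n k ∣≤ 1#) (a≈n : ApproximatesNormal a n)
             (g≈x : Approximates g x) (h≈y : Approximates h y) where

      private
        t e : Carrier
        t = (y ⊖ x) ∙ n
        e = fromℕ d * (fromℕ 3 * m)

        difference : ∀ k → ∣ fromℕ (lookup h k) - fromℕ (lookup g k) ∣≤ m
        difference k =
          lin (+-mono-≤ (fromℕ-mono-≤ (proj₁ h≈y k)) (fromℕ-nonneg (lookup g k)))
              (solve 3 (λ h g m → m :- (h :- g) := (m :+ g) :- (h :+ con (+ 0))) ≈-refl (fromℕ (lookup h k)) (fromℕ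
                  (lookup g k)) m) ,
          lin (+-mono-≤ (fromℕ-mono-≤ (proj₁ g≈x k)) (fromℕ-nonneg (lookup h k)))
              (solve 3 (λ h g m → m :- :- (h :- g) := (m :+ h) :- (g :+ con (+ 0))) ≈-refl (fromℕ (lookup h k)) (fromℕ
                  (lookup g k)) m)

        difference′ : ∀ k → ∣ (fromℕ (lookup h k) - fromℕ (lookup g k)) - m * (y k - x k) ∣≤ fromℕ 2
        difference′ k = abs-weaken bound (abs-cong eq
          (abs-* (abs-nonneg 0≤m ≤-refl) (abs-+ (proj₂ h≈y k) (abs-neg (proj₂ g≈x k)))))
          where
          open Reasoning
          H G : Carrier
          H = fromℕ (lookup h k)
          G = fromℕ (lookup g k)
          bound : m * (u + u) ≤ fromℕ 2
          bound = ≈⇒≤ (begin-equality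
            m * (u + u)  ≈⟨ solve 2 (λ m u → m :* (u :+ u) := con (+ 2) :* (m :* u)) ≈-refl m u ⟩
            fromℕ 2 * (m * u)  ≈⟨ *-congˡ mu≈1 ⟩
            fromℕ 2 * 1#  ≈⟨ *-identityʳ _ ⟩
            fromℕ 2  ∎)
          eq : m * ((pt h k - y k) - (pt g k - x k)) ≈ (H - G) - m * (y k - x k)
          eq = begin-equality
            m * (((H * u - ½ᴿ) - y k) - ((G * u - ½ᴿ) - x k))
              ≈⟨ solve 7 (λ m u c H G y x → m :* (((H :* u :- c) :- y) :- ((G :* u :- c) :- x)) :=
                   (m :* u) :* (H :- G) :- m :* (y :- x)) ≈-refl m u ½ᴿ H G (y k) (x k) ⟩
            (m * u) * (H - G) - m * (y k - x k)  ≈⟨ +-congʳ (1*-cancel mu≈1) ⟩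
            (H - G) - m * (y k - x k)  ∎

        -- Two errors add up to 3 M: the coded normal is off by 1 while the grid coordinates differ
        -- by at most M, and the difference of the grid coordinates is off by 2 while M n is at most
        -- M.
        term : ∀ k → ∣ (fromℕ (lookup a k) - m) * (fromℕ (lookup h k) - fromℕ (lookup g k))
                       - m * (m * ((y k - x k) * n k)) ∣≤ fromℕ 3 * m
        term k = abs-weaken bound (abs-cong eq
          (abs-+ (abs-* (a≈n k) (difference k)) (abs-* (abs-* (abs-nonneg 0≤m ≤-refl) (n≤1 k)) (difference′ k))))
          where
          bound : 1# * m + (m * 1#) * fromℕ 2 ≤ fromℕ 3 * m
          bound = ≈⇒≤ (solve 1 (λ m → con (+ 1) :* m :+ (m :* con (+ 1)) :* con (+ 2) := con (+ 3) :* m) ≈-refl m)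
          eq : (fromℕ (lookup a k) - (m + m * n k)) * (fromℕ (lookup h k) - fromℕ (lookup g k))
               + (m * n k) * ((fromℕ (lookup h k) - fromℕ (lookup g k)) - m * (y k - x k)) ≈
               (fromℕ (lookup a k) - m) * (fromℕ (lookup h k) - fromℕ (lookup g k)) - m * (m * ((y k - x k) * n k))
          eq = solve 5 (λ a m n D z → (a :- (m :+ m :* n)) :* D :+ (m :* n) :* (D :- m :* z) :=
                                       (a :- m) :* D :- m :* (m :* (z :* n))) ≈-refl
                 (fromℕ (lookup a k)) m (n k) (fromℕ (lookup h k) - fromℕ (lookup g k)) (y k - x k)

        advance-close : ∣ advance a g h - m * (m * t) ∣≤ e
        advance-close = abs-cong eq (abs-sum term)
          where
          open Reasoning
          w : Point d
          w k = (fromℕ (lookup a k) - m) * (fromℕ (lookup h k) - fromℕ (lookup g k))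
          eq : sum (λ k → w k - m * (m * ((y k - x k) * n k))) ≈ advance a g h - m * (m * t)
          eq = begin-equality
            sum (λ k → w k - m * (m * ((y k - x k) * n k)))
              ≈⟨ sum-- w (λ k → m * (m * ((y k - x k) * n k))) ⟩
            sum w - sum (λ k → m * (m * ((y k - x k) * n k)))
              ≈⟨ +-congˡ (-‿cong (≈-trans (*-sum m (λ k → m * ((y k - x k) * n k))) (*-congˡ (*-sum m (λ k →
                  (y k - x k) * n k))))) ⟩
            sum w - m * (m * t)  ∎

        mmr : m * (m * r) ≈ m + e
        mmr = begin-equality
          m * (m * (fromℕ μ * u))  ≈⟨ solve 3 (λ m μ u → m :* (m :* (μ :* u)) := m :* (μ :* (m :* u))) ≈-refl m
              (fromℕ μ) u ⟩
          m * (fromℕ μ * (m * u))  ≈⟨ *-congˡ (*-cong fromℕ-μ mu≈1) ⟩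
          m * ((1# + fromℕ 3 * fromℕ d) * 1#)  ≈⟨ solve 2 (λ m d → m :* ((con (+ 1) :+ con (+ 3) :* d) :* con
              (+ 1)) := m :+ d :* (con (+ 3) :* m)) ≈-refl m (fromℕ d) ⟩
          m + fromℕ d * (fromℕ 3 * m)  ∎
          where open Reasoning

      -- Together with `before-only-if`: the integer test and the real inequality agree up to the
      -- margin r. An advance by r ensures the test, and the test excludes a retreat by more than r.
      before-if : r ≤ (y ⊖ x) ∙ n → Before a g h
      before-if r≤t = before⁺ a g h (≤-trans 0≤m (lin
        (+-mono-≤ (≤-trans (≈⇒≤ (≈-sym mmr)) (*-monoˡ-≤ 0≤m (*-monoˡ-≤ 0≤m r≤t))) (proj₂ advance-close))
        (solve 4 (λ A m e T → A :- m := (T :+ e) :- ((m :+ e) :+ :- (A :- T))) ≈-refl (advance a g h) m e (m *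
            (m * t)))))

      before-only-if : Before a g h → - r ≤ (y ⊖ x) ∙ n
      before-only-if b = *-cancelˡ-≤ 0<m (*-cancelˡ-≤ 0<m (begin
        m * (m * - r)  ≈⟨ solve 2 (λ m r → m :* (m :* :- r) := :- (m :* (m :* r))) ≈-refl m r ⟩
        - (m * (m * r))  ≈⟨ -‿cong mmr ⟩
        - (m + e)  ≤⟨ lin (+-mono-≤ (+-mono-≤ (before⁻ a g h b) (proj₁ advance-close)) 0≤m)
                                   (solve 4 (λ A m e T → T :- :- (m :+ e) := ((A :+ e) :+ m) :- ((con (+ 0) :+
                                       (A :- T)) :+ con (+ 0)))
                                      ≈-refl (advance a g h) m e (m * (m * t))) ⟩
        m * (m * t)  ∎))
        where open Reasoning

    nearest : ∀ {z} → Cube d z → ∃[ g ] Approximates g z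
    nearest {z} z∈ = tabulate G , small , close
      where
      open Reasoning
      G′ : ∀ k → ∃[ n ] n ℕ.≤ M × ∣ fromℕ n - m * (z k + ½ᴿ) ∣≤ 1#
      G′ k = round 1≤M (m * (z k + ½ᴿ))
        (*-nonneg 0≤m (lin (proj₁ (z∈ k)) (solve 2 (λ z h → (z :+ h) :- con (+ 0) := z :- :- h) ≈-refl (z k) ½ᴿ)))
        (begin
          m * (z k + ½ᴿ)  ≤⟨ *-monoˡ-≤ 0≤m (+-mono-≤ (proj₂ (z∈ k)) ≤-refl) ⟩
          m * (½ᴿ + ½ᴿ)  ≈⟨ *-congˡ ½+½ ⟩
          m * 1#  ≈⟨ *-identityʳ m ⟩
          m  ∎)
      G : Fin d → ℕ
      G k = proj₁ (G′ k)
      small : Small M (tabulate G)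
      small k = ≡.subst (ℕ._≤ M) (≡.sym (lookup∘tabulate G k)) (proj₁ (proj₂ (G′ k)))
      close : ∀ k → ∣ pt (tabulate G) k - z k ∣≤ u
      close k = ≡.subst (λ n → ∣ (fromℕ n * u - ½ᴿ) - z k ∣≤ u) (≡.sym (lookup∘tabulate G k))
        (abs-weaken (≈⇒≤ (*-identityʳ u)) (abs-cong eq (abs-* (abs-nonneg (<⇒≤ 0<u) ≤-refl) (proj₂ (proj₂ (G′ k))))))
        where
        eq : u * (fromℕ (G k) - m * (z k + ½ᴿ)) ≈ (fromℕ (G k) * u - ½ᴿ) - z k
        eq = begin-equality
          u * (fromℕ (G k) - m * (z k + ½ᴿ))
            ≈⟨ solve 5 (λ u g m z h → u :* (g :- m :* (z :+ h)) := g :* u :- (m :* u) :* (z :+ h)) ≈-refl u (fromℕ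
                (G k)) m (z k) ½ᴿ ⟩
          fromℕ (G k) * u - (m * u) * (z k + ½ᴿ)  ≈⟨ +-congˡ (-‿cong (1*-cancel mu≈1)) ⟩
          fromℕ (G k) * u - (z k + ½ᴿ)  ≈⟨ solve 3 (λ g z h → g :- (z :+ h) := (g :- h) :- z) ≈-refl (fromℕ (G k) * u)
              (z k) ½ᴿ ⟩
          (fromℕ (G k) * u - ½ᴿ) - z k  ∎

    pt-approximates : ∀ {g x} → Small M g → x ≋ pt g → Approximates g x
    pt-approximates {g} {x} small x≋ = small , λ k → abs-cong
      (≈-trans (solve 1 (λ a → con (+ 0) := a :- a) ≈-refl (pt g k)) (+-congˡ (-‿cong (≈-sym (x≋ k)))))
      (abs-nonneg ≤-refl (<⇒≤ 0<u))

    pt∈Cube : ∀ {g} → Small M g → Cube d (pt g)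
    pt∈Cube {g} small k =
      lin (*-nonneg (fromℕ-nonneg (lookup g k)) (<⇒≤ 0<u))
          (solve 2 (λ x h → (x :- h) :- :- h := x :- con (+ 0)) ≈-refl (fromℕ (lookup g k) * u) ½ᴿ) ,
      lin (≤-trans (*-monoʳ-≤ (<⇒≤ 0<u) (fromℕ-mono-≤ (small k))) (≈⇒≤ (≈-trans mu≈1 (≈-sym ½+½))))
          (solve 2 (λ x h → h :- (x :- h) := (h :+ h) :- x) ≈-refl (fromℕ (lookup g k) * u) ½ᴿ)

    nearest-normal : ∀ {n} → (∀ k → ∣ n k ∣≤ 1#) → ∃[ a ] Small (2 ℕ.* M) a × ApproximatesNormal a n
    nearest-normal {n} n≤1 = tabulate G ,
      (λ k → ≡.subst (ℕ._≤ 2 ℕ.* M) (≡.sym (lookup∘tabulate G k)) (proj₁ (proj₂ (G′ k)))) ,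
      (λ k → ≡.subst (λ a → ∣ fromℕ a - (m + m * n k) ∣≤ 1#) (≡.sym (lookup∘tabulate G k)) (proj₂ (proj₂ (G′ k))))
      where
      open Reasoning
      mn : ∀ k → ∣ m * n k ∣≤ m
      mn k = abs-weaken (≈⇒≤ (*-identityʳ m)) (abs-* (abs-nonneg 0≤m ≤-refl) (n≤1 k))
      G′ : ∀ k → ∃[ a ] a ℕ.≤ 2 ℕ.* M × ∣ fromℕ a - (m + m * n k) ∣≤ 1#
      G′ k = round (ℕ.≤-trans 1≤M (ℕ.m≤n*m M 2)) (m + m * n k)
        (lin (proj₂ (mn k)) (solve 2 (λ m x → (m :+ x) :- con (+ 0) := m :- :- x) ≈-refl m (m * n k)))
        (begin
          m + m * n k  ≤⟨ +-mono-≤ ≤-refl (proj₁ (mn k)) ⟩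
          m + m  ≈⟨ solve 1 (λ m → m :+ m := con (+ 2) :* m) ≈-refl m ⟩
          fromℕ 2 * m  ≈⟨ fromℕ-* 2 M ⟨
          fromℕ (2 ℕ.* M)  ∎)
      G : Fin d → ℕ
      G k = proj₁ (G′ k)

    -- A slab between parallel hyperplanes: the code of a normal, and a grid point on each
    -- hyperplane. Natural entries bounded in terms of M leave finitely many slabs.
    Condition : Set
    Condition = Vec ℕ d × Vec ℕ d × Vec ℕ d

    Test : Set
    Test = Vec Condition d

    Satisfies : Condition → Vec ℕ d → Set
    Satisfies (a , g , h) x = Before a g x × Before a x h

    Hits : Test → Vec ℕ d → Set
    Hits θ x = ∀ i → Satisfies (lookup θ i) x

    hits? : ∀ θ x → Dec (Hits θ x)
    hits? θ x = Fin.all? λ i → (_ ℕ.≤? _) ×-dec (_ ℕ.≤? _)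

    hits : Test → Vec ℕ d → Bool
    hits θ x = does (hits? θ x)

    -- Along side i, measured from `lo` in units of r: the faces are at 0 and at 3 + n i or beyond,
    -- the hyperplanes of the test are based near 1 and 2 + n i, and the lattice layers are at 2,
    -- ..., 1 + n i. The gaps between the three kinds match the margin r, so that roundings of
    -- lattice points pass the test and no grid point outside the box does.
    module Range {φ : Point d → Point d} (isometry : IsIsometry φ) (I : Intervals d)
                 (inside : ∀ y → Intervals.region I y → Cube d (φ y))
                 (n : Fin d → ℕ) (n-fits : ∀ i → fromℕ (3 ℕ.+ n i) * r ≤ Intervals.side I i) where

      open Intervals I
      open Isometry isometry

      private
        normal≤1 : ∀ i k → ∣ normal lo i k ∣≤ 1#
        normal≤1 = normal-bound lo

        nonneg : ∀ j → 0# ≤ fromℕ j * r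
        nonneg j = *-nonneg (fromℕ-nonneg j) (<⇒≤ 0<r)

        fits : ∀ i j → j ℕ.≤ 3 ℕ.+ n i → fromℕ j * r ≤ side i
        fits i j j≤ = ≤-trans (*-monoʳ-≤ (<⇒≤ 0<r) (fromℕ-mono-≤ j≤)) (n-fits i)

        corner : Fin d → ℕ → Point d
        corner i j = lo +[ i ] (fromℕ j * r)

        corner∈ : ∀ i j → j ℕ.≤ 3 ℕ.+ n i → region (corner i j)
        corner∈ i j j≤ k with k Fin.≟ i
        ... | yes refl = lin (nonneg j) (solve 2 (λ l t → (l :+ t :* con (+ 1)) :- l := t :- con (+ 0)) ≈-refl (lo k)
            (fromℕ j * r)) ,
                         lin (fits i j j≤) (solve 3 (λ l t h → h :- (l :+ t :* con (+ 1)) := (h :- l) :- t) ≈-refl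
                             (lo k) (fromℕ j * r) (hi k))
        ... | no _     = lin (≤-refl {0#}) (solve 2 (λ l t → (l :+ t :* con (+ 0)) :- l := con (+ 0) :- con (+ 0))
            ≈-refl (lo k) (fromℕ j * r)) ,
                         lin (lo≤hi k) (solve 3 (λ l t h → h :- (l :+ t :* con (+ 0)) := h :- l) ≈-refl (lo k)
                             (fromℕ j * r) (hi k))

        lower≤ : ∀ i → 1 ℕ.≤ 3 ℕ.+ n i
        lower≤ i = ℕ.s≤s ℕ.z≤n

        upper≤ : ∀ i → 2 ℕ.+ n i ℕ.≤ 3 ℕ.+ n i
        upper≤ i = ℕ.n≤1+n (2 ℕ.+ n i)

        A : ∀ i → ∃[ a ] Small (2 ℕ.* M) a × ApproximatesNormal a (normal lo i)
        A i = nearest-normal (normal≤1 i)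

        G : ∀ i → ∃[ g ] Approximates g (φ (corner i 1))
        G i = nearest (inside _ (corner∈ i 1 (lower≤ i)))

        H : ∀ i → ∃[ h ] Approximates h (φ (corner i (2 ℕ.+ n i)))
        H i = nearest (inside _ (corner∈ i (2 ℕ.+ n i) (upper≤ i)))

      condition : Fin d → Condition
      condition i = proj₁ (A i) , proj₁ (G i) , proj₁ (H i)

      test : Test
      test = tabulate condition

      test-small : ∀ i → Small (2 ℕ.* M) (proj₁ (condition i)) ×
                         Small M (proj₁ (proj₂ (condition i))) × Small M (proj₂ (proj₂ (condition i)))
      test-small i = proj₁ (proj₂ (A i)) , proj₁ (proj₂ (G i)) , proj₁ (proj₂ (H i))

      lattice-point : Fin (productℕ n) → Point d
      lattice-point c i = lo i + fromℕ (2 ℕ.+ toℕ (decode n c i)) * r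

      private
        toℕ-decode< : ∀ c i → toℕ (decode n c i) ℕ.< n i
        toℕ-decode< c i = Fin.toℕ<n (decode n c i)

        lattice-point∈ : ∀ c → region (lattice-point c)
        lattice-point∈ c i =
          lin (nonneg j) (solve 2 (λ l t → (l :+ t) :- l := t :- con (+ 0)) ≈-refl (lo i) (fromℕ j * r)) ,
          lin (fits i j (ℕ.≤-trans (ℕ.s≤s (ℕ.s≤s (ℕ.<⇒≤ (toℕ-decode< c i)))) (upper≤ i)))
              (solve 3 (λ l t h → h :- (l :+ t) := (h :- l) :- t) ≈-refl (lo i) (fromℕ j * r) (hi i))
          where
          j : ℕ
          j = 2 ℕ.+ toℕ (decode n c i)

        image : ∀ c → ∃[ g ] Approximates g (φ (lattice-point c))
        image c = nearest (inside _ (lattice-point∈ c))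

      grid-point : Fin (productℕ n) → Vec ℕ d
      grid-point c = proj₁ (image c)

      grid-point-small : ∀ c → Small M (grid-point c)
      grid-point-small c = proj₁ (proj₂ (image c))

      grid-point-hits : ∀ c → Hits test (grid-point c)
      grid-point-hits c i = ≡.subst (λ θ → Satisfies θ (grid-point c)) (≡.sym (lookup∘tabulate condition i))
        ( before-if (proj₁ (A i)) (proj₁ (G i)) (grid-point c) (normal≤1 i) (proj₂ (proj₂ (A i))) (proj₂ (G i)) (proj₂
            (image c)) (begin
            r  ≤⟨ lin (nonneg j) (solve 3 (λ l r j → ((l :+ (con (+ 1) :+ (con (+ 1) :+ j)) :* r) :- (l :+ (con
                (+ 1) :+ con (+ 0)) :* r)) :- r := j :* r :- con (+ 0)) ≈-refl (lo i) r (fromℕ j)) ⟩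
            lattice-point c i - (lo i + fromℕ 1 * r) ≈⟨ +-congˡ (-‿cong (+[]-self lo i (fromℕ 1 * r))) ⟨
            lattice-point c i - corner i 1 i  ≈⟨ coordinate lo i (lattice-point c) (corner i 1) ⟨
            (φ (lattice-point c) ⊖ φ (corner i 1)) ∙ normal lo i  ∎)
        , before-if (proj₁ (A i)) (grid-point c) (proj₁ (H i)) (normal≤1 i) (proj₂ (proj₂ (A i))) (proj₂ (image c))
            (proj₂ (H i)) (begin
            r  ≤⟨ lin (*-monoʳ-≤ (<⇒≤ 0<r) (fromℕ-mono-≤ (toℕ-decode< c i))) (solve 4 (λ l r j n → ((l :+ (con
                (+ 1) :+ (con (+ 1) :+ n)) :* r) :- (l :+ (con (+ 1) :+ (con (+ 1) :+ j)) :* r)) :- r := n :* r :-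
                (con (+ 1) :+ j) :* r) ≈-refl (lo i) r (fromℕ j) (fromℕ (n i))) ⟩
            (lo i + fromℕ (2 ℕ.+ n i) * r) - lattice-point c i ≈⟨ +-congʳ (+[]-self lo i (fromℕ (2 ℕ.+ n i) * r)) ⟨
            corner i (2 ℕ.+ n i) i - lattice-point c i  ≈⟨ coordinate lo i (corner i (2 ℕ.+ n i)) (lattice-point c) ⟨
            (φ (corner i (2 ℕ.+ n i)) ⊖ φ (lattice-point c)) ∙ normal lo i  ∎))
        where
        open Reasoning
        j : ℕ
        j = toℕ (decode n c i)

      private
        du<r : fromℕ d * (u + u) < r
        du<r = lin< (+-mono-<-≤ 0<u (*-nonneg (fromℕ-nonneg d) (<⇒≤ 0<u)))
          (≈-trans (+-congʳ (*-congʳ fromℕ-μ))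
            (solve 2 (λ d u → (con (+ 1) :+ con (+ 3) :* d) :* u :- d :* (u :+ u) := (u :+ d :* u) :- (con
                (+ 0) :+ con (+ 0))) ≈-refl (fromℕ d) u))

        separated : ∀ a b {l} → (l + fromℕ a * r) - (l + fromℕ b * r) ≤ fromℕ d * (u + u) → a ℕ.≤ b
        separated a b {l} le = ℕ.≮⇒≥ λ b<a → le (<-≤-trans du<r
          (lin (*-monoʳ-≤ (<⇒≤ 0<r) (fromℕ-mono-≤ b<a))
            (solve 4 (λ l a b r → ((l :+ a :* r) :- (l :+ b :* r)) :- r := a :* r :- (con (+ 1) :+ b) :* r) ≈-refl l
                (fromℕ a) (fromℕ b) r)))

      -- If two lattice points round to one grid point, their images differ by at most 2 u in each
      -- coordinate, and `close⁻¹` brings the points themselves within 2 d u < r, whereas different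
      -- layers are at least r apart.
      grid-point-injective : ∀ {c c′} → grid-point c ≡ grid-point c′ → c ≡ c′
      grid-point-injective {c} {c′} eq = decode-injective n λ i →
        Fin.toℕ-injective (ℕ.+-cancelˡ-≡ 2 _ _ (ℕ.≤-antisym
          (separated _ _ (proj₁ (close⁻¹ images-close i)))
          (separated _ _ (≤-trans (≈⇒≤ (solve 2 (λ a b → b :- a := :- (a :- b)) ≈-refl (lattice-point c i)
              (lattice-point c′ i)))
            (proj₂ (close⁻¹ images-close i))))))
        where
        images-close : ∀ k → ∣ φ (lattice-point c) k - φ (lattice-point c′) k ∣≤ u + u
        images-close k = abs-cong
          (solve 3 (λ x g y → :- (g :- x) :+ (g :- y) := x :- y) ≈-refl (φ (lattice-point c) k) (pt (grid-point c) k)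
              (φ (lattice-point c′) k))
          (abs-+ (abs-neg (proj₂ (proj₂ (image c)) k))
            (≡.subst (λ g → ∣ pt g k - φ (lattice-point c′) k ∣≤ u) (≡.sym eq) (proj₂ (proj₂ (image c′)) k)))

      -- Surjectivity of the isometry gives every grid point a preimage. The test keeps it at most r
      -- outside the hyperplanes, which lie at least r inside the faces.
      hits⇒inside : ∀ {g} → Small M g → Hits test g → ∃[ y ] region y × φ y ≋ pt g
      hits⇒inside {g} small hit = y , in-region , φy≋
        where
        open Reasoning
        y : Point d
        y = proj₁ (proj₂ isometry (pt g))
        φy≋ : φ y ≋ pt g
        φy≋ = proj₂ (proj₂ isometry (pt g))
        g≈ : Approximates g (φ y)
        g≈ = pt-approximates {g} small φy≋
        hit′ : ∀ i → Satisfies (condition i) g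
        hit′ i = ≡.subst (λ θ → Satisfies θ g) (lookup∘tabulate condition i) (hit i)
        in-region : region y
        in-region i =
          lin (begin
            - r  ≤⟨ before-only-if (proj₁ (A i)) (proj₁ (G i)) g (normal≤1 i) (proj₂ (proj₂ (A i))) (proj₂ (G i)) g≈
                (proj₁ (hit′ i)) ⟩
            (φ y ⊖ φ (corner i 1)) ∙ normal lo i  ≈⟨ coordinate lo i y (corner i 1) ⟩
            y i - corner i 1 i  ≈⟨ +-congˡ (-‿cong (+[]-self lo i (fromℕ 1 * r))) ⟩
            y i - (lo i + fromℕ 1 * r)  ∎)
            (solve 3 (λ l r y → y :- l := (y :- (l :+ (con (+ 1) :+ con (+ 0)) :* r)) :- :- r) ≈-refl (lo i) r
                (y i)) ,
          lin (+-mono-≤ (n-fits i) (begin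
            - r  ≤⟨ before-only-if (proj₁ (A i)) g (proj₁ (H i)) (normal≤1 i) (proj₂ (proj₂ (A i))) g≈ (proj₂ (H i))
                (proj₂ (hit′ i)) ⟩
            (φ (corner i (2 ℕ.+ n i)) ⊖ φ y) ∙ normal lo i  ≈⟨ coordinate lo i (corner i (2 ℕ.+ n i)) y ⟩
            corner i (2 ℕ.+ n i) i - y i  ≈⟨ +-congʳ (+[]-self lo i (fromℕ (2 ℕ.+ n i) * r)) ⟩
            (lo i + fromℕ (2 ℕ.+ n i) * r) - y i  ∎))
            (solve 5 (λ l r y n h → h :- y := ((h :- l) :+ ((l :+ n :* r) :- y)) :- ((con (+ 1) :+ n) :* r :+ :- r))
                ≈-refl (lo i) r (y i) (fromℕ (2 ℕ.+ n i)) (hi i))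

  -- Nets for boxes of given volume

  ^-distribʳ-* : ∀ n a b → (a ℕ.* b) ℕ.^ n ≡ a ℕ.^ n ℕ.* b ℕ.^ n
  ^-distribʳ-* zero    a b = refl
  ^-distribʳ-* (suc n) a b = ≡.trans (≡.cong (a ℕ.* b ℕ.*_) (^-distribʳ-* n a b)) (lemma a b (a ℕ.^ n) (b ℕ.^ n))
    where
    lemma : ∀ a b c d → a ℕ.* b ℕ.* (c ℕ.* d) ≡ a ℕ.* c ℕ.* (b ℕ.* d)
    lemma = solve-∀

  module NetSize (d κ : ℕ) (0<κ : 1 ℕ.≤ κ) (p : ℕ) where

    open Grid d κ 0<κ p

    -- 1/`k` is the density guaranteed for the tests of boxes. An entry up to 2 M takes `b` bits, a
    -- vector b d bits, a condition three vectors and a test d conditions: `j` bits in all.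
    k j b : ℕ
    k = (2 ℕ.* μ) ℕ.^ d ℕ.* (2 ℕ.^ p ℕ.* 6 ℕ.^ d)
    b = 2 ℕ.+ (μ ℕ.* κ ℕ.+ p)
    j = (b ℕ.* d ℕ.+ (b ℕ.* d ℕ.+ b ℕ.* d)) ℕ.* d

    vectors : ℕ → List (Vec ℕ d)
    vectors B = allVecs (upTo (suc B)) d

    length-vectors : ∀ B → length (vectors B) ≡ suc B ℕ.^ d
    length-vectors B = ≡.trans (length-allVecs (upTo (suc B)) d) (≡.cong (ℕ._^ d) (List.length-upTo (suc B)))

    ∈-vectors : ∀ {B} g → Small B g → g ∈ vectors B
    ∈-vectors {B} g small = ≡.subst (_∈ vectors B) (tabulate∘lookup g)
      (∈-allVecs⁺ (lookup g) λ i → ∈-upTo⁺ (ℕ.s≤s (small i)))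

    vectors-small : ∀ {B} g → g ∈ vectors B → Small B g
    vectors-small g g∈ i = ℕ.s≤s⁻¹ (∈-upTo⁻ (∈-allVecs⁻ g∈ i))

    conditions : List Condition
    conditions = cartesianProductWith _,_ (vectors (2 ℕ.* M)) (cartesianProductWith _,_ (vectors (2 ℕ.* M)) (vectors
        (2 ℕ.* M)))

    tests : List Test
    tests = allVecs conditions d

    2M<2^b : suc (2 ℕ.* M) ℕ.≤ 2 ℕ.^ b
    2M<2^b = begin
      suc (2 ℕ.* M)  ≤⟨ ℕ.+-monoˡ-≤ (2 ℕ.* M) (ℕ.≤-trans 1≤M (ℕ.m≤n*m M 2)) ⟩
      2 ℕ.* M ℕ.+ 2 ℕ.* M  ≡⟨ lemma μ κ (2 ℕ.^ p) ⟩
      4 ℕ.* (μ ℕ.* κ ℕ.* 2 ℕ.^ p)  ≤⟨ ℕ.*-monoʳ-≤ 4 (ℕ.*-monoˡ-≤ (2 ℕ.^ p) (ℕ.<⇒≤ (n<2^n (μ ℕ.* κ)))) ⟩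
      4 ℕ.* (2 ℕ.^ (μ ℕ.* κ) ℕ.* 2 ℕ.^ p)  ≡⟨ ≡.cong (4 ℕ.*_) (≡.sym (ℕ.^-distribˡ-+-* 2 (μ ℕ.* κ) p)) ⟩
      4 ℕ.* 2 ℕ.^ (μ ℕ.* κ ℕ.+ p)  ≡⟨ ≡.sym (ℕ.^-distribˡ-+-* 2 2 (μ ℕ.* κ ℕ.+ p)) ⟩
      2 ℕ.^ b  ∎
      where
      open ℕ.≤-Reasoning
      lemma : ∀ μ κ q → 2 ℕ.* (μ ℕ.* (κ ℕ.* q)) ℕ.+ 2 ℕ.* (μ ℕ.* (κ ℕ.* q)) ≡ 4 ℕ.* (μ ℕ.* κ ℕ.* q)
      lemma = solve-∀

    length-tests : length tests ℕ.≤ 2 ℕ.^ j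
    length-tests = begin
      length tests  ≡⟨ length-allVecs conditions d ⟩
      length conditions ℕ.^ d  ≤⟨ ℕ.^-monoˡ-≤ d conditions≤ ⟩
      (2 ℕ.^ (b ℕ.* d ℕ.+ (b ℕ.* d ℕ.+ b ℕ.* d))) ℕ.^ d  ≡⟨ ℕ.^-*-assoc 2 (b ℕ.* d ℕ.+ (b ℕ.* d ℕ.+ b ℕ.* d)) d ⟩
      2 ℕ.^ j  ∎
      where
      open ℕ.≤-Reasoning
      V : List (Vec ℕ d)
      V = vectors (2 ℕ.* M)
      V≤ : length V ℕ.≤ 2 ℕ.^ (b ℕ.* d)
      V≤ = begin
        length V  ≡⟨ length-vectors (2 ℕ.* M) ⟩
        suc (2 ℕ.* M) ℕ.^ d  ≤⟨ ℕ.^-monoˡ-≤ d 2M<2^b ⟩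
        (2 ℕ.^ b) ℕ.^ d  ≡⟨ ℕ.^-*-assoc 2 b d ⟩
        2 ℕ.^ (b ℕ.* d)  ∎
      conditions≤ : length conditions ℕ.≤ 2 ℕ.^ (b ℕ.* d ℕ.+ (b ℕ.* d ℕ.+ b ℕ.* d))
      conditions≤ = begin
        length conditions  ≡⟨ length-cartesianProductWith _,_ V (cartesianProductWith _,_ V V) ⟩
        length V ℕ.* length (cartesianProductWith _,_ V V) ≡⟨ ≡.cong (length V ℕ.*_)
            (length-cartesianProductWith _,_ V V) ⟩
        length V ℕ.* (length V ℕ.* length V)  ≤⟨ ℕ.*-mono-≤ V≤ (ℕ.*-mono-≤ V≤ V≤) ⟩
        2 ℕ.^ (b ℕ.* d) ℕ.* (2 ℕ.^ (b ℕ.* d) ℕ.* 2 ℕ.^ (b ℕ.* d))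
          ≡⟨ ≡.cong (2 ℕ.^ (b ℕ.* d) ℕ.*_) (≡.sym (ℕ.^-distribˡ-+-* 2 (b ℕ.* d) (b ℕ.* d))) ⟩
        2 ℕ.^ (b ℕ.* d) ℕ.* 2 ℕ.^ (b ℕ.* d ℕ.+ b ℕ.* d)  ≡⟨ ≡.sym (ℕ.^-distribˡ-+-* 2 (b ℕ.* d)
            (b ℕ.* d ℕ.+ b ℕ.* d)) ⟩
        2 ℕ.^ (b ℕ.* d ℕ.+ (b ℕ.* d ℕ.+ b ℕ.* d))  ∎

    0<k : 0 ℕ.< k
    0<k = ℕ.*-mono-≤ (ℕ.m^n>0 (2 ℕ.* μ) d) (ℕ.*-mono-≤ (ℕ.m^n>0 2 p) (ℕ.m^n>0 6 d))

    grid : List (Vec ℕ d)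
    grid = vectors M

    0<grid : 0 ℕ.< length grid
    0<grid = ≡.subst (0 ℕ.<_) (≡.sym (length-vectors M)) (ℕ.m^n>0 (suc M) d)

    net : ∃[ N ] length N ℕ.≤ k ℕ.* j ℕ.+ 1 × All (_∈ grid) N ×
          (∀ {θ} → θ ∈ tests → Fat hits grid 0<grid k θ → HitBy hits grid 0<grid k N θ)
    net = hitting-set hits grid 0<grid k j tests length-tests 0<k

    net-list : List (Point d)
    net-list = List.map pt (proj₁ net)

    net⊆Cube : All (Cube d) net-list
    net⊆Cube = All.map⁺ (All.map (λ {g} g∈ → pt∈Cube {g} (vectors-small g g∈)) (proj₁ (proj₂ (proj₂ net))))

    -- The fraction 1/k of the grid: M = μK, and a box of side ≥ 6r and volume
    -- ≥ 2⁻ᵖ has at least K^d / (2ᵖ 6^d) lattice points.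
    net-hits : ∀ {φ} → IsIsometry φ → (I : Intervals d) → (∀ y → Intervals.region I y → Cube d (φ y)) →
               (∀ i → fromℕ 6 ≤ fromℕ K * Intervals.side I i) →
               1# ≤ fromℕ (2 ℕ.^ p) * Intervals.volume I →
               Any (λ z → ∃[ y ] Intervals.region I y × φ y ≋ z) net-list
    net-hits {φ} isometry I inside wide large = Any.map⁺ (Any-map∈ inside-if-hit (proj₁ (proj₂ (proj₂ net))) hit)
      where
      open Intervals I

      cells : ∀ i → ∃[ n ] 1 ℕ.≤ n × fromℕ (3 ℕ.+ n) ≤ fromℕ K * side i × fromℕ K * side i ≤ fromℕ 6 * fromℕ n
      cells i = helper (floor N x (≤-trans (fromℕ-nonneg 6) (wide i)) (≤-trans (<⇒≤ x<N) (fromℕ-mono-≤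
          (ℕ.m≤n+m N 2))))
        where
        x : Carrier
        x = fromℕ K * side i
        N : ℕ
        N = proj₁ (archimedean x)
        x<N : x < fromℕ N
        x<N = proj₂ (archimedean x)
        helper : ∃[ n ] n ℕ.≤ N × fromℕ n ≤ x × x ≤ fromℕ (2 ℕ.+ n) →
                 ∃[ n ] 1 ℕ.≤ n × fromℕ (3 ℕ.+ n) ≤ x × x ≤ fromℕ 6 * fromℕ n
        -- As x ≥ 6, the value found by `floor` has the form 4 + o. Giving up 3 units for the
        -- margins leaves 1 + o cells, and x ≤ 6 + o ≤ 6 (1 + o) is the origin of the powers of 6.
        helper (n , _ , lo≤ , ≤hi) with ℕ.m≤n⇒∃[o]m+o≡n (ℕ.+-cancelˡ-≤ 2 4 n (fromℕ-cancel-≤ (≤-trans (wide i) ≤hi)))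
        ... | o , refl = suc o , ℕ.s≤s ℕ.z≤n , lo≤ , ≤-trans ≤hi (≤-trans (fromℕ-mono-≤ le) (≈⇒≤ (fromℕ-* 6 (suc o))))
          where
          le : 6 ℕ.+ o ℕ.≤ 6 ℕ.* suc o
          le = ℕ.≤-trans (ℕ.+-monoʳ-≤ 6 (ℕ.m≤n*m o 6)) (ℕ.≤-reflexive (≡.sym (ℕ.*-suc 6 o)))

      n : Fin d → ℕ
      n i = proj₁ (cells i)

      cells-fit : ∀ i → fromℕ (3 ℕ.+ n i) * r ≤ side i
      cells-fit i = begin
        fromℕ (3 ℕ.+ n i) * r  ≤⟨ *-monoʳ-≤ (<⇒≤ 0<r) (proj₁ (proj₂ (proj₂ (cells i)))) ⟩
        fromℕ K * side i * r  ≈⟨ solve 3 (λ k s r → k :* s :* r := (k :* r) :* s) ≈-refl (fromℕ K) (side i) r ⟩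
        (fromℕ K * r) * side i  ≈⟨ *-congʳ Kr≈1 ⟩
        1# * side i  ≈⟨ *-identityˡ (side i) ⟩
        side i  ∎
        where open Reasoning

      module B = Range isometry I inside n cells-fit

      K^d≤ : K ℕ.^ d ℕ.≤ 2 ℕ.^ p ℕ.* 6 ℕ.^ d ℕ.* productℕ n
      K^d≤ = fromℕ-cancel-≤ (begin
        fromℕ (K ℕ.^ d)  ≈⟨ fromℕ-^ K d ⟩
        fromℕ K ^ d  ≈⟨ *-identityʳ _ ⟨
        fromℕ K ^ d * 1#  ≤⟨ *-monoˡ-≤ (^-nonneg d (fromℕ-nonneg K)) large ⟩
        fromℕ K ^ d * (fromℕ (2 ℕ.^ p) * volume)  ≈⟨ solve 3 (λ a b c → a :* (b :* c) := b :* (a :* c)) ≈-refl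
            (fromℕ K ^ d) (fromℕ (2 ℕ.^ p)) volume ⟩
        fromℕ (2 ℕ.^ p) * (fromℕ K ^ d * volume)  ≈⟨ *-congˡ (product-scale (fromℕ K) side) ⟨
        fromℕ (2 ℕ.^ p) * product (λ i → fromℕ K * side i)  ≤⟨ *-monoˡ-≤ (fromℕ-nonneg (2 ℕ.^ p))
                                                                    (product-mono-≤ (λ i → ≤-trans (fromℕ-nonneg 6)
                                                                        (wide i)) (λ i → proj₂ (proj₂ (proj₂
                                                                        (cells i))))) ⟩
        fromℕ (2 ℕ.^ p) * product (λ i → fromℕ 6 * fromℕ (n i))  ≈⟨ *-congˡ (product-scale (fromℕ 6) (λ i → fromℕ
            (n i))) ⟩
        fromℕ (2 ℕ.^ p) * (fromℕ 6 ^ d * product (λ i → fromℕ (n i)))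
                                                               ≈⟨ *-congˡ (*-cong (≈-sym (fromℕ-^ 6 d))
                                                                   (product-fromℕ n)) ⟩
        fromℕ (2 ℕ.^ p) * (fromℕ (6 ℕ.^ d) * fromℕ (productℕ n))
                                                               ≈⟨ *-assoc _ _ _ ⟨
        (fromℕ (2 ℕ.^ p) * fromℕ (6 ℕ.^ d)) * fromℕ (productℕ n)
                                                               ≈⟨ *-congʳ (fromℕ-* (2 ℕ.^ p) (6 ℕ.^ d)) ⟨
        fromℕ (2 ℕ.^ p ℕ.* 6 ℕ.^ d) * fromℕ (productℕ n)  ≈⟨ fromℕ-* (2 ℕ.^ p ℕ.* 6 ℕ.^ d) (productℕ n) ⟨
        fromℕ (2 ℕ.^ p ℕ.* 6 ℕ.^ d ℕ.* productℕ n)  ∎)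
        where open Reasoning

      fat : Fat hits grid 0<grid k B.test
      fat = begin
        length grid  ≡⟨ length-vectors M ⟩
        suc M ℕ.^ d  ≤⟨ ℕ.^-monoˡ-≤ d (ℕ.≤-trans (ℕ.+-monoˡ-≤ M 1≤M) (ℕ.≤-reflexive (lemma μ K))) ⟩
        (2 ℕ.* μ ℕ.* K) ℕ.^ d  ≡⟨ ^-distribʳ-* d (2 ℕ.* μ) K ⟩
        (2 ℕ.* μ) ℕ.^ d ℕ.* K ℕ.^ d  ≤⟨ ℕ.*-monoʳ-≤ ((2 ℕ.* μ) ℕ.^ d) K^d≤ ⟩
        (2 ℕ.* μ) ℕ.^ d ℕ.* (2 ℕ.^ p ℕ.* 6 ℕ.^ d ℕ.* productℕ n)  ≡⟨ ≡.sym (ℕ.*-assoc ((2 ℕ.* μ) ℕ.^ d)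
            (2 ℕ.^ p ℕ.* 6 ℕ.^ d) (productℕ n)) ⟩
        k ℕ.* productℕ n  ≤⟨ ℕ.*-monoʳ-≤ k (injection⇒count B.grid-point B.grid-point-injective (hits B.test) grid
                                                                (λ c → ∈-vectors (B.grid-point c)
                                                                    (B.grid-point-small c))
                                                                (λ c → dec-true (hits? B.test (B.grid-point c))
                                                                    (B.grid-point-hits c))) ⟩
        k ℕ.* count (hits B.test) grid  ∎
        where
        open ℕ.≤-Reasoning
        lemma : ∀ μ K → μ ℕ.* K ℕ.+ μ ℕ.* K ≡ 2 ℕ.* μ ℕ.* K
        lemma = solve-∀

      test∈ : B.test ∈ tests
      test∈ = ∈-allVecs⁺ B.condition λ i →
        let sa , sg , sh = B.test-small i
            a , g , h = B.condition i
        in ∈-cartesianProductWith⁺ _,_ (∈-vectors a sa)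
             (∈-cartesianProductWith⁺ _,_ (∈-vectors g λ k → ℕ.≤-trans (sg k) (ℕ.m≤n*m M 2))
                                          (∈-vectors h λ k → ℕ.≤-trans (sh k) (ℕ.m≤n*m M 2)))

      hit : HitBy hits grid 0<grid k (proj₁ net) B.test
      hit = proj₂ (proj₂ (proj₂ net)) test∈ fat

      inside-if-hit : ∀ {g} → g ∈ grid → hits B.test g ≡ true → ∃[ y ] region y × φ y ≋ pt g
      inside-if-hit {g} g∈ h = B.hits⇒inside {g} (vectors-small g g∈) (does⇒ (hits? B.test g) h)

      Any-map∈ : ∀ {A : Set} {P Q S : A → Set} {xs} → (∀ {x} → P x → Q x → S x) → All P xs → Any Q xs → Any S xs
      Any-map∈ f (p ∷ _)  (here q)  = here (f p q)
      Any-map∈ f (_ ∷ ps) (there q) = there (Any-map∈ f ps q)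

  -- What remains of k j + 1 once 2 ^ p and p + 1 are taken out, using b ≤ (2 + μ κ) (p + 1).
  net-constant : ℕ → ℕ → ℕ
  net-constant d κ = (2 ℕ.* μ) ℕ.^ d ℕ.* 6 ℕ.^ d ℕ.* ((2 ℕ.+ μ ℕ.* κ) ℕ.* (3 ℕ.* d ℕ.* d)) ℕ.+ 1
    where
    μ : ℕ
    μ = suc (3 ℕ.* d)

  1≤net-constant : ∀ d κ → 1 ℕ.≤ net-constant d κ
  1≤net-constant d κ = ℕ.m≤n+m 1 _

  length-net : ∀ d κ 0<κ p → length (NetSize.net-list d κ 0<κ p) ℕ.≤ net-constant d κ ℕ.* (2 ℕ.^ p ℕ.* suc p)
  length-net d κ 0<κ p = begin
    length net-list  ≡⟨ List.length-map pt (proj₁ net) ⟩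
    length (proj₁ net)  ≤⟨ proj₁ (proj₂ net) ⟩
    k ℕ.* j ℕ.+ 1  ≤⟨ ℕ.+-mono-≤ (ℕ.*-monoʳ-≤ k (ℕ.≤-trans (ℕ.≤-reflexive (lemma b d)) (ℕ.*-monoˡ-≤ D b≤)))
        (ℕ.*-mono-≤ (ℕ.m^n>0 2 p) (ℕ.s≤s (ℕ.z≤n {p}))) ⟩
    a ℕ.* (2 ℕ.^ p ℕ.* s) ℕ.* ((2 ℕ.+ c) ℕ.* suc p ℕ.* D) ℕ.+ 2 ℕ.^ p ℕ.* suc p
                                  ≡⟨ lemma′ a (2 ℕ.^ p) s (2 ℕ.+ c) (suc p) D ⟩
    (a ℕ.* s ℕ.* ((2 ℕ.+ c) ℕ.* D) ℕ.+ 1) ℕ.* (2 ℕ.^ p ℕ.* suc p)  ∎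
    where
    open ℕ.≤-Reasoning
    open NetSize d κ 0<κ p
    open Grid d κ 0<κ p
    a s c D : ℕ
    a = (2 ℕ.* μ) ℕ.^ d
    s = 6 ℕ.^ d
    c = μ ℕ.* κ
    D = 3 ℕ.* d ℕ.* d
    lemma : ∀ b d → (b ℕ.* d ℕ.+ (b ℕ.* d ℕ.+ b ℕ.* d)) ℕ.* d ≡ b ℕ.* (3 ℕ.* d ℕ.* d)
    lemma = solve-∀
    lemma′ : ∀ a q s c t D → a ℕ.* (q ℕ.* s) ℕ.* (c ℕ.* t ℕ.* D) ℕ.+ q ℕ.* t ≡ (a ℕ.* s ℕ.* (c ℕ.* D) ℕ.+ 1) ℕ.*
        (q ℕ.* t)
    lemma′ = solve-∀
    b≤ : b ℕ.≤ (2 ℕ.+ c) ℕ.* suc p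
    b≤ = begin
      2 ℕ.+ (c ℕ.+ p)  ≡⟨ ≡.sym (ℕ.+-assoc 2 c p) ⟩
      (2 ℕ.+ c) ℕ.+ p  ≤⟨ ℕ.+-monoʳ-≤ (2 ℕ.+ c) (ℕ.m≤n*m p (2 ℕ.+ c)) ⟩
      (2 ℕ.+ c) ℕ.+ (2 ℕ.+ c) ℕ.* p  ≡⟨ ≡.sym (ℕ.*-suc (2 ℕ.+ c) p) ⟩
      (2 ℕ.+ c) ℕ.* suc p  ∎

  -- Outer measure of boxes

  sum-step : ∀ B v (f : ℕ → Carrier) → (∀ n → n ℕ.< B → f n ≈ v) → (∀ n → B ℕ.≤ n → f n ≈ 0#) →
             ∀ N → B ℕ.≤ N → sum {N} (λ i → f (toℕ i)) ≈ fromℕ B * v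
  sum-step zero    v f below above N       _             =
    ≈-trans (sum-zero {N} λ i → above (toℕ i) ℕ.z≤n) (≈-sym (zeroˡ v))
  sum-step (suc B) v f below above (suc N) (ℕ.s≤s B≤N) = ≈-trans
    (+-cong (below 0 (ℕ.s≤s ℕ.z≤n))
      (sum-step B v (f ∘ suc) (λ n → below (suc n) ∘ ℕ.s≤s) (λ n → above (suc n) ∘ ℕ.s≤s) N B≤N))
    (solve 2 (λ b v → v :+ b :* v := (con (+ 1) :+ b) :* v) ≈-refl (fromℕ B) v)

  eventually-constant : ∀ {f l} N₀ → (∀ n → N₀ ℕ.≤ n → f n ≈ l) → ConvergesTo f l
  eventually-constant {f} {l} N₀ eq e 0<e = N₀ , λ n N₀≤n →
    lin< 0<e (≈-trans (+-congˡ (-‿cong (eq n N₀≤n))) (solve 2 (λ l e → (l :+ e) :- l := e :- con (+ 0)) ≈-refl l e)) ,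
    lin< 0<e (≈-trans (+-congʳ (+-congʳ (eq n N₀≤n))) (solve 2 (λ l e → (l :+ e) :- l := e :- con (+ 0)) ≈-refl l e))

  -- The outer measure is defined by sequences of intervals, so the finite cover is continued by
  -- single points. Their volume vanishes because the dimension is positive, and the partial sums
  -- are eventually constant.
  finite-cover : ∀ {d ε v} {S : PointSet (suc d)} B (Q : Fin B → Intervals (suc d)) →
                 (∀ b → Intervals.volume (Q b) ≈ v) → (∀ x → S x → ∃[ b ] Intervals.region (Q b) x) →
                 ε ≤μ S → ε ≤ fromℕ B * v
  finite-cover {d} {ε} {v} {S} B Q vol cover ε≤μS =
    ε≤μS (λ n → box (n ℕ.<? B)) covered (fromℕ B * v)
      (eventually-constant B (sum-step B v (λ n → Intervals.volume (box (n ℕ.<? B)))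
        (λ n → below (n ℕ.<? B)) (λ n → above (n ℕ.<? B))))
    where
    point : Intervals (suc d)
    point = record { lo = λ _ → 0# ; hi = λ _ → 0# ; lo≤hi = λ _ → ≤-refl }
    box : ∀ {n} → Dec (n ℕ.< B) → Intervals (suc d)
    box (yes n<B) = Q (Fin.fromℕ< n<B)
    box (no _)    = point
    below : ∀ {n} (n<?B : Dec (n ℕ.< B)) → n ℕ.< B → Intervals.volume (box n<?B) ≈ v
    below (yes n<B) _   = vol (Fin.fromℕ< n<B)
    below (no n≮B)  n<B = ⊥-elim (n≮B n<B)
    above : ∀ {n} (n<?B : Dec (n ℕ.< B)) → B ℕ.≤ n → Intervals.volume (box n<?B) ≈ 0#
    above (yes n<B) B≤n = ⊥-elim (ℕ.<-irrefl refl (ℕ.<-≤-trans n<B B≤n))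
    above (no _)    _   = ≈-trans (*-congʳ (solve 0 (con (+ 0) :- con (+ 0) := con (+ 0)) ≈-refl)) (zeroˡ _)
    covered : ∀ {x} → S x → ∃[ n ] Intervals.region (box (n ℕ.<? B)) x
    covered {x} x∈S =
      let b , x∈b = cover x x∈S
      in toℕ b , at (toℕ b ℕ.<? B) b refl x∈b
      where
      at : ∀ {n} (n<?B : Dec (n ℕ.< B)) b → toℕ b ≡ n → Intervals.region (Q b) x → Intervals.region (box n<?B) x
      at (yes n<B) b refl x∈b = ≡.subst (λ b → Intervals.region (Q b) x) (≡.sym (Fin.fromℕ<-toℕ b n<B)) x∈b
      at (no n≮B)  b refl x∈b = ⊥-elim (n≮B (Fin.toℕ<n b))

  -- A tilted box has to be covered by axis-parallel cubes: one around the image of each point of a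
  -- mesh of spacing r, of half-width d r because an isometry stretches coordinatewise distances at
  -- most by d. The loss of a factor 2 d and a summand 3 r for each side stands in for the rotation
  -- invariance of the measure.
  module CoverByCubes {d₀ : ℕ} {ε K r : Carrier} {φ : Point (suc d₀) → Point (suc d₀)} {S : PointSet (suc d₀)}
           (isometry : IsIsometry φ) (I : Intervals (suc d₀))
           (S⊆ : ∀ x → S x → ∃[ y ] Intervals.region I y × φ y ≋ x)
           (0<r : 0# < r) (0<K : 0# < K) (Kr≈1 : K * r ≈ 1#) where

    open Intervals I

    private
      d : ℕ
      d = suc d₀

      0≤r : 0# ≤ r
      0≤r = <⇒≤ 0<r

      h : Carrier
      h = fromℕ d * r

      0≤h : 0# ≤ h
      0≤h = *-nonneg (fromℕ-nonneg d) 0≤r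

      cells : ∀ i → ∃[ n ] fromℕ n ≤ K * side i × K * side i ≤ fromℕ (2 ℕ.+ n)
      cells i =
        let N , x<N = archimedean (K * side i)
            n , _ , lo≤ , ≤hi = floor N (K * side i) (*-nonneg (<⇒≤ 0<K) (≤⇒0≤- (lo≤hi i)))
                                  (≤-trans (<⇒≤ x<N) (fromℕ-mono-≤ (ℕ.m≤n+m N 2)))
        in n , lo≤ , ≤hi

      n m : Fin d → ℕ
      n i = proj₁ (cells i)
      -- `round` returns a number from 0 to 2 + n i.
      m i = 3 ℕ.+ n i

      mesh : (∀ i → Fin (m i)) → Point d
      mesh b i = lo i + fromℕ (toℕ (b i)) * r

      nearest-mesh : ∀ {y} → region y → ∃[ b ] (∀ i → ∣ mesh b i - y i ∣≤ r)
      nearest-mesh {y} y∈ = (λ i → Fin.fromℕ< (ℕ.s≤s (proj₁ (proj₂ (B i))))) ,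
        (λ i → ≡.subst (λ b → ∣ (lo i + fromℕ b * r) - y i ∣≤ r)
                 (≡.sym (Fin.toℕ-fromℕ< (ℕ.s≤s (proj₁ (proj₂ (B i))))))
                 (abs-weaken (≈⇒≤ (*-identityˡ r)) (abs-cong (eq i) (abs-* (proj₂ (proj₂ (B i)))
                     (abs-nonneg 0≤r ≤-refl)))))
        where
        open Reasoning
        B : ∀ i → ∃[ b ] b ℕ.≤ 2 ℕ.+ n i × ∣ fromℕ b - K * (y i - lo i) ∣≤ 1#
        B i = round (ℕ.s≤s ℕ.z≤n) (K * (y i - lo i)) (*-nonneg (<⇒≤ 0<K) (≤⇒0≤- (proj₁ (y∈ i))))
          (≤-trans (*-monoˡ-≤ (<⇒≤ 0<K) (+-mono-≤ (proj₂ (y∈ i)) ≤-refl)) (proj₂ (proj₂ (cells i))))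
        eq : ∀ i → (fromℕ (proj₁ (B i)) - K * (y i - lo i)) * r ≈ (lo i + fromℕ (proj₁ (B i)) * r) - y i
        eq i = begin-equality
          (b - K * (y i - lo i)) * r  ≈⟨ solve 5 (λ b K y l r → (b :- K :* (y :- l)) :* r := b :* r :- (K :* r) :*
              (y :- l)) ≈-refl b K (y i) (lo i) r ⟩
          b * r - (K * r) * (y i - lo i)  ≈⟨ +-congˡ (-‿cong (1*-cancel Kr≈1)) ⟩
          b * r - (y i - lo i)  ≈⟨ solve 3 (λ b y l → b :- (y :- l) := (l :+ b) :- y) ≈-refl (b * r) (y i) (lo i) ⟩
          (lo i + b * r) - y i  ∎
          where
          b : Carrier
          b = fromℕ (proj₁ (B i))

      cube : (∀ i → Fin (m i)) → Intervals d
      cube b = record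
        { lo    = λ k → φ (mesh b) k - h
        ; hi    = λ k → φ (mesh b) k + h
        ; lo≤hi = λ k → lin (+-mono-≤ 0≤h 0≤h)
            (solve 2 (λ x h → (x :+ h) :- (x :- h) := (h :+ h) :- (con (+ 0) :+ con (+ 0))) ≈-refl (φ (mesh b) k) h)
        }

      v : Carrier
      v = (h + h) ^ d

      volume-cube : ∀ b → Intervals.volume (cube b) ≈ v
      volume-cube b = ≈-trans
        (product-cong λ k → solve 2 (λ x h → (x :+ h) :- (x :- h) := h :+ h) ≈-refl (φ (mesh b) k) h)
        (product-const d (h + h))

      cover : ∀ x → S x → ∃[ c ] Intervals.region (cube (decode m c)) x
      cover x x∈S =
        let y , y∈ , φy≋x = S⊆ x x∈S
            b , near = nearest-mesh y∈
            c = encode m b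
            close = Isometry.close isometry {x = mesh (decode m c)} {y} {r} λ k →
              ≡.subst (λ j → ∣ (lo k + fromℕ (toℕ j) * r) - y k ∣≤ r) (≡.sym (decode-encode m b k)) (near k)
        in c , λ k →
          ≤-trans (lin (proj₁ (close k)) (solve 3 (λ a y h → y :- (a :- h) := h :- (a :- y)) ≈-refl (φ (mesh
              (decode m c)) k) (φ y k) h))
                  (≈⇒≤ (φy≋x k)) ,
          ≤-trans (≈⇒≤ (≈-sym (φy≋x k)))
                  (lin (proj₂ (close k)) (solve 3 (λ a y h → (a :+ h) :- y := h :- :- (a :- y)) ≈-refl (φ (mesh
                      (decode m c)) k) (φ y k) h))

    measure≤sides : ε ≤μ S → ε ≤ product (λ i → (fromℕ 2 * fromℕ d) * (side i + fromℕ 3 * r))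
    measure≤sides ε≤μS = begin
      ε  ≤⟨ finite-cover (productℕ m) (λ c → cube (decode m c)) (λ c → volume-cube (decode m c)) cover ε≤μS ⟩
      fromℕ (productℕ m) * v  ≈⟨ *-congʳ (product-fromℕ m) ⟨
      product (λ i → fromℕ (m i)) * v  ≈⟨ *-comm _ v ⟩
      v * product (λ i → fromℕ (m i))  ≈⟨ product-scale (h + h) (λ i → fromℕ (m i)) ⟨
      product (λ i → (h + h) * fromℕ (m i))  ≤⟨ product-mono-≤ (λ i → *-nonneg 0≤h+h (fromℕ-nonneg (m i))) factor ⟩
      product (λ i → (fromℕ 2 * fromℕ d) * (side i + fromℕ 3 * r))  ∎
      where
      open Reasoning
      0≤h+h : 0# ≤ h + h
      0≤h+h = ≤-trans (≈⇒≤ (≈-sym (+-identityˡ 0#))) (+-mono-≤ 0≤h 0≤h)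
      factor : ∀ i → (h + h) * fromℕ (m i) ≤ (fromℕ 2 * fromℕ d) * (side i + fromℕ 3 * r)
      factor i = begin
        (h + h) * fromℕ (m i)  ≈⟨ *-congˡ (fromℕ-+ 3 (n i)) ⟩
        (h + h) * (fromℕ 3 + fromℕ (n i))
          ≈⟨ solve 3 (λ d r n → (d :* r :+ d :* r) :* (con (+ 3) :+ n) := (con (+ 2) :* d) :* (n :* r :+ con
              (+ 3) :* r)) ≈-refl (fromℕ d) r (fromℕ (n i)) ⟩
        (fromℕ 2 * fromℕ d) * (fromℕ (n i) * r + fromℕ 3 * r)
          ≤⟨ *-monoˡ-≤ (*-nonneg (fromℕ-nonneg 2) (fromℕ-nonneg d)) (+-mono-≤ (*-monoʳ-≤ 0≤r (proj₁ (proj₂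
              (cells i)))) ≤-refl) ⟩
        (fromℕ 2 * fromℕ d) * (K * side i * r + fromℕ 3 * r)
          ≈⟨ *-congˡ (+-congʳ (≈-trans (solve 3 (λ K s r → K :* s :* r := (K :* r) :* s) ≈-refl K (side i) r)
              (1*-cancel Kr≈1))) ⟩
        (fromℕ 2 * fromℕ d) * (side i + fromℕ 3 * r)  ∎

  -- Epsilon-nets

  ⟦_⟧ˡ : ∀ {d} → List (Point d) → PointSet d
  ⟦ xs ⟧ˡ x = Any (x ≋_) xs

  ∈-⟦⟧ˡ : ∀ {d} {P : PointSet d} {xs : List (Point d)} → Any P xs → ∃[ x ] ⟦ xs ⟧ˡ x × P x
  ∈-⟦⟧ˡ any = let x , x∈ , px = find any in x , Any.map (λ { refl _ → ≈-refl }) x∈ , px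

  Cube-resp : ∀ {d} {x y : Point d} → x ≋ y → Cube d y → Cube d x
  Cube-resp x≋y c k = ≤-trans (proj₁ (c k)) (≈⇒≤ (≈-sym (x≋y k))) , ≤-trans (≈⇒≤ (x≋y k)) (proj₂ (c k))

  ⟦⟧ˡ⊆Cube : ∀ {d} {xs : List (Point d)} → All (Cube d) xs → ∀ {x} → ⟦ xs ⟧ˡ x → Cube d x
  ⟦⟧ˡ⊆Cube (c ∷ _)  (here x≋)  = Cube-resp x≋ c
  ⟦⟧ˡ⊆Cube (_ ∷ cs) (there x∈) = ⟦⟧ˡ⊆Cube cs x∈

  ⟦⟧ˡ-resp : ∀ {d} {xs : List (Point d)} {x y} → x ≋ y → ⟦ xs ⟧ˡ x → ⟦ xs ⟧ˡ y
  ⟦⟧ˡ-resp x≋y = Any.map λ x≋ k → ≈-trans (≈-sym (x≋y k)) (x≋ k)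

  2^-mono-cancel : ∀ m n → fromℕ (2 ℕ.^ m) ≤ fromℕ (2 ℕ.^ n) → m ℕ.≤ n
  2^-mono-cancel m n le = ℕ.≮⇒≥ λ n<m → ℕ.<-irrefl refl (ℕ.<-≤-trans (ℕ.^-monoʳ-< 2 (ℕ.s≤s (ℕ.s≤s ℕ.z≤n)) n<m)
      (fromℕ-cancel-≤ le))

  2^-split : ∀ m n → fromℕ (2 ℕ.^ (m ℕ.+ n)) ≈ fromℕ (2 ℕ.^ m) * fromℕ (2 ℕ.^ n)
  2^-split m n = ≈-trans (≈-reflexive (≡.cong fromℕ (ℕ.^-distribˡ-+-* 2 m n))) (fromℕ-* (2 ℕ.^ m) (2 ℕ.^ n))

  -- With p = a + 2 + q the hypotheses give 2 ^ (2 + q) ≤ y, so q + 1 ≤ 2 ℓ by `ln-lower`; the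
  -- additive a + 3 turns into a factor because q + 1 ≥ 1. This converts the binary exponents of
  -- nets and levels into natural logarithms.
  exponent-bound : ∀ {y ℓ} a p → IsLn y ℓ → fromℕ (2 ℕ.^ (a ℕ.+ 2)) ≤ fromℕ (2 ℕ.^ p) →
                   fromℕ (2 ℕ.^ p) ≤ fromℕ (2 ℕ.^ a) * y → fromℕ (suc p) ≤ fromℕ (a ℕ.+ 3) * (fromℕ 2 * ℓ)
  exponent-bound {y} {ℓ} a p ln lower upper =
    bound (ℕ.m≤n⇒∃[o]m+o≡n (2^-mono-cancel (a ℕ.+ 2) p lower))
    where
    open Reasoning
    0<2^a : 0# < fromℕ (2 ℕ.^ a)
    0<2^a = <-≤-trans 0<1 (1≤fromℕ (ℕ.m^n>0 2 a))
    bound : (∃[ q ] (a ℕ.+ 2) ℕ.+ q ≡ p) → fromℕ (suc p) ≤ fromℕ (a ℕ.+ 3) * (fromℕ 2 * ℓ)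
    bound (q , refl) = begin
      fromℕ (suc ((a ℕ.+ 2) ℕ.+ q))  ≤⟨ fromℕ-mono-≤ nat ⟩
      fromℕ ((a ℕ.+ 3) ℕ.* suc q)  ≈⟨ fromℕ-* (a ℕ.+ 3) (suc q) ⟩
      fromℕ (a ℕ.+ 3) * fromℕ (suc q)  ≤⟨ *-monoˡ-≤ (fromℕ-nonneg (a ℕ.+ 3)) (ln-lower q {y} {ℓ} ln (*-cancelˡ-≤ 0<2^a
          (begin
        fromℕ (2 ℕ.^ a) * fromℕ (2 ℕ.^ (2 ℕ.+ q))  ≈⟨ 2^-split a (2 ℕ.+ q) ⟨
        fromℕ (2 ℕ.^ (a ℕ.+ (2 ℕ.+ q)))  ≡⟨ ≡.cong (λ e → fromℕ (2 ℕ.^ e)) (≡.sym (ℕ.+-assoc a 2 q)) ⟩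
        fromℕ (2 ℕ.^ ((a ℕ.+ 2) ℕ.+ q))  ≤⟨ upper ⟩
        fromℕ (2 ℕ.^ a) * y  ∎))) ⟩
      fromℕ (a ℕ.+ 3) * (fromℕ 2 * ℓ)  ∎
      where
      nat : suc ((a ℕ.+ 2) ℕ.+ q) ℕ.≤ (a ℕ.+ 3) ℕ.* suc q
      nat = ℕ.≤-trans (ℕ.≤-reflexive (≡.cong (ℕ._+ q) (≡.sym (ℕ.+-suc a 2))))
        (ℕ.≤-trans (ℕ.+-monoʳ-≤ (a ℕ.+ 3) (ℕ.≤-trans (ℕ.m≤m+n q (suc (a ℕ.+ 1) ℕ.* q)) (ℕ.*-monoˡ-≤ q {suc (suc
            (a ℕ.+ 1))} {a ℕ.+ 3} (ℕ.≤-reflexive (≡.sym (≡.trans (ℕ.+-suc a 2) (≡.cong suc (ℕ.+-suc a 1))))))))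
          (ℕ.≤-reflexive (≡.sym (ℕ.*-suc (a ℕ.+ 3) q))))

  module EpsilonNet (d₀ : ℕ) where

    -- The measure bound is a product of factors 2 d (side + 3 r). If one side is below 6 r, its
    -- factor is at most 18 d r and the others are at most 8 d², so the measure is at most c r < κ
    -- r. If all sides are at least 3 r, each factor is at most 4 d times the side, so ε ≤ A ·
    -- volume. Finally 2 ^ p ≤ 4 A y + 1 ≤ 5 A y ≤ 2 ^ a · y for y = 1/ε ≥ 1.
    d κ c A a constant : ℕ
    d = suc d₀
    c = 18 ℕ.* d ℕ.* (8 ℕ.* d ℕ.* d) ℕ.^ d₀
    κ = suc c
    A = (4 ℕ.* d) ℕ.^ d
    a = 5 ℕ.* A
    constant = net-constant d κ ℕ.* (2 ℕ.^ a ℕ.* ((a ℕ.+ 3) ℕ.* 2))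

    1≤A : 1 ℕ.≤ A
    1≤A = ℕ.m^n>0 (4 ℕ.* d) d

    module AtScale (p : ℕ) where
      open Grid d κ (ℕ.s≤s ℕ.z≤n) p public
      open NetSize d κ (ℕ.s≤s ℕ.z≤n) p public

      0<K : 0# < fromℕ K
      0<K = <-≤-trans 0<1 (1≤fromℕ 1≤K)

      module _ {ε : Carrier} (A≤ : fromℕ A ≤ fromℕ (2 ℕ.^ p) * ε) (S : PointSet d) (S⊆Cube : S ⊆ Cube d)
               (box : Box d) (S≐ : S ≐ Box.image box) (ε≤μS : ε ≤μ S) where

        open Box box
        open Intervals intervals
        open Isometry isometry

        private
          dᴿ : Carrier
          dᴿ = fromℕ d

          0≤d : 0# ≤ dᴿ
          0≤d = fromℕ-nonneg d

          0≤2d : 0# ≤ fromℕ 2 * dᴿ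
          0≤2d = *-nonneg (fromℕ-nonneg 2) 0≤d

          0≤r : 0# ≤ r
          0≤r = <⇒≤ 0<r

          inside : ∀ y → region y → Cube d (φ y)
          inside y y∈ = S⊆Cube (proj₂ S≐ (y , y∈ , λ k → ≈-refl))

          f : Fin d → Carrier
          f i = (fromℕ 2 * dᴿ) * (side i + fromℕ 3 * r)

          0≤f : ∀ i → 0# ≤ f i
          0≤f i = *-nonneg 0≤2d (≤-trans (≈⇒≤ (≈-sym (+-identityˡ 0#)))
            (+-mono-≤ (≤⇒0≤- (lo≤hi i)) (*-nonneg (fromℕ-nonneg 3) 0≤r)))

          ε≤f : ε ≤ product f
          ε≤f = CoverByCubes.measure≤sides isometry intervals (λ x x∈S → proj₁ S≐ x∈S) 0<r 0<K Kr≈1 ε≤μS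

          -- The opposite corners `lo` and `hi` have images in the unit cube, and `close⁻¹` bounds
          -- their coordinates' differences.
          side≤d : ∀ i → side i ≤ dᴿ
          side≤d i = ≤-trans (proj₁ (close⁻¹ {x = hi} {y = lo} {e = 1#} (λ k →
              let c = inside hi (λ i → lo≤hi i , ≤-refl) k ; c′ = inside lo (λ i → ≤-refl , lo≤hi i) k
              in ≤-trans (lin (+-mono-≤ (proj₂ c) (proj₁ c′)) (solve 3 (λ x y h → (h :+ h) :- (x :- y) := (h :+ y) :- (x :+ :- h)) ≈-refl (φ hi k) (φ lo k) ½ᴿ)) (≈⇒≤ ½+½) ,
                 ≤-trans (lin (+-mono-≤ (proj₂ c′) (proj₁ c)) (solve 3 (λ x y h → (h :+ h) :- :- (x :- y) :=
                     (h :+ x) :- (y :+ :- h)) ≈-refl (φ hi k) (φ lo k) ½ᴿ)) (≈⇒≤ ½+½)) i))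
            (≈⇒≤ (*-identityʳ dᴿ))

          r≤d : r ≤ dᴿ
          r≤d = begin
            r  ≈⟨ *-identityˡ r ⟨
            1# * r  ≤⟨ *-monoʳ-≤ 0≤r (1≤fromℕ 1≤K) ⟩
            fromℕ K * r  ≈⟨ Kr≈1 ⟩
            1#  ≤⟨ 1≤fromℕ {d} (ℕ.s≤s ℕ.z≤n) ⟩
            dᴿ  ∎
            where open Reasoning

          0<2^p : 0# < fromℕ (2 ℕ.^ p)
          0<2^p = <-≤-trans 0<1 (1≤fromℕ (ℕ.m^n>0 2 p))

          κr≤ε : fromℕ κ * r ≤ ε
          κr≤ε = *-cancelˡ-≤ 0<2^p (begin
            fromℕ (2 ℕ.^ p) * (fromℕ κ * r)  ≈⟨ solve 3 (λ q k r → q :* (k :* r) := (k :* q) :* r) ≈-refl (fromℕ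
                (2 ℕ.^ p)) (fromℕ κ) r ⟩
            (fromℕ κ * fromℕ (2 ℕ.^ p)) * r  ≈⟨ *-congʳ (fromℕ-* κ (2 ℕ.^ p)) ⟨
            fromℕ K * r  ≈⟨ Kr≈1 ⟩
            1#  ≤⟨ 1≤fromℕ 1≤A ⟩
            fromℕ A  ≤⟨ A≤ ⟩
            fromℕ (2 ℕ.^ p) * ε  ∎)
            where open Reasoning

          f≤ : ∀ i → f i ≤ fromℕ (8 ℕ.* d ℕ.* d)
          f≤ i = begin
            (fromℕ 2 * dᴿ) * (side i + fromℕ 3 * r)  ≤⟨ *-monoˡ-≤ 0≤2d (+-mono-≤ (side≤d i) (*-monoˡ-≤
                (fromℕ-nonneg 3) r≤d)) ⟩
            (fromℕ 2 * dᴿ) * (dᴿ + fromℕ 3 * dᴿ)  ≈⟨ solve 1 (λ d → (con (+ 2) :* d) :* (d :+ con (+ 3) :* d) := con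
                (+ 8) :* d :* d) ≈-refl dᴿ ⟩
            fromℕ 8 * dᴿ * dᴿ  ≈⟨ *-congʳ (fromℕ-* 8 d) ⟨
            fromℕ (8 ℕ.* d) * dᴿ  ≈⟨ fromℕ-* (8 ℕ.* d) d ⟨
            fromℕ (8 ℕ.* d ℕ.* d)  ∎
            where open Reasoning

          -- A side shorter than 6r would force the measure of the box below κr ≤ ε.
          wide : ∀ i → fromℕ 6 ≤ fromℕ K * side i
          wide i thin = κr≤ε (begin-strict
            ε  ≤⟨ ε≤f ⟩
            product f  ≈⟨ product-remove i f ⟩
            f i * product (removeAt f i)  ≤⟨ *-mono-≤ (0≤f i) (^-nonneg d₀ (fromℕ-nonneg (8 ℕ.* d ℕ.* d))) fi≤
                                                              (≤-trans (product-mono-≤ (λ k → 0≤f (punchIn i k))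
                                                                  (λ k → f≤ (punchIn i k))) (≈⇒≤ (product-const d₀
                                                                  (fromℕ (8 ℕ.* d ℕ.* d))))) ⟩
            (fromℕ 18 * dᴿ * r) * fromℕ (8 ℕ.* d ℕ.* d) ^ d₀
                                                         ≈⟨ *-cong (*-congʳ (fromℕ-* 18 d)) (fromℕ-^
                                                             (8 ℕ.* d ℕ.* d) d₀) ⟨
            (fromℕ (18 ℕ.* d) * r) * fromℕ ((8 ℕ.* d ℕ.* d) ℕ.^ d₀)
                                                         ≈⟨ solve 3 (λ a r b → (a :* r) :* b := (a :* b) :* r) ≈-refl
                                                             (fromℕ (18 ℕ.* d)) r (fromℕ ((8 ℕ.* d ℕ.* d) ℕ.^ d₀)) ⟩
            (fromℕ (18 ℕ.* d) * fromℕ ((8 ℕ.* d ℕ.* d) ℕ.^ d₀)) * r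
                                                         ≈⟨ *-congʳ (fromℕ-* (18 ℕ.* d) ((8 ℕ.* d ℕ.* d) ℕ.^ d₀)) ⟨
            fromℕ c * r  <⟨ lin< 0<r (solve 2 (λ c r → (con (+ 1) :+ c) :* r :- c :* r := r :- con (+ 0)) ≈-refl
                (fromℕ c) r) ⟩
            fromℕ κ * r  ∎)
            where
            open Reasoning
            side≤ : side i ≤ fromℕ 6 * r
            side≤ = begin
              side i  ≈⟨ *-identityˡ (side i) ⟨
              1# * side i  ≈⟨ *-congʳ Kr≈1 ⟨
              (fromℕ K * r) * side i ≈⟨ solve 3 (λ k r s → (k :* r) :* s := (k :* s) :* r) ≈-refl (fromℕ K) r
                  (side i) ⟩
              (fromℕ K * side i) * r ≤⟨ *-monoʳ-≤ 0≤r (<⇒≤ thin) ⟩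
              fromℕ 6 * r  ∎
            fi≤ : f i ≤ fromℕ 18 * dᴿ * r
            fi≤ = ≤-trans (*-monoˡ-≤ 0≤2d (+-mono-≤ side≤ ≤-refl))
              (≈⇒≤ (solve 2 (λ d r → (con (+ 2) :* d) :* (con (+ 6) :* r :+ con (+ 3) :* r) := con (+ 18) :* d :* r)
                  ≈-refl dᴿ r))

          3r≤side : ∀ i → fromℕ 3 * r ≤ side i
          3r≤side i = begin
            fromℕ 3 * r  ≤⟨ *-monoʳ-≤ 0≤r (fromℕ-mono-≤ {3} {6} (ℕ.s≤s (ℕ.s≤s (ℕ.s≤s ℕ.z≤n)))) ⟩
            fromℕ 6 * r  ≤⟨ *-monoʳ-≤ 0≤r (wide i) ⟩
            fromℕ K * side i * r  ≈⟨ solve 3 (λ k r s → k :* s :* r := (k :* r) :* s) ≈-refl (fromℕ K) r (side i) ⟩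
            (fromℕ K * r) * side i  ≈⟨ 1*-cancel Kr≈1 ⟩
            side i  ∎
            where open Reasoning

          large : 1# ≤ fromℕ (2 ℕ.^ p) * volume
          large = *-cancelˡ-≤ (<-≤-trans 0<1 (1≤fromℕ 1≤A)) (begin
            fromℕ A * 1#  ≈⟨ *-identityʳ _ ⟩
            fromℕ A  ≤⟨ A≤ ⟩
            fromℕ (2 ℕ.^ p) * ε  ≤⟨ *-monoˡ-≤ (<⇒≤ 0<2^p) ε≤f ⟩
            fromℕ (2 ℕ.^ p) * product f  ≤⟨ *-monoˡ-≤ (<⇒≤ 0<2^p) (product-mono-≤ 0≤f λ i →
                ≤-trans (*-monoˡ-≤ 0≤2d (+-mono-≤ ≤-refl (3r≤side i)))
                  (≈⇒≤ (≈-trans (solve 2 (λ d s → (con (+ 2) :* d) :* (s :+ s) := (con (+ 4) :* d) :* s) ≈-refl dᴿ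
                      (side i)) (*-congʳ (≈-sym (fromℕ-* 4 d)))))) ⟩
            fromℕ (2 ℕ.^ p) * product (λ i → fromℕ (4 ℕ.* d) * side i)
                                                    ≈⟨ *-congˡ (product-scale (fromℕ (4 ℕ.* d)) side) ⟩
            fromℕ (2 ℕ.^ p) * (fromℕ (4 ℕ.* d) ^ d * volume)
                                                    ≈⟨ *-congˡ (*-congʳ (fromℕ-^ (4 ℕ.* d) d)) ⟨
            fromℕ (2 ℕ.^ p) * (fromℕ A * volume)  ≈⟨ solve 3 (λ q a v → q :* (a :* v) := a :* (q :* v)) ≈-refl (fromℕ
                (2 ℕ.^ p)) (fromℕ A) volume ⟩
            fromℕ A * (fromℕ (2 ℕ.^ p) * volume)  ∎)
            where open Reasoning

        meets : ⟦ net-list ⟧ˡ ≬ S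
        meets =
          let z , z∈ , y , y∈ , φy≋z = ∈-⟦⟧ˡ (net-hits isometry intervals inside wide large)
          in z , z∈ , proj₂ S≐ (y , y∈ , φy≋z)

    -- Below this threshold y = 1/ε is at least 2 ^ (a + 2), as `exponent-bound` demands.
    ε₀ : Carrier
    ε₀ = recip (fromℕ (2 ℕ.^ (a ℕ.+ 2))) (<-≤-trans 0<1 (1≤fromℕ (ℕ.m^n>0 2 (a ℕ.+ 2))))

    0<2^a+2 : 0# < fromℕ (2 ℕ.^ (a ℕ.+ 2))
    0<2^a+2 = <-≤-trans 0<1 (1≤fromℕ (ℕ.m^n>0 2 (a ℕ.+ 2)))

    0<ε₀ : 0# < ε₀
    0<ε₀ = recip-pos _ _

    ε₀<1 : ε₀ < 1#
    ε₀<1 = begin-strict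
      ε₀  ≈⟨ *-identityʳ ε₀ ⟨
      ε₀ * 1#  <⟨ *-monoˡ-< 0<ε₀ (<-≤-trans (<-respˡ-≈ fromℕ-1 (fromℕ-mono-< {1} {2} (ℕ.s≤s (ℕ.s≤s ℕ.z≤n))))
                                            (fromℕ-mono-≤ (ℕ.^-monoʳ-≤ 2 {1} {a ℕ.+ 2} (ℕ.≤-trans (ℕ.s≤s ℕ.z≤n)
                                                (ℕ.m≤n+m 2 a))))) ⟩
      ε₀ * fromℕ (2 ℕ.^ (a ℕ.+ 2))  ≈⟨ *-comm _ _ ⟩
      fromℕ (2 ℕ.^ (a ℕ.+ 2)) * ε₀  ≈⟨ *-recip _ _ ⟩
      1#  ∎
      where open Reasoning

    1≤constant : 1 ℕ.≤ constant
    1≤constant = ℕ.*-mono-≤ {1} {net-constant d κ} (1≤net-constant d κ)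
      (ℕ.*-mono-≤ {1} {2 ℕ.^ a} (ℕ.m^n>0 2 a)
        (ℕ.*-mono-≤ {1} {a ℕ.+ 3} {1} {2} (ℕ.≤-trans (ℕ.s≤s ℕ.z≤n) (ℕ.m≤n+m 3 a)) (ℕ.s≤s ℕ.z≤n)))

    0<constant : 0# < fromℕ constant
    0<constant = <-≤-trans 0<1 (1≤fromℕ 1≤constant)

    epsilon-net : ∀ ε (0<ε : 0# < ε) → ∃[ N ] IsNet (𝓑′ d) ε N ×
      (ε ≤ ε₀ → ∀ ℓ → IsLn (recip ε 0<ε) ℓ → Card≤ N (fromℕ constant * recip ε 0<ε * ℓ))
    epsilon-net ε 0<ε = ⟦ N.net-list ⟧ˡ ,
      (⟦⟧ˡ-resp , ⟦⟧ˡ⊆Cube N.net⊆Cube , λ { S (S⊆Cube , box , S≐ , _) ε≤μS → N.meets A≤ S S⊆Cube box S≐ ε≤μS }) ,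
      λ ε≤ε₀ ℓ ln → N.net-list , (λ x x∈ → x∈) , size ε≤ε₀ ℓ ln
      where
      open Reasoning
      y : Carrier
      y = recip ε 0<ε
      0≤y : 0# ≤ y
      0≤y = <⇒≤ (recip-pos ε 0<ε)
      scale : ∃[ p ] fromℕ A * y ≤ fromℕ (2 ℕ.^ p) × fromℕ (2 ℕ.^ p) ≤ fromℕ 4 * (fromℕ A * y) + 1#
      scale = log₂ (fromℕ A * y) (*-nonneg (fromℕ-nonneg A) 0≤y)
      p : ℕ
      p = proj₁ scale
      module N = AtScale p
      A≤ : fromℕ A ≤ fromℕ (2 ℕ.^ p) * ε
      A≤ = begin
        fromℕ A  ≈⟨ *-identityʳ _ ⟨
        fromℕ A * 1#  ≈⟨ *-congˡ (*-recip ε 0<ε) ⟨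
        fromℕ A * (ε * y)  ≈⟨ solve 3 (λ a e y → a :* (e :* y) := (a :* y) :* e) ≈-refl (fromℕ A) ε y ⟩
        (fromℕ A * y) * ε  ≤⟨ *-monoʳ-≤ (<⇒≤ 0<ε) (proj₁ (proj₂ scale)) ⟩
        fromℕ (2 ℕ.^ p) * ε  ∎
      size : ε ≤ ε₀ → ∀ ℓ → IsLn y ℓ → fromℕ (length N.net-list) ≤ fromℕ constant * y * ℓ
      size ε≤ε₀ ℓ ln = begin
        fromℕ (length N.net-list)  ≤⟨ fromℕ-mono-≤ (length-net d κ (ℕ.s≤s ℕ.z≤n) p) ⟩
        fromℕ (net-constant d κ ℕ.* (2 ℕ.^ p ℕ.* suc p))  ≈⟨ ≈-trans (fromℕ-* (net-constant d κ) (2 ℕ.^ p ℕ.* suc p))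
            (*-congˡ (fromℕ-* (2 ℕ.^ p) (suc p))) ⟩
        C * (fromℕ (2 ℕ.^ p) * fromℕ (suc p))  ≤⟨ *-monoˡ-≤ (fromℕ-nonneg (net-constant d κ)) (*-mono-≤ (fromℕ-nonneg
            (2 ℕ.^ p)) (≤-trans (fromℕ-nonneg (suc p)) exponent) upper exponent) ⟩
        C * ((fromℕ (2 ℕ.^ a) * y) * (fromℕ (a ℕ.+ 3) * (fromℕ 2 * ℓ)))
          ≈⟨ solve 6 (λ C t y b two l → C :* ((t :* y) :* (b :* (two :* l))) := (C :* (t :* (b :* two))) :* y :* l)
              ≈-refl C (fromℕ (2 ℕ.^ a)) y (fromℕ (a ℕ.+ 3)) (fromℕ 2) ℓ ⟩
        (C * (fromℕ (2 ℕ.^ a) * (fromℕ (a ℕ.+ 3) * fromℕ 2))) * y * ℓ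
          ≈⟨ *-congʳ (*-congʳ (≈-trans (fromℕ-* (net-constant d κ) _) (*-congˡ (≈-trans (fromℕ-* (2 ℕ.^ a) _) (*-congˡ
              (fromℕ-* (a ℕ.+ 3) 2)))))) ⟨
        fromℕ constant * y * ℓ  ∎
        where
        C : Carrier
        C = fromℕ (net-constant d κ)
        2^≤y : fromℕ (2 ℕ.^ (a ℕ.+ 2)) ≤ y
        2^≤y = begin
          fromℕ (2 ℕ.^ (a ℕ.+ 2))  ≈⟨ *-identityʳ _ ⟨
          fromℕ (2 ℕ.^ (a ℕ.+ 2)) * 1#  ≈⟨ *-congˡ (*-recip ε 0<ε) ⟨
          fromℕ (2 ℕ.^ (a ℕ.+ 2)) * (ε * y)  ≤⟨ *-monoˡ-≤ (<⇒≤ 0<2^a+2) (*-monoʳ-≤ 0≤y ε≤ε₀) ⟩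
          fromℕ (2 ℕ.^ (a ℕ.+ 2)) * (ε₀ * y)  ≈⟨ *-assoc _ _ _ ⟨
          (fromℕ (2 ℕ.^ (a ℕ.+ 2)) * ε₀) * y  ≈⟨ ≈-trans (*-congʳ (*-recip _ _)) (*-identityˡ y) ⟩
          y  ∎
        y≤Ay : y ≤ fromℕ A * y
        y≤Ay = ≤-trans (≈⇒≤ (≈-sym (*-identityˡ y))) (*-monoʳ-≤ 0≤y (1≤fromℕ 1≤A))
        1≤Ay : 1# ≤ fromℕ A * y
        1≤Ay = ≤-trans (1≤fromℕ (ℕ.m^n>0 2 (a ℕ.+ 2))) (≤-trans 2^≤y y≤Ay)
        upper : fromℕ (2 ℕ.^ p) ≤ fromℕ (2 ℕ.^ a) * y
        upper = begin
          fromℕ (2 ℕ.^ p)  ≤⟨ proj₂ (proj₂ scale) ⟩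
          fromℕ 4 * (fromℕ A * y) + 1#  ≤⟨ +-mono-≤ ≤-refl 1≤Ay ⟩
          fromℕ 4 * (fromℕ A * y) + fromℕ A * y  ≈⟨ solve 2 (λ a y → con (+ 4) :* (a :* y) :+ a :* y := (con
              (+ 5) :* a) :* y) ≈-refl (fromℕ A) y ⟩
          (fromℕ 5 * fromℕ A) * y  ≈⟨ *-congʳ (fromℕ-* 5 A) ⟨
          fromℕ a * y  ≤⟨ *-monoʳ-≤ 0≤y (fromℕ-mono-≤ (ℕ.<⇒≤ (n<2^n a))) ⟩
          fromℕ (2 ℕ.^ a) * y  ∎
        exponent : fromℕ (suc p) ≤ fromℕ (a ℕ.+ 3) * (fromℕ 2 * ℓ)
        exponent = exponent-bound a p ln (≤-trans 2^≤y (≤-trans y≤Ay (proj₁ (proj₂ scale)))) upper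

  -- Frames along segments, and dyadic shells

  ∣±1∣≤1 : ∣ 1# ∣≤ 1# × ∣ - 1# ∣≤ 1#
  ∣±1∣≤1 = abs-nonneg 0≤1 ≤-refl , abs-neg (abs-nonneg 0≤1 ≤-refl)

  ∣∙∣-cong : ∀ {d} {x x′ y y′ : Point d} → x ≋ x′ → y ≋ y′ → distSq x y ≈ distSq x′ y′
  ∣∙∣-cong {x = x} {x′} {y} {y′} p q = sum-cong λ k →
    *-cong (eq k) (*-cong (eq k) ≈-refl)
    where
    eq : ∀ k → x k - y k ≈ x′ k - y′ k
    eq k = +-cong (p k) (-‿cong (q k))

  distSq-scale : ∀ {d} c (x y : Point d) → distSq (λ k → c * x k) (λ k → c * y k) ≈ c ^ 2 * distSq x y
  distSq-scale c x y = ≈-trans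
    (sum-cong λ k → solve 3 (λ c x y → (c :* x :- c :* y) :^ 2 := c :^ 2 :* (x :- y) :^ 2) ≈-refl c (x k) (y k))
    (*-sum (c ^ 2) (λ k → (x k - y k) ^ 2))

  -- Reflection in the hyperplane orthogonal to D − s e₀, followed by
  -- multiplication by s = ± 1 and translation by P; it maps e₀ to P + D.  One of the
  -- signs keeps D − s e₀ away from 0.

  module Householder {d₀ : ℕ} (P D : Point (suc d₀)) (D∙D≈1 : D ∙ D ≈ 1#)
                     (s : Carrier) (s*s≈1 : s * s ≈ 1#) (0<w : 0# < 1# - s * D zero) where

    private
      d : ℕ
      d = suc d₀

      w ρ : Carrier
      w = 1# - s * D zero
      ρ = recip w 0<w

      wρ≈1 : w * ρ ≈ 1#
      wρ≈1 = *-recip w 0<w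

      v : Point d
      v k = D k - s * basis zero k

      ∙v : ∀ x → x ∙ v ≈ x ∙ D - s * x zero
      ∙v x = begin-equality
        x ∙ v  ≈⟨ ∙-comm x v ⟩
        v ∙ x  ≈⟨ ∙-⊖ˡ D (λ k → s * basis zero k) x ⟩
        D ∙ x - (λ k → s * basis zero k) ∙ x  ≈⟨ +-cong (∙-comm D x) (-‿cong (∙-comm (λ k → s * basis zero k) x)) ⟩
        x ∙ D - x ∙ (λ k → s * basis zero k)  ≈⟨ +-congˡ (-‿cong (≈-trans (∙-scaleʳ s x (basis zero)) (*-congˡ
            (∙-basis x zero)))) ⟩
        x ∙ D - s * x zero  ∎
        where open Reasoning

      v∙v : v ∙ v ≈ fromℕ 2 * w
      v∙v = begin-equality
        v ∙ v  ≈⟨ ∙v v ⟩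
        v ∙ D - s * v zero  ≈⟨ +-cong (≈-trans (∙-comm v D) (∙v D)) (-‿cong (*-congˡ (+-congˡ (-‿cong (*-congˡ
            (≈-reflexive (basis-self {d} zero))))))) ⟩
        (D ∙ D - s * D zero) - s * (D zero - s * 1#)  ≈⟨ +-congʳ (+-congʳ D∙D≈1) ⟩
        (1# - s * D zero) - s * (D zero - s * 1#)  ≈⟨ solve 2 (λ s t → (con (+ 1) :- s :* t) :- s :* (t :- s :* con
            (+ 1)) := (con (+ 1) :- s :* t) :- s :* t :+ s :* s) ≈-refl s (D zero) ⟩
        (1# - s * D zero) - s * D zero + s * s  ≈⟨ +-congˡ s*s≈1 ⟩
        (1# - s * D zero) - s * D zero + 1#  ≈⟨ solve 1 (λ t → (con (+ 1) :- t) :- t :+ con (+ 1) := con (+ 2) :* (con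
            (+ 1) :- t)) ≈-refl (s * D zero) ⟩
        fromℕ 2 * w  ∎
        where open Reasoning

      -- Twice the coefficient of the orthogonal projection onto `v`, since v ∙ v = 2 w; the
      -- division is by `w`, which is known to be positive.
      c : Point d → Carrier
      c x = (x ∙ v) * ρ

      cw : ∀ x → c x * w ≈ x ∙ v
      cw x = ≈-trans (solve 3 (λ a r w → (a :* r) :* w := a :* (w :* r)) ≈-refl (x ∙ v) ρ w) (≈-trans (*-congˡ wρ≈1)
          (*-identityʳ _))

      ψ : Point d → Point d
      ψ x k = s * (x k - c x * v k)

      ψ∙v : ∀ x → ψ x ∙ v ≈ - (s * (x ∙ v))
      ψ∙v x = begin-equality
        ψ x ∙ v  ≈⟨ sum-cong (λ k → solve 4 (λ s x c v → (s :* (x :- c :* v)) :* v := s :* (x :* v :- c :* (v :* v)))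
            ≈-refl s (x k) (c x) (v k)) ⟩
        sum (λ k → s * (x k * v k - c x * (v k * v k)))  ≈⟨ *-sum s (λ k → x k * v k - c x * (v k * v k)) ⟩
        s * sum (λ k → x k * v k - c x * (v k * v k))  ≈⟨ *-congˡ (≈-trans (sum-- (λ k → x k * v k) (λ k → c x * (v k * v k))) (+-congˡ (-‿cong (*-sum (c x) (λ k → v k * v k))))) ⟩
        s * (x ∙ v - c x * (v ∙ v))  ≈⟨ *-congˡ (+-congˡ (-‿cong (≈-trans (*-congˡ v∙v) (solve 2 (λ c w → c :* (con
            (+ 2) :* w) := con (+ 2) :* (c :* w)) ≈-refl (c x) w)))) ⟩
        s * (x ∙ v - fromℕ 2 * (c x * w))  ≈⟨ *-congˡ (+-congˡ (-‿cong (*-congˡ (cw x)))) ⟩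
        s * (x ∙ v - fromℕ 2 * (x ∙ v))  ≈⟨ solve 2 (λ s a → s :* (a :- con (+ 2) :* a) := :- (s :* a)) ≈-refl s
            (x ∙ v) ⟩
        - (s * (x ∙ v))  ∎
        where open Reasoning

      ψψ : ∀ x → ψ (ψ x) ≋ x
      ψψ x k = begin-equality
        s * (s * (x k - c x * v k) - (ψ x ∙ v) * ρ * v k)  ≈⟨ *-congˡ (+-congˡ (-‿cong (*-congʳ (*-congʳ (ψ∙v x))))) ⟩
        s * (s * (x k - c x * v k) - (- (s * (x ∙ v))) * ρ * v k) ≈⟨ solve 5 (λ s x a r v → s :* (s :* (x :-
            (a :* r) :* v) :- (:- (s :* a)) :* r :* v) := (s :* s) :* x) ≈-refl s (x k) (x ∙ v) ρ (v k) ⟩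
        (s * s) * x k  ≈⟨ 1*-cancel s*s≈1 ⟩
        x k  ∎
        where open Reasoning

    φ : Point d → Point d
    φ x k = P k + ψ x k

    private
      φ-distSq : ∀ x y → distSq (φ x) (φ y) ≈ distSq x y
      φ-distSq x y = begin-equality
        distSq (φ x) (φ y)
          ≈⟨ sum-cong term ⟩
        sum (λ k → (x k - y k) ^ 2 + (b * b * (v k * v k) - fromℕ 2 * b * (a k * v k)))
          ≈⟨ sum-+ (λ k → (x k - y k) ^ 2) (λ k → b * b * (v k * v k) - fromℕ 2 * b * (a k * v k)) ⟩
        distSq x y + sum (λ k → b * b * (v k * v k) - fromℕ 2 * b * (a k * v k))
          ≈⟨ +-congˡ (≈-trans (sum-- (λ k → b * b * (v k * v k)) (λ k → fromℕ 2 * b * (a k * v k)))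
               (+-cong (*-sum (b * b) (λ k → v k * v k)) (-‿cong (*-sum (fromℕ 2 * b) (λ k → a k * v k))))) ⟩
        distSq x y + (b * b * (v ∙ v) - fromℕ 2 * b * (a ∙ v))
          ≈⟨ +-congˡ (+-cong (*-congˡ v∙v) (-‿cong (*-congˡ (≈-sym (cw a))))) ⟩
        distSq x y + (b * b * (fromℕ 2 * w) - fromℕ 2 * b * (b * w))
          ≈⟨ solve 3 (λ D b w → D :+ (b :* b :* (con (+ 2) :* w) :- con (+ 2) :* b :* (b :* w)) := D) ≈-refl
              (distSq x y) b w ⟩
        distSq x y  ∎
        where
        open Reasoning
        a : Point d
        a = x ⊖ y
        b : Carrier
        b = c a
        term : ∀ k → (φ x k - φ y k) ^ 2 ≈ (x k - y k) ^ 2 + (b * b * (v k * v k) - fromℕ 2 * b * (a k * v k))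
        term k = begin-equality
          ((P k + s * (x k - c x * v k)) - (P k + s * (y k - c y * v k))) ^ 2
            ≈⟨ solve 8 (λ P s x y v m n r → ((P :+ s :* (x :- (m :* r) :* v)) :- (P :+ s :* (y :-
                (n :* r) :* v))) :^ 2 :=
                 (s :* s) :* ((x :- y) :- ((m :- n) :* r) :* v) :^ 2) ≈-refl (P k) s (x k) (y k) (v k) (x ∙ v)
                     (y ∙ v) ρ ⟩
          (s * s) * ((x k - y k) - (x ∙ v - y ∙ v) * ρ * v k) ^ 2
            ≈⟨ 1*-cancel s*s≈1 ⟩
          ((x k - y k) - (x ∙ v - y ∙ v) * ρ * v k) ^ 2
            ≈⟨ ^-congˡ 2 (+-congˡ (-‿cong (*-congʳ (*-congʳ (≈-sym (∙-⊖ˡ x y v)))))) ⟩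
          ((x k - y k) - b * v k) ^ 2
            ≈⟨ solve 3 (λ a b v → (a :- b :* v) :^ 2 := a :^ 2 :+ (b :* b :* (v :* v) :- con (+ 2) :* b :* (a :* v)))
                ≈-refl (x k - y k) b (v k) ⟩
          (x k - y k) ^ 2 + (b * b * (v k * v k) - fromℕ 2 * b * (a k * v k))  ∎

    isometry : IsIsometry φ
    isometry = φ-distSq , λ z → ψ (z ⊖ P) , λ k →
      ≈-trans (+-congˡ (ψψ (z ⊖ P) k)) (solve 2 (λ p z → p :+ (z :- p) := z) ≈-refl (P k) (z k))

    axis : ∀ t → φ (λ k → t * basis zero k) ≋ (λ k → P k + t * D k)
    axis t k = +-congˡ (begin-equality
      s * (t * e - ((λ k → t * basis zero k) ∙ v) * ρ * (D k - s * e))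
        ≈⟨ *-congˡ (+-congˡ (-‿cong (*-congʳ (*-congʳ te∙v)))) ⟩
      s * (t * e - (- (t * (s * w))) * ρ * (D k - s * e))
        ≈⟨ solve 6 (λ s t e w r D → s :* (t :* e :- (:- (t :* (s :* w))) :* r :* (D :- s :* e)) :=
                                    s :* t :* e :+ (s :* s) :* (w :* r) :* t :* (D :- s :* e)) ≈-refl s t e w ρ
                                        (D k) ⟩
      s * t * e + (s * s) * (w * ρ) * t * (D k - s * e)
        ≈⟨ +-congˡ (*-congʳ (*-congʳ (*-cong s*s≈1 wρ≈1))) ⟩
      s * t * e + 1# * 1# * t * (D k - s * e)
        ≈⟨ solve 4 (λ s t e D → s :* t :* e :+ con (+ 1) :* con (+ 1) :* t :* (D :- s :* e) := t :* D) ≈-refl s t e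
            (D k) ⟩
      t * D k  ∎)
      where
      open Reasoning
      e : Carrier
      e = basis {d} zero k
      te∙v : (λ k → t * basis zero k) ∙ v ≈ - (t * (s * w))
      te∙v = begin-equality
        (λ k → t * basis zero k) ∙ v  ≈⟨ ∙-comm (λ k → t * basis zero k) v ⟩
        v ∙ (λ k → t * basis zero k)  ≈⟨ ≈-trans (∙-scaleʳ t v (basis zero)) (*-congˡ (∙-basis v zero)) ⟩
        t * (D zero - s * basis {d} zero zero)
                                           ≈⟨ *-congˡ (+-congˡ (-‿cong (*-congˡ (≈-reflexive
                                               (basis-self {d} zero))))) ⟩
        t * (D zero - s * 1#)  ≈⟨ *-congˡ (+-congʳ (≈-trans (≈-sym (*-identityˡ _)) (*-congʳ (≈-sym s*s≈1)))) ⟩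
        t * ((s * s) * D zero - s * 1#)  ≈⟨ solve 3 (λ t s z → t :* ((s :* s) :* z :- s :* con (+ 1)) := :- (t :*
            (s :* (con (+ 1) :- s :* z)))) ≈-refl t s (D zero) ⟩
        - (t * (s * w))  ∎

  -- A reflection is an explicit frame with first vector D, obtained without searching for a nonzero
  -- coordinate. The sign of `D zero` cannot be decided, but cotransitivity of -1 < 1 shows `D zero`
  -- to be away from one of the two ends, and the sign s is chosen accordingly.
  isometry-along : ∀ {d₀} (P D : Point (suc d₀)) → D ∙ D ≈ 1# →
                   ∃[ φ ] IsIsometry φ × (∀ t → φ (λ k → t * basis zero k) ≋ (λ k → P k + t * D k))
  isometry-along P D D∙D≈1 = [ minus , plus ]′ (<-cotrans { - 1# } {1#} -1<1 (D zero))
    where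
    -1<1 : - 1# < 1#
    -1<1 = lin< 0<2 (solve 0 (con (+ 1) :- :- con (+ 1) := con (+ 2) :- con (+ 0)) ≈-refl)
    Goal : Set
    Goal = ∃[ φ ] IsIsometry φ × (∀ t → φ (λ k → t * basis zero k) ≋ (λ k → P k + t * D k))
    plus : D zero < 1# → Goal
    plus lt = H.φ , H.isometry , H.axis
      where
      module H = Householder P D D∙D≈1 1# (*-identityˡ 1#)
        (lin< lt (solve 1 (λ t → (con (+ 1) :- con (+ 1) :* t) :- con (+ 0) := con (+ 1) :- t) ≈-refl (D zero)))
    minus : - 1# < D zero → Goal
    minus lt = H.φ , H.isometry , H.axis
      where
      module H = Householder P D D∙D≈1 (- 1#) (solve 0 (:- con (+ 1) :* :- con (+ 1) := con (+ 1)) ≈-refl)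
        (lin< lt (solve 1 (λ t → (con (+ 1) :- (:- con (+ 1)) :* t) :- con (+ 0) := t :- :- con (+ 1)) ≈-refl
            (D zero)))

  Bounded : ∀ {d} → Carrier → Point d → Set
  Bounded X x = ∀ i → ∣ x i ∣≤ X

  -- c ∣ x i ∣ ≥ X for some i, with σ in the role of the sign of x i.
  Large : ∀ {d} → Carrier → Carrier → Point d → Set
  Large c X x = ∃[ i ] ∃[ σ ] ∣ σ ∣≤ 1# × X ≤ c * (σ * x i)

  all-or-some : ∀ {n} {A B : Fin n → Set} → (∀ i → A i ⊎ B i) → (∀ i → A i) ⊎ ∃ B
  all-or-some {zero}  f = inj₁ λ ()
  all-or-some {suc n} f with f zero | all-or-some (f ∘ suc)
  ... | inj₂ b | _            = inj₂ (zero , b)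
  ... | inj₁ a | inj₂ (i , b) = inj₂ (suc i , b)
  ... | inj₁ a | inj₁ as      = inj₁ λ { zero → a ; (suc i) → as i }

  bounded : ∀ {d} (x : Point d) → ∃[ n ] Bounded (fromℕ n) x
  bounded {zero}  x = 0 , λ ()
  bounded {suc d} x =
    let m , p = archimedean (x zero)
        n , q = archimedean (- x zero)
        o , r = bounded (x ∘ suc)
    in m ℕ.+ (n ℕ.+ o) , λ where
         zero    → ≤-trans (<⇒≤ p) (fromℕ-mono-≤ (ℕ.m≤m+n m (n ℕ.+ o))) ,
                   ≤-trans (<⇒≤ q) (fromℕ-mono-≤ (ℕ.≤-trans (ℕ.m≤m+n n o) (ℕ.m≤n+m (n ℕ.+ o) m)))
         (suc i) → abs-weaken (fromℕ-mono-≤ (ℕ.≤-trans (ℕ.m≤n+m o n) (ℕ.m≤n+m (n ℕ.+ o) m))) (r i)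

  2^ᴿ : ℕ → Carrier
  2^ᴿ k = fromℕ (2 ℕ.^ k)

  -- A coordinate of size between 2 ^ (k - 1) and 2 ^ k fits both alternatives. This overlap is what
  -- lets cotransitivity decide, and it makes the factor 4 and not 2.
  bounded-or-large : ∀ {d} k (x : Point d) → Bounded (2^ᴿ k) x ⊎ Large (fromℕ 4) (2^ᴿ (suc k)) x
  bounded-or-large k x = all-or-some each
    where
    lt : 2^ᴿ k < 2^ᴿ (suc k)
    lt = fromℕ-mono-< (ℕ.^-monoʳ-< 2 (ℕ.s≤s (ℕ.s≤s ℕ.z≤n)) (ℕ.n<1+n k))
    halve : ∀ {y} → fromℕ 2 * y < 2^ᴿ (suc k) → y ≤ 2^ᴿ k
    halve p = *-cancelˡ-≤ 0<2 (≤-trans (<⇒≤ p) (≈⇒≤ (2^[1+n] k)))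
    double : ∀ {y z} → y ≈ z → 2^ᴿ k < fromℕ 2 * y → 2^ᴿ (suc k) ≤ fromℕ 4 * z
    double {y} {z} y≈z p = begin
      2^ᴿ (suc k)  ≈⟨ 2^[1+n] k ⟩
      fromℕ 2 * 2^ᴿ k  ≤⟨ *-monoˡ-≤ (fromℕ-nonneg 2) (<⇒≤ p) ⟩
      fromℕ 2 * (fromℕ 2 * y)  ≈⟨ solve 1 (λ y → con (+ 2) :* (con (+ 2) :* y) := con (+ 4) :* y) ≈-refl y ⟩
      fromℕ 4 * y  ≈⟨ *-congˡ y≈z ⟩
      fromℕ 4 * z  ∎
      where open Reasoning
    each : ∀ i → ∣ x i ∣≤ 2^ᴿ k ⊎ ∃[ σ ] ∣ σ ∣≤ 1# × 2^ᴿ (suc k) ≤ fromℕ 4 * (σ * x i)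
    each i = [ (λ p → inj₂ (1# , proj₁ ∣±1∣≤1 , double (≈-sym (*-identityˡ (x i))) p)) , (λ p →
        [ (λ q → inj₂ (- 1# , proj₂ ∣±1∣≤1 , double (solve 1 (λ x → :- x := (:- con (+ 1)) :* x) ≈-refl (x i)) q)) ,
          (λ q → inj₁ (halve p , halve q)) ]′ (<-cotrans lt (fromℕ 2 * - x i))) ]′ (<-cotrans lt (fromℕ 2 * x i))

  -- The descent starts from a cube that holds both endpoints and halves it until one endpoint is
  -- found to be large. The size of that endpoint is then comparable with the cube, and the segment
  -- will be met near it.
  dyadic-size : ∀ {d} (p q : Point d) → (Bounded (2^ᴿ 0) p × Bounded (2^ᴿ 0) q) ⊎
    ∃[ k ] Bounded (2^ᴿ k) p × Bounded (2^ᴿ k) q × (Large (fromℕ 4) (2^ᴿ k) p ⊎ Large (fromℕ 4) (2^ᴿ k) q)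
  dyadic-size p q =
    let m , bp = bounded p
        n , bq = bounded q
        le = ℕ.<⇒≤ (n<2^n (m ℕ.+ n))
    in search (m ℕ.+ n)
         (λ i → abs-weaken (fromℕ-mono-≤ (ℕ.≤-trans (ℕ.m≤m+n m n) le)) (bp i))
         (λ i → abs-weaken (fromℕ-mono-≤ (ℕ.≤-trans (ℕ.m≤n+m n m) le)) (bq i))
    where
    Goal : Set
    Goal = (Bounded (2^ᴿ 0) p × Bounded (2^ᴿ 0) q) ⊎
      ∃[ k ] Bounded (2^ᴿ k) p × Bounded (2^ᴿ k) q × (Large (fromℕ 4) (2^ᴿ k) p ⊎ Large (fromℕ 4) (2^ᴿ k) q)
    search : ∀ k → Bounded (2^ᴿ k) p → Bounded (2^ᴿ k) q → Goal
    search zero    bp bq = inj₁ (bp , bq)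
    search (suc k) bp bq =
      [ (λ bp′ → [ (λ bq′ → search k bp′ bq′) , (λ lq → inj₂ (suc k , bp , bq , inj₂ lq)) ]′ (bounded-or-large k q))
      , (λ lp → inj₂ (suc k , bp , bq , inj₁ lp)) ]′ (bounded-or-large k p)

  -- Visibility in the forest

  module OpticalForest (d₁ : ℕ) where

    -- In the volume of the box used below, the 16 in `Cℕ` cancels h and each factor 8 d cancels a
    -- factor 2 h′. With κ = 6 d, the sides are at least 6 r.
    d₀ d κ Cℕ : ℕ
    d₀ = suc d₁
    d  = suc d₀
    κ  = 6 ℕ.* d
    Cℕ = 16 ℕ.* (8 ℕ.* d) ℕ.^ d₀

    0<κ : 1 ℕ.≤ κ
    0<κ = ℕ.s≤s ℕ.z≤n

    C : Carrier
    C = fromℕ Cℕ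

    -- After division by 4 · 2 ^ k, coordinates up to 2 ^ k become at most 1/4, which leaves room
    -- inside the unit cube for the thickness of the box.
    scale : ℕ → Carrier
    scale k = 2^ᴿ (2 ℕ.+ k)

    exponent : ℕ → ℕ
    exponent k = (2 ℕ.+ k) ℕ.* d

    level : ℕ → List (Point d)
    level k = NetSize.net-list d κ 0<κ (exponent k)

    -- Points of infinitely many dilated nets might crowd around the origin. `Large` gives the
    -- points of level k a coordinate of size at least 2 ^ k / 16, so that a ball meets finitely
    -- many levels; 1/64 is what `large-coordinate` guarantees.
    forest : PointSet d
    forest x = ∃[ k ] Any (λ z → Large (fromℕ 64) 1# z × x ≋ (λ i → scale k * z i)) (level k)

    dᴿ h h′ : Carrier
    dᴿ = fromℕ d
    h  = recip (fromℕ 16) (0<fromℕ-suc 15)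
    -- `16 ℕ.* d` unfolds to `suc (d₀ ℕ.+ 15 ℕ.* d)`.
    h′ = recip (fromℕ (16 ℕ.* d)) (0<fromℕ-suc (d₀ ℕ.+ 15 ℕ.* d))

    0≤h : 0# ≤ h
    0≤h = <⇒≤ (recip-pos (fromℕ 16) (0<fromℕ-suc 15))

    0≤h′ : 0# ≤ h′
    0≤h′ = <⇒≤ (recip-pos (fromℕ (16 ℕ.* d)) (0<fromℕ-suc (d₀ ℕ.+ 15 ℕ.* d)))

    0≤d : 0# ≤ dᴿ
    0≤d = fromℕ-nonneg d

    0<d : 0# < dᴿ
    0<d = 0<fromℕ-suc d₀

    16h≈1 : fromℕ 16 * h ≈ 1#
    16h≈1 = *-recip (fromℕ 16) (0<fromℕ-suc 15)

    16dh′≈1 : (fromℕ 16 * dᴿ) * h′ ≈ 1#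
    16dh′≈1 = ≈-trans (*-congʳ (≈-sym (fromℕ-* 16 d))) (*-recip (fromℕ (16 ℕ.* d)) (0<fromℕ-suc (d₀ ℕ.+ 15 ℕ.* d)))

    dh′≈h : dᴿ * h′ ≈ h
    dh′≈h = *-cancelˡ-≈ (0<fromℕ-suc 15) (≈-trans (≈-sym (*-assoc (fromℕ 16) dᴿ h′)) (≈-trans 16dh′≈1 (≈-sym 16h≈1)))

    h≤1 : h ≤ 1#
    h≤1 = ≤-trans (≈⇒≤ (≈-sym (*-identityˡ h))) (≤-trans (*-monoʳ-≤ 0≤h (1≤fromℕ {16} (ℕ.s≤s ℕ.z≤n))) (≈⇒≤ 16h≈1))

    C≈ : C ≈ fromℕ 16 * (fromℕ 8 * dᴿ) ^ d₀
    C≈ = ≈-trans (fromℕ-* 16 ((8 ℕ.* d) ℕ.^ d₀)) (*-congˡ (≈-trans (fromℕ-^ (8 ℕ.* d) d₀) (^-congˡ d₀ (fromℕ-* 8 d))))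

    128d≤C : 128 ℕ.* d ℕ.≤ Cℕ
    128d≤C = ℕ.≤-trans (ℕ.≤-reflexive (ℕ.*-assoc 16 8 d)) (ℕ.*-monoʳ-≤ 16
      (ℕ.≤-trans (ℕ.≤-reflexive (≡.sym (ℕ.*-identityʳ (8 ℕ.* d)))) (ℕ.*-monoʳ-≤ (8 ℕ.* d) (ℕ.m^n>0 (8 ℕ.* d) d₁))))

    16≤C : 16 ℕ.≤ Cℕ
    16≤C = ℕ.≤-trans (ℕ.*-monoʳ-≤ 16 (ℕ.m^n>0 (8 ℕ.* d) d₀)) ℕ.≤-refl

    module Tube {ε : Carrier} (0<ε : 0# < ε) (ε<1 : ε < 1#) {p q : Point d}
                (dist : IsDist p q (C * recip ε 0<ε ^ d₀)) where

      y ℓ ρ : Carrier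
      y = recip ε 0<ε
      ℓ = C * y ^ d₀

      0≤ε : 0# ≤ ε
      0≤ε = <⇒≤ 0<ε

      εy≈1 : ε * y ≈ 1#
      εy≈1 = *-recip ε 0<ε

      0<y : 0# < y
      0<y = recip-pos ε 0<ε

      0≤y : 0# ≤ y
      0≤y = <⇒≤ 0<y

      0≤C : 0# ≤ C
      0≤C = fromℕ-nonneg Cℕ

      1≤y : 1# ≤ y
      1≤y = begin
        1#  ≈⟨ εy≈1 ⟨
        ε * y  ≤⟨ *-monoʳ-≤ 0≤y (<⇒≤ ε<1) ⟩
        1# * y  ≈⟨ *-identityˡ y ⟩
        y  ∎
        where open Reasoning

      1≤^ : ∀ {x} n → 1# ≤ x → 1# ≤ x ^ n
      1≤^ n 1≤x = ≤-trans (≈⇒≤ (≈-sym (1^n n))) (^-mono-≤ n 0≤1 1≤x)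

      x≤x^d₀ : ∀ {x} → 1# ≤ x → x ≤ x ^ d₀
      x≤x^d₀ {x} 1≤x = ≤-trans (≈⇒≤ (≈-sym (*-identityʳ x))) (*-monoˡ-≤ (≤-trans 0≤1 1≤x) (1≤^ d₁ 1≤x))

      Cy≤ℓ : C * y ≤ ℓ
      Cy≤ℓ = *-monoˡ-≤ 0≤C (x≤x^d₀ 1≤y)

      C≤ℓ : C ≤ ℓ
      C≤ℓ = ≤-trans (≈⇒≤ (≈-sym (*-identityʳ C))) (*-monoˡ-≤ 0≤C (1≤^ d₀ 1≤y))

      0<ℓ : 0# < ℓ
      0<ℓ = <-≤-trans 0<1 (≤-trans (1≤fromℕ (ℕ.≤-trans (ℕ.s≤s ℕ.z≤n) 16≤C)) C≤ℓ)

      ρ = recip ℓ 0<ℓ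

      ℓρ≈1 : ℓ * ρ ≈ 1#
      ℓρ≈1 = *-recip ℓ 0<ℓ

      0≤ℓ : 0# ≤ ℓ
      0≤ℓ = <⇒≤ 0<ℓ

      0≤ρ : 0# ≤ ρ
      0≤ρ = <⇒≤ (recip-pos ℓ 0<ℓ)

      bounded⇒ℓ≤ : ∀ {X} → 0# ≤ X → Bounded X p → Bounded X q → ℓ ≤ dᴿ * (X + X)
      bounded⇒ℓ≤ 0≤X bp bq = square-cancel-≤
        (*-nonneg 0≤d (≤-trans (≈⇒≤ (≈-sym (+-identityˡ 0#))) (+-mono-≤ 0≤X 0≤X)))
        (≤-trans (≈⇒≤ (≈-sym (proj₂ dist))) (dist≤coordinates′ λ k → abs-+ (bp k) (abs-neg (bq k))))

      -- The length is at least C ≥ 128 d, beyond the bound 2 d for two points of the cube of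
      -- half-width 1. So the descent of `dyadic-size` always stops at a large endpoint.
      not-unit-size : Bounded (2^ᴿ 0) p → Bounded (2^ᴿ 0) q → ⊥
      not-unit-size bp bq = ≤-trans C≤ℓ (bounded⇒ℓ≤ (fromℕ-nonneg 1) bp bq) 2d<C
        where
        open Reasoning
        2d<C : dᴿ * (2^ᴿ 0 + 2^ᴿ 0) < C
        2d<C = begin-strict
          dᴿ * (fromℕ 1 + fromℕ 1)  ≈⟨ solve 1 (λ d → d :* ((con (+ 1) :+ con (+ 0)) :+ (con (+ 1) :+ con
              (+ 0))) := con (+ 2) :* d) ≈-refl dᴿ ⟩
          fromℕ 2 * dᴿ  ≈⟨ fromℕ-* 2 d ⟨
          fromℕ (2 ℕ.* d)  <⟨ fromℕ-mono-< (ℕ.*-monoˡ-< d {2} {128} (ℕ.s≤s (ℕ.s≤s (ℕ.s≤s ℕ.z≤n)))) ⟩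
          fromℕ (128 ℕ.* d)  ≤⟨ fromℕ-mono-≤ 128d≤C ⟩
          C  ∎

      module AtScale (k : ℕ) (bp : Bounded (2^ᴿ k) p) (bq : Bounded (2^ᴿ k) q) where

        open Grid d κ 0<κ (exponent k) using (K)

        X Λ : Carrier
        X = 2^ᴿ k
        Λ = scale k

        0≤X : 0# ≤ X
        0≤X = fromℕ-nonneg (2 ℕ.^ k)

        1≤X : 1# ≤ X
        1≤X = 1≤fromℕ (ℕ.m^n>0 2 k)

        1≤Λ : 1# ≤ Λ
        1≤Λ = 1≤fromℕ (ℕ.m^n>0 2 (2 ℕ.+ k))

        0<Λ : 0# < Λ
        0<Λ = <-≤-trans 0<1 1≤Λ

        0≤Λ : 0# ≤ Λ
        0≤Λ = <⇒≤ 0<Λ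

        Λ≈4X : Λ ≈ fromℕ 4 * X
        Λ≈4X = ≈-trans (2^[1+n] (suc k)) (≈-trans (*-congˡ (2^[1+n] k))
          (solve 1 (λ x → con (+ 2) :* (con (+ 2) :* x) := con (+ 4) :* x) ≈-refl X))

        L : Carrier
        L = recip Λ 0<Λ

        0≤L : 0# ≤ L
        0≤L = <⇒≤ (recip-pos Λ 0<Λ)

        ΛL≈1 : Λ * L ≈ 1#
        ΛL≈1 = *-recip Λ 0<Λ

        4LX≈1 : fromℕ 4 * (L * X) ≈ 1#
        4LX≈1 = ≈-trans (solve 3 (λ f l x → f :* (l :* x) := (f :* x) :* l) ≈-refl (fromℕ 4) L X)
          (≈-trans (*-congʳ (≈-sym Λ≈4X)) ΛL≈1)

        L≤LX : L ≤ L * X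
        L≤LX = ≤-trans (≈⇒≤ (≈-sym (*-identityʳ L))) (*-monoˡ-≤ 0≤L 1≤X)

        -- Lengths shrunk by L = 1/Λ. The long side covers only a sixteenth of the segment, so that
        -- its points stay as far from the origin as p, up to a constant; η is the half-width of the
        -- other sides, and e = d η bounds the distance from the axis.
        side₀ η e : Carrier
        side₀ = ℓ * L * h
        η = ε * L * h′
        e = ε * L * h

        0≤side₀ : 0# ≤ side₀
        0≤side₀ = *-nonneg (*-nonneg 0≤ℓ 0≤L) 0≤h

        0≤η : 0# ≤ η
        0≤η = *-nonneg (*-nonneg 0≤ε 0≤L) 0≤h′

        dη≈e : dᴿ * η ≈ e
        dη≈e = ≈-trans (solve 3 (λ d a h → d :* (a :* h) := a :* (d :* h)) ≈-refl dᴿ (ε * L) h′) (*-congˡ dh′≈h)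

        εL≤LX : ε * L ≤ L * X
        εL≤LX = ≤-trans (≤-trans (*-monoʳ-≤ 0≤L (<⇒≤ ε<1)) (≈⇒≤ (*-identityˡ L))) L≤LX

        e≤LX : e ≤ L * X
        e≤LX = ≤-trans (≤-trans (*-monoˡ-≤ (*-nonneg 0≤ε 0≤L) h≤1) (≈⇒≤ (*-identityʳ (ε * L)))) εL≤LX

        I : Intervals d
        I = record
          { lo    = λ { zero → 0# ; (suc _) → - η }
          ; hi    = λ { zero → side₀ ; (suc _) → η }
          ; lo≤hi = λ
            { zero    → 0≤side₀
            ; (suc _) → lin (+-mono-≤ 0≤η 0≤η) (solve 1 (λ n → n :- :- n := (n :+ n) :- (con (+ 0) :+ con (+ 0)))
                ≈-refl η)
            }
          }

        open Intervals I

        P D : Point d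
        P i = p i * L
        D i = (q i - p i) * ρ

        D∙D≈1 : D ∙ D ≈ 1#
        D∙D≈1 = begin-equality
          D ∙ D  ≈⟨ sum-cong (λ i → solve 3 (λ p q r → ((q :- p) :* r) :* ((q :- p) :* r) := r :^ 2 :* (p :- q) :^ 2)
              ≈-refl (p i) (q i) ρ) ⟩
          sum (λ i → ρ ^ 2 * (p i - q i) ^ 2)  ≈⟨ *-sum (ρ ^ 2) (λ i → (p i - q i) ^ 2) ⟩
          ρ ^ 2 * distSq p q  ≈⟨ *-congˡ (proj₂ dist) ⟩
          ρ ^ 2 * ℓ ^ 2  ≈⟨ solve 2 (λ r l → r :^ 2 :* l :^ 2 := (l :* r) :^ 2) ≈-refl ρ ℓ ⟩
          (ℓ * ρ) ^ 2  ≈⟨ ^-congˡ 2 ℓρ≈1 ⟩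
          1# ^ 2  ≈⟨ 1^n 2 ⟩
          1#  ∎
          where open Reasoning

        along : ∃[ φ ] IsIsometry φ × (∀ t → φ (λ i → t * basis zero i) ≋ (λ i → P i + t * D i))
        along = isometry-along P D D∙D≈1

        φ : Point d → Point d
        φ = proj₁ along

        isometry : IsIsometry φ
        isometry = proj₁ (proj₂ along)

        module Point-in-box (z : Point d) (z∈ : region z) where

          foot : Point d
          foot i = z zero * basis zero i

          near-foot : ∀ i → ∣ z i - foot i ∣≤ η
          near-foot zero    = abs-cong (solve 1 (λ z → con (+ 0) := z :- z :* con (+ 1)) ≈-refl (z zero))
              (abs-nonneg ≤-refl 0≤η)
          near-foot (suc j) = abs-cong (solve 2 (λ z z₀ → z := z :- z₀ :* con (+ 0)) ≈-refl (z (suc j)) (z zero))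
            (proj₂ (z∈ (suc j)) , lin (proj₁ (z∈ (suc j))) (solve 2 (λ z n → n :- :- z := z :- :- n) ≈-refl (z
                (suc j)) η))

          t : Carrier
          t = z zero * Λ * ρ

          0≤t : 0# ≤ t
          0≤t = *-nonneg (*-nonneg (proj₁ (z∈ zero)) 0≤Λ) 0≤ρ

          t≤h : t ≤ h
          t≤h = begin
            z zero * Λ * ρ  ≤⟨ *-monoʳ-≤ 0≤ρ (*-monoʳ-≤ 0≤Λ (proj₂ (z∈ zero))) ⟩
            ℓ * L * h * Λ * ρ  ≈⟨ solve 5 (λ l L h m r → l :* L :* h :* m :* r := (l :* r) :* (m :* L) :* h)
                ≈-refl ℓ L h Λ ρ ⟩
            (ℓ * ρ) * (Λ * L) * h  ≈⟨ *-congʳ (*-cong ℓρ≈1 ΛL≈1) ⟩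
            1# * 1# * h  ≈⟨ solve 1 (λ h → con (+ 1) :* con (+ 1) :* h := h) ≈-refl h ⟩
            h  ∎
            where open Reasoning

          on-segment a : Point d
          on-segment i = p i + t * (q i - p i)
          a i = P i + z zero * D i

          on-segment∈ : Segment p q on-segment
          on-segment∈ = t , 0≤t , ≤-trans t≤h h≤1 , λ i → ≈-refl

          Λa≈ : ∀ i → Λ * a i ≈ on-segment i
          Λa≈ i = begin-equality
            Λ * (p i * L + z zero * ((q i - p i) * ρ))
              ≈⟨ solve 6 (λ m p L z w r → m :* (p :* L :+ z :* (w :* r)) := (m :* L) :* p :+ z :* m :* r :* w)
                  ≈-refl Λ (p i) L (z zero) (q i - p i) ρ ⟩
            (Λ * L) * p i + t * (q i - p i)  ≈⟨ +-congʳ (1*-cancel ΛL≈1) ⟩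
            on-segment i  ∎
            where open Reasoning

          a≈ : ∀ i → a i ≈ L * on-segment i
          a≈ i = ≈-sym (begin-equality
            L * on-segment i  ≈⟨ *-congˡ (Λa≈ i) ⟨
            L * (Λ * a i)  ≈⟨ solve 3 (λ l m a → l :* (m :* a) := (m :* l) :* a) ≈-refl L Λ (a i) ⟩
            (Λ * L) * a i  ≈⟨ 1*-cancel ΛL≈1 ⟩
            a i  ∎)
            where open Reasoning

          φfoot≋a : φ foot ≋ a
          φfoot≋a = proj₂ (proj₂ along) (z zero)

          φ-near-a : ∀ i → ∣ φ z i - a i ∣≤ e
          φ-near-a i = abs-weaken (≈⇒≤ dη≈e) (abs-cong (+-congˡ (-‿cong (φfoot≋a i)))
            (Isometry.close isometry {x = z} {y = foot} near-foot i))

          on-segment-bounded : Bounded X on-segment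
          on-segment-bounded i = abs-weaken (≈⇒≤ (solve 2 (λ t x → (con (+ 1) :- t) :* x :+ t :* x := x) ≈-refl t X))
            (abs-cong (solve 3 (λ p q t → (con (+ 1) :- t) :* p :+ t :* q := p :+ t :* (q :- p)) ≈-refl (p i) (q i) t)
              (abs-+ (abs-* (abs-nonneg (≤⇒0≤- (≤-trans t≤h h≤1)) ≤-refl) (bp i)) (abs-* (abs-nonneg 0≤t ≤-refl)
                  (bq i))))

          -- The segment shrinks to coordinates of size L X = 1/4, and the thickness e ≤ L X takes
          -- up at most as much again.
          φz∈Cube : Cube d (φ z)
          φz∈Cube i =
            lin (proj₂ ∣φz∣≤) (solve 2 (λ x h → x :- :- h := h :- :- x) ≈-refl (φ z i) ½ᴿ) , proj₁ ∣φz∣≤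
            where
            open Reasoning
            ½≥ : L * X + e ≤ ½ᴿ
            ½≥ = *-cancelˡ-≤ 0<2 (begin
              fromℕ 2 * (L * X + e)  ≤⟨ *-monoˡ-≤ (fromℕ-nonneg 2) (+-mono-≤ ≤-refl e≤LX) ⟩
              fromℕ 2 * (L * X + L * X)  ≈⟨ solve 1 (λ x → con (+ 2) :* (x :+ x) := con (+ 4) :* x) ≈-refl (L * X) ⟩
              fromℕ 4 * (L * X)  ≈⟨ 4LX≈1 ⟩
              1#  ≈⟨ 2*½ ⟨
              fromℕ 2 * ½ᴿ  ∎)
            ∣φz∣≤ : ∣ φ z i ∣≤ ½ᴿ
            ∣φz∣≤ = abs-weaken ½≥ (abs-cong (≈-trans (+-congʳ (≈-sym (a≈ i))) (solve 2 (λ a f → a :+ (f :- a) := f)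
                ≈-refl (a i) (φ z i)))
              (abs-+ (abs-* (abs-nonneg 0≤L ≤-refl) (on-segment-bounded i)) (φ-near-a i)))

          dist-φz-a : distSq (φ z) a ≤ e ^ 2
          dist-φz-a = begin
            distSq (φ z) a  ≈⟨ ∣∙∣-cong {x = φ z} (λ i → ≈-refl) φfoot≋a ⟨
            distSq (φ z) (φ foot)  ≈⟨ proj₁ isometry z foot ⟩
            distSq z foot  ≤⟨ dist≤coordinates′ near-foot ⟩
            (dᴿ * η) ^ 2  ≈⟨ ^-congˡ 2 dη≈e ⟩
            e ^ 2  ∎
            where open Reasoning

          close-to-segment : ∀ x → x ≋ (λ i → Λ * φ z i) → DistToSet≤ x (Segment p q) ε
          close-to-segment x x≋ δ 0<δ = on-segment , on-segment∈ , 0≤ε+δ , (begin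
            distSq x on-segment  ≈⟨ ∣∙∣-cong x≋ (λ i → ≈-sym (Λa≈ i)) ⟩
            distSq (λ i → Λ * φ z i) (λ i → Λ * a i)  ≈⟨ distSq-scale Λ (φ z) a ⟩
            Λ ^ 2 * distSq (φ z) a  ≤⟨ *-monoˡ-≤ (0≤^2 Λ) dist-φz-a ⟩
            Λ ^ 2 * e ^ 2  ≈⟨ solve 4 (λ m ε L h → m :^ 2 :* (ε :* L :* h) :^ 2 := ((m :* L) :* (ε :* h)) :^ 2)
                ≈-refl Λ ε L h ⟩
            ((Λ * L) * (ε * h)) ^ 2  ≈⟨ ^-congˡ 2 (1*-cancel ΛL≈1) ⟩
            (ε * h) ^ 2  ≤⟨ ^-mono-≤ 2 (*-nonneg 0≤ε 0≤h) (≤-trans (≤-trans (*-monoˡ-≤ 0≤ε h≤1) (≈⇒≤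
                (*-identityʳ ε))) ε≤ε+δ) ⟩
            (ε + δ) ^ 2  ∎)
            where
            open Reasoning
            ε≤ε+δ : ε ≤ ε + δ
            ε≤ε+δ = lin (<⇒≤ 0<δ) (solve 2 (λ e d → (e :+ d) :- e := d :- con (+ 0)) ≈-refl ε δ)
            0≤ε+δ : 0# ≤ ε + δ
            0≤ε+δ = ≤-trans 0≤ε ε≤ε+δ

          -- The i-th coordinate of p has size at least X/4, and moving by t ≤ 1/16 of the segment
          -- changes it by at most X/8. Shrinking the remaining X/8 gives 1/32; the distance from
          -- the axis, at most L X / 16 = 1/64, still leaves 1/64.
          large-coordinate : Large (fromℕ 4) X p → Large (fromℕ 64) 1# (φ z)
          large-coordinate (i , σ , σ≤1 , X≤) = i , σ , σ≤1 ,
            lin (+-mono-≤ (+-mono-≤ (*-monoˡ-≤ (fromℕ-nonneg 8) (*-monoˡ-≤ 0≤L X≤8)) error) (≈⇒≤ (≈-sym 8LX≈2)))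
              (≈-trans
                (+-congʳ (*-congˡ (*-congˡ (solve 2 (λ f a → f := a :+ (f :- a)) ≈-refl (φ z i) (a i)))))
                (≈-trans (+-congʳ (*-congˡ (*-congˡ (+-congʳ (a≈ i)))))
                  (solve 5 (λ L X σ x w → con (+ 64) :* (σ :* (L :* x :+ w)) :- con (+ 1) :=
                    ((con (+ 8) :* (L :* (con (+ 8) :* (σ :* x))) :+ con (+ 1)) :+ con (+ 8) :* (L :* X))
                    :- ((con (+ 8) :* (L :* X) :+ :- (con (+ 64) :* (σ :* w))) :+ con (+ 2)))
                    ≈-refl L X σ (on-segment i) (φ z i - a i))))
            where
            open Reasoning
            W : Carrier
            W = t * (σ * (q i - p i))
            8W≤X : - (fromℕ 8 * W) ≤ X
            8W≤X = begin
              - (fromℕ 8 * W)  ≈⟨ solve 1 (λ w → :- (con (+ 8) :* w) := con (+ 8) :* :- w) ≈-refl W ⟩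
              fromℕ 8 * - W  ≤⟨ *-monoˡ-≤ (fromℕ-nonneg 8) (proj₂ (abs-* (abs-nonneg 0≤t t≤h) (abs-* σ≤1 (abs-+ (bq i)
                  (abs-neg (bp i)))))) ⟩
              fromℕ 8 * (h * (1# * (X + X)))  ≈⟨ solve 2 (λ h x → con (+ 8) :* (h :* (con (+ 1) :* (x :+ x))) := (con
                  (+ 16) :* h) :* x) ≈-refl h X ⟩
              (fromℕ 16 * h) * X  ≈⟨ 1*-cancel 16h≈1 ⟩
              X  ∎
            X≤8 : X ≤ fromℕ 8 * (σ * on-segment i)
            X≤8 = lin (+-mono-≤ (+-mono-≤ X≤ X≤) 8W≤X)
              (solve 5 (λ X σ p q t → con (+ 8) :* (σ :* (p :+ t :* (q :- p))) :- X :=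
                ((con (+ 4) :* (σ :* p) :+ con (+ 4) :* (σ :* p)) :+ X) :- ((X :+ X) :+ :- (con (+ 8) :* (t :* (σ :*
                    (q :- p))))))
                ≈-refl X σ (p i) (q i) t)
            8LX≈2 : fromℕ 8 * (L * X) ≈ fromℕ 2
            8LX≈2 = begin-equality
              fromℕ 8 * (L * X)  ≈⟨ solve 1 (λ x → con (+ 8) :* x := con (+ 2) :* (con (+ 4) :* x)) ≈-refl (L * X) ⟩
              fromℕ 2 * (fromℕ 4 * (L * X))  ≈⟨ *-congˡ 4LX≈1 ⟩
              fromℕ 2 * 1#  ≈⟨ *-identityʳ (fromℕ 2) ⟩
              fromℕ 2  ∎
            error : - (fromℕ 64 * (σ * (φ z i - a i))) ≤ 1#
            error = begin
              - (fromℕ 64 * (σ * (φ z i - a i)))  ≈⟨ solve 1 (λ w → :- (con (+ 64) :* w) := con (+ 64) :* :- w) ≈-refl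
                  (σ * (φ z i - a i)) ⟩
              fromℕ 64 * - (σ * (φ z i - a i))  ≤⟨ *-monoˡ-≤ (fromℕ-nonneg 64) (proj₂ (abs-* σ≤1 (φ-near-a i))) ⟩
              fromℕ 64 * (1# * (ε * L * h))  ≈⟨ solve 2 (λ a h → con (+ 64) :* (con (+ 1) :* (a :* h)) := con
                  (+ 4) :* a :* (con (+ 16) :* h)) ≈-refl (ε * L) h ⟩
              fromℕ 4 * (ε * L) * (fromℕ 16 * h)  ≈⟨ ≈-trans (*-congˡ 16h≈1) (*-identityʳ _) ⟩
              fromℕ 4 * (ε * L)  ≤⟨ *-monoˡ-≤ (fromℕ-nonneg 4) εL≤LX ⟩
              fromℕ 4 * (L * X)  ≈⟨ 4LX≈1 ⟩
              1#  ∎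

        2^p≈ : 2^ᴿ (exponent k) ≈ Λ * Λ ^ d₀
        2^p≈ = ≈-trans (≈-reflexive (≡.cong fromℕ (≡.sym (ℕ.^-*-assoc 2 (2 ℕ.+ k) d)))) (fromℕ-^ (2 ℕ.^ (2 ℕ.+ k)) d)

        -- K L equals κ Λ^(d - 1), and d - 1 ≥ 1.
        κΛ≤KL : fromℕ κ * Λ ≤ fromℕ K * L
        κΛ≤KL = begin
          fromℕ κ * Λ  ≤⟨ *-monoˡ-≤ (fromℕ-nonneg κ) (x≤x^d₀ 1≤Λ) ⟩
          fromℕ κ * Λ ^ d₀  ≈⟨ ≈-trans (*-congˡ (≈-sym (1*-cancel ΛL≈1))) (solve 4 (λ k m l t → k :*
              ((m :* l) :* t) := (k :* (m :* t)) :* l) ≈-refl (fromℕ κ) Λ L (Λ ^ d₀)) ⟩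
          (fromℕ κ * (Λ * Λ ^ d₀)) * L  ≈⟨ *-congʳ (≈-trans (*-congˡ (≈-sym 2^p≈)) (≈-sym (fromℕ-* κ
              (2 ℕ.^ exponent k)))) ⟩
          fromℕ K * L  ∎
          where open Reasoning

        -- A long segment forces a large scale: C y ≤ ℓ ≤ 2 d X. Hence the short sides, of order
        -- ε/Λ, are at least of order 1/Λ² and not thin for a grid with r ≤ 1/(κ Λ²).
        2≤Xε : fromℕ 2 ≤ X * ε
        2≤Xε = *-cancelˡ-≤ 0<2 (*-cancelˡ-≤ 0<d (begin
          dᴿ * (fromℕ 2 * fromℕ 2)  ≈⟨ solve 1 (λ d → d :* (con (+ 2) :* con (+ 2)) := con (+ 4) :* d) ≈-refl dᴿ ⟩
          fromℕ 4 * dᴿ  ≈⟨ fromℕ-* 4 d ⟨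
          fromℕ (4 ℕ.* d)  ≤⟨ fromℕ-mono-≤ (ℕ.≤-trans (ℕ.*-monoˡ-≤ d (ℕ.m≤m+n 4 124)) 128d≤C) ⟩
          C  ≈⟨ ≈-trans (≈-sym (*-identityˡ C)) (*-congʳ (≈-sym εy≈1)) ⟩
          (ε * y) * C  ≈⟨ solve 3 (λ e y c → (e :* y) :* c := e :* (c :* y)) ≈-refl ε y C ⟩
          ε * (C * y)  ≤⟨ *-monoˡ-≤ 0≤ε (≤-trans Cy≤ℓ (bounded⇒ℓ≤ 0≤X bp bq)) ⟩
          ε * (dᴿ * (X + X))  ≈⟨ solve 3 (λ e d x → e :* (d :* (x :+ x)) := d :* (con (+ 2) :* (x :* e)))
              ≈-refl ε dᴿ X ⟩
          dᴿ * (fromℕ 2 * (X * ε))  ∎))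
          where open Reasoning

        wide : ∀ i → fromℕ 6 ≤ fromℕ K * side i
        wide zero = begin
          fromℕ 6  ≈⟨ solve 0 (con (+ 6) := con (+ 6) :* con (+ 1) :* con (+ 1)) ≈-refl ⟩
          fromℕ 6 * 1# * 1#  ≤⟨ *-mono-≤ (*-nonneg (fromℕ-nonneg 6) 0≤1) (*-nonneg 0≤ℓ 0≤h) (*-mono-≤
              (fromℕ-nonneg 6) 0≤Λ (fromℕ-mono-≤ {6} {κ} (ℕ.m≤m*n 6 d)) 1≤Λ) 1≤ℓh ⟩
          fromℕ κ * Λ * (ℓ * h)  ≤⟨ *-monoʳ-≤ (*-nonneg 0≤ℓ 0≤h) κΛ≤KL ⟩
          fromℕ K * L * (ℓ * h)  ≈⟨ solve 4 (λ k l m h → k :* l :* (m :* h) := k :* (m :* l :* h :- con (+ 0))) ≈-refl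
              (fromℕ K) L ℓ h ⟩
          fromℕ K * (side₀ - 0#)  ∎
          where
          open Reasoning
          1≤ℓh : 1# ≤ ℓ * h
          1≤ℓh = ≤-trans (≈⇒≤ (≈-sym 16h≈1)) (*-monoʳ-≤ 0≤h (≤-trans (fromℕ-mono-≤ 16≤C) C≤ℓ))
        wide (suc j) = begin
          fromℕ 6  ≈⟨ *-identityʳ (fromℕ 6) ⟨
          fromℕ 6 * 1#  ≈⟨ *-congˡ 16h≈1 ⟨
          fromℕ 6 * (fromℕ 16 * h)  ≈⟨ solve 1 (λ h → con (+ 6) :* (con (+ 16) :* h) := con (+ 48) :* con (+ 2) :* h)
              ≈-refl h ⟩
          fromℕ 48 * fromℕ 2 * h  ≤⟨ *-monoʳ-≤ 0≤h (*-monoˡ-≤ (fromℕ-nonneg 48) 2≤Xε) ⟩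
          fromℕ 48 * (X * ε) * h  ≈⟨ *-congˡ dh′≈h ⟨
          fromℕ 48 * (X * ε) * (dᴿ * h′)  ≈⟨ solve 4 (λ x e d h → con (+ 48) :* (x :* e) :* (d :* h) := (con
              (+ 6) :* d) :* (con (+ 4) :* x) :* (con (+ 2) :* (e :* h))) ≈-refl X ε dᴿ h′ ⟩
          (fromℕ 6 * dᴿ) * (fromℕ 4 * X) * (fromℕ 2 * (ε * h′))
                                               ≈⟨ *-congʳ (*-cong (fromℕ-* 6 d) Λ≈4X) ⟨
          fromℕ κ * Λ * (fromℕ 2 * (ε * h′))  ≤⟨ *-monoʳ-≤ (*-nonneg (fromℕ-nonneg 2) (*-nonneg 0≤ε 0≤h′)) κΛ≤KL ⟩
          fromℕ K * L * (fromℕ 2 * (ε * h′))  ≈⟨ solve 4 (λ k l e h → k :* l :* (con (+ 2) :* (e :* h)) := k :*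
              (e :* l :* h :- :- (e :* l :* h))) ≈-refl (fromℕ K) L ε h′ ⟩
          fromℕ K * (η - - η)  ∎
          where open Reasoning

        -- Equality holds: 2 ^ p is Λ^d and cancels the factor L of every side, and ε^d₀ from the
        -- short sides cancels y^d₀ in the length ℓ.
        large : 1# ≤ 2^ᴿ (exponent k) * volume
        large = ≈⇒≤ (≈-sym (begin-equality
          2^ᴿ (exponent k) * volume
            ≈⟨ *-cong 2^p≈ (*-congˡ (≈-trans (product-cong {d₀} {λ _ → η - - η} {λ _ → η + η} λ j → solve 1
                (λ n → n :- :- n := n :+ n) ≈-refl η) (product-const d₀ (η + η)))) ⟩
          (Λ * Λ ^ d₀) * ((side₀ - 0#) * (η + η) ^ d₀)
            ≈⟨ solve 4 (λ m n s t → (m :* n) :* ((s :- con (+ 0)) :* t) := (m :* s) :* (n :* t)) ≈-refl Λ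
                (Λ ^ d₀) side₀ ((η + η) ^ d₀) ⟩
          (Λ * (ℓ * L * h)) * (Λ ^ d₀ * (η + η) ^ d₀)
            ≈⟨ *-cong (solve 4 (λ m l L h → m :* (l :* L :* h) := (m :* L) :* (l :* h)) ≈-refl Λ ℓ L h) (≈-sym
                (^-distrib-* Λ (η + η) d₀)) ⟩
          ((Λ * L) * (ℓ * h)) * (Λ * (η + η)) ^ d₀
            ≈⟨ *-cong (1*-cancel ΛL≈1) (^-congˡ d₀ (≈-trans
                 (solve 4 (λ m e L h → m :* (e :* L :* h :+ e :* L :* h) := (m :* L) :* (e :* (con (+ 2) :* h)))
                     ≈-refl Λ ε L h′)
                 (1*-cancel ΛL≈1))) ⟩
          ((C * y ^ d₀) * h) * (ε * (fromℕ 2 * h′)) ^ d₀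
            ≈⟨ *-cong (*-congʳ (*-congʳ C≈)) (^-distrib-* ε (fromℕ 2 * h′) d₀) ⟩
          (((fromℕ 16 * B ^ d₀) * y ^ d₀) * h) * (ε ^ d₀ * (fromℕ 2 * h′) ^ d₀)
            ≈⟨ solve 6 (λ s b y h e t → (((s :* b) :* y) :* h) :* (e :* t) := (s :* h) :* ((e :* y) :* (b :* t)))
                ≈-refl (fromℕ 16) (B ^ d₀) (y ^ d₀) h (ε ^ d₀) ((fromℕ 2 * h′) ^ d₀) ⟩
          (fromℕ 16 * h) * ((ε ^ d₀ * y ^ d₀) * (B ^ d₀ * (fromℕ 2 * h′) ^ d₀))
            ≈⟨ *-cong 16h≈1 (*-cong (unit-power εy≈1) (unit-power (≈-trans
                 (solve 2 (λ d h → (con (+ 8) :* d) :* (con (+ 2) :* h) := (con (+ 16) :* d) :* h)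
                     ≈-refl dᴿ h′) 16dh′≈1))) ⟩
          1# * (1# * 1#)  ≈⟨ solve 0 (con (+ 1) :* (con (+ 1) :* con (+ 1)) := con (+ 1)) ≈-refl ⟩
          1#  ∎))
          where
          open Reasoning
          B : Carrier
          B = fromℕ 8 * dᴿ
          unit-power : ∀ {a b} → a * b ≈ 1# → a ^ d₀ * b ^ d₀ ≈ 1#
          unit-power {a} {b} ab≈1 = ≈-trans (≈-sym (^-distrib-* a b d₀)) (≈-trans (^-congˡ d₀ ab≈1) (1^n d₀))

        hit : Any (λ z → ∃[ y ] region y × φ y ≋ z) (level k)
        hit = NetSize.net-hits d κ 0<κ (exponent k) isometry I Point-in-box.φz∈Cube wide large

        visible-from-large : Large (fromℕ 4) X p → ∃[ x ] forest x × DistToSet≤ x (Segment p q) ε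
        visible-from-large large-p = from-hit (find hit)
          where
          from-hit : (∃[ z ] z ∈ level k × ∃[ y ] region y × φ y ≋ z) →
                     ∃[ x ] forest x × DistToSet≤ x (Segment p q) ε
          from-hit (z , z∈ , y , y∈ , φy≋z) = scaled ,
            (k , Any.map {P = z ≡_} {Q = λ z → Large (fromℕ 64) 1# z × scaled ≋ (λ i → scale k * z i)}
                   (λ { refl → large-z (Point-in-box.large-coordinate y y∈ large-p) , λ i → ≈-refl }) z∈) ,
            Point-in-box.close-to-segment y y∈ scaled (λ i → *-congˡ (≈-sym (φy≋z i)))
            where
            scaled : Point d
            scaled i = Λ * z i
            large-z : Large (fromℕ 64) 1# (φ y) → Large (fromℕ 64) 1# z
            large-z (i , σ , σ≤1 , 1≤) = i , σ , σ≤1 , ≤-trans 1≤ (≈⇒≤ (*-congˡ (*-congˡ (φy≋z i))))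

    DistToSet≤-⊆ : ∀ {x : Point d} {A B : PointSet d} {ε} → (∀ {y} → A y → B y) → DistToSet≤ x A ε → DistToSet≤ x B ε
    DistToSet≤-⊆ A⊆B dist δ 0<δ = let y , y∈ , le = dist δ 0<δ in y , A⊆B y∈ , le

    Segment-sym : ∀ {p q : Point d} {x} → Segment p q x → Segment q p x
    Segment-sym {p} {q} (t , 0≤t , t≤1 , x≋) = 1# - t , ≤⇒0≤- t≤1 ,
      lin 0≤t (solve 1 (λ t → con (+ 1) :- (con (+ 1) :- t) := t :- con (+ 0)) ≈-refl t) ,
      λ i → ≈-trans (x≋ i) (solve 3 (λ p q t → p :+ t :* (q :- p) := q :+ (con (+ 1) :- t) :* (p :- q)) ≈-refl (p i)
          (q i) t)

    visible : ∀ ε (0<ε : 0# < ε) → ε < 1# → ∀ p q → IsDist p q (C * recip ε 0<ε ^ d₀) →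
              ∃[ x ] forest x × DistToSet≤ x (Segment p q) ε
    visible ε 0<ε ε<1 p q dist = [ unit , dyadic ]′ (dyadic-size p q)
      where
      dist′ : IsDist q p (C * recip ε 0<ε ^ d₀)
      dist′ = proj₁ dist , ≈-trans (distSq-sym q p) (proj₂ dist)
      Goal : Set
      Goal = ∃[ x ] forest x × DistToSet≤ x (Segment p q) ε
      unit : Bounded (2^ᴿ 0) p × Bounded (2^ᴿ 0) q → Goal
      unit (bp , bq) = ⊥-elim (Tube.not-unit-size 0<ε ε<1 {p} {q} dist bp bq)
      dyadic : (∃[ k ] Bounded (2^ᴿ k) p × Bounded (2^ᴿ k) q × (Large (fromℕ 4) (2^ᴿ k) p ⊎ Large (fromℕ 4)
          (2^ᴿ k) q)) → Goal
      dyadic (k , bp , bq , inj₁ large) = Tube.AtScale.visible-from-large 0<ε ε<1 {p} {q} dist k bp bq large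
      -- The box starts at the first endpoint, so the segment is reversed when only `q` is known to
      -- be large.
      dyadic (k , bp , bq , inj₂ large) = swap (Tube.AtScale.visible-from-large 0<ε ε<1 {q} {p} dist′ k bq bp large)
        where
        swap : (∃[ x ] forest x × DistToSet≤ x (Segment q p) ε) → Goal
        swap (x , x∈ , close) = x , x∈ , DistToSet≤-⊆ {x} {Segment q p} {Segment p q} Segment-sym close

  -- Growth of the forest

  module ForestGrowth (d₁ : ℕ) where

    open OpticalForest d₁

    forest-respects : ∀ {x y} → x ≋ y → forest x → forest y
    forest-respects x≋y (k , any) = k , Any.map (λ (large , x≋) → large , λ i → ≈-trans (≈-sym (x≋y i)) (x≋ i)) any

    scaled-level : ℕ → List (Point d)
    scaled-level k = List.map (λ z i → scale k * z i) (level k)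

    levels : ℕ → List (Point d)
    levels zero    = scaled-level zero
    levels (suc K) = scaled-level (suc K) ++ levels K

    scaled-level⊆levels : ∀ {k K} {P : Point d → Set} → k ℕ.≤′ K → Any P (scaled-level k) → Any P (levels K)
    scaled-level⊆levels {zero}  ℕ.≤′-refl         any = any
    scaled-level⊆levels {suc k} ℕ.≤′-refl         any = Any.++⁺ˡ any
    scaled-level⊆levels         (ℕ.≤′-step {K} k≤K) any = Any.++⁺ʳ (scaled-level (suc K))
        (scaled-level⊆levels k≤K any)

    c₀ c₁ : ℕ
    c₀ = net-constant d κ
    c₁ = c₀ ℕ.* (2 ℕ.^ (2 ℕ.* d) ℕ.* suc (2 ℕ.* d))

    length-level : ∀ k → length (scaled-level k) ℕ.≤ c₁ ℕ.* (2 ℕ.^ (k ℕ.* d) ℕ.* suc k)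
    length-level k = begin
      length (scaled-level k)  ≡⟨ List.length-map _ (level k) ⟩
      length (level k)  ≤⟨ length-net d κ 0<κ (exponent k) ⟩
      c₀ ℕ.* (2 ℕ.^ ((2 ℕ.+ k) ℕ.* d) ℕ.* suc ((2 ℕ.+ k) ℕ.* d))
                                                ≤⟨ ℕ.*-monoʳ-≤ c₀ (ℕ.*-mono-≤ (ℕ.≤-reflexive power) linear) ⟩
      c₀ ℕ.* ((2 ℕ.^ (2 ℕ.* d) ℕ.* 2 ℕ.^ (k ℕ.* d)) ℕ.* (suc (2 ℕ.* d) ℕ.* suc k))
                                                ≡⟨ lemma c₀ (2 ℕ.^ (2 ℕ.* d)) (2 ℕ.^ (k ℕ.* d)) (suc (2 ℕ.* d))
                                                    (suc k) ⟩
      c₁ ℕ.* (2 ℕ.^ (k ℕ.* d) ℕ.* suc k)  ∎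
      where
      open ℕ.≤-Reasoning
      power : 2 ℕ.^ ((2 ℕ.+ k) ℕ.* d) ≡ 2 ℕ.^ (2 ℕ.* d) ℕ.* 2 ℕ.^ (k ℕ.* d)
      power = ≡.trans (≡.cong (2 ℕ.^_) (ℕ.*-distribʳ-+ d 2 k)) (ℕ.^-distribˡ-+-* 2 (2 ℕ.* d) (k ℕ.* d))
      expand : ∀ d k → suc (2 ℕ.* d) ℕ.* suc k ≡ suc ((2 ℕ.+ k) ℕ.* d) ℕ.+ (k ℕ.+ k ℕ.* d)
      expand = solve-∀
      linear : suc ((2 ℕ.+ k) ℕ.* d) ℕ.≤ suc (2 ℕ.* d) ℕ.* suc k
      linear = ℕ.≤-trans (ℕ.m≤m+n (suc ((2 ℕ.+ k) ℕ.* d)) (k ℕ.+ k ℕ.* d)) (ℕ.≤-reflexive (≡.sym (expand d k)))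
      lemma : ∀ c a b e f → c ℕ.* ((a ℕ.* b) ℕ.* (e ℕ.* f)) ≡ (c ℕ.* (a ℕ.* e)) ℕ.* (b ℕ.* f)
      lemma = solve-∀

    -- A geometric sum: a further level at least doubles the bound because 2 ^ d ≥ 2, so all lower
    -- levels together fit into the budget of the top one.
    length-levels : ∀ K → length (levels K) ℕ.≤ 2 ℕ.* c₁ ℕ.* (2 ℕ.^ (K ℕ.* d) ℕ.* suc K)
    length-levels zero    = ℕ.≤-trans (length-level 0) (ℕ.*-monoˡ-≤ (2 ℕ.^ 0 ℕ.* 1) (ℕ.m≤n*m c₁ 2))
    length-levels (suc K) = begin
      length (levels (suc K))  ≡⟨ List.length-++ (scaled-level (suc K)) ⟩
      length (scaled-level (suc K)) ℕ.+ length (levels K)  ≤⟨ ℕ.+-mono-≤ (length-level (suc K)) (length-levels K) ⟩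
      c₁ ℕ.* (B ℕ.* suc (suc K)) ℕ.+ 2 ℕ.* c₁ ℕ.* (b ℕ.* suc K) ≡⟨ ≡.cong (c₁ ℕ.* (B ℕ.* suc (suc K)) ℕ.+_)
          (lemma c₁ b (suc K)) ⟩
      c₁ ℕ.* (B ℕ.* suc (suc K)) ℕ.+ c₁ ℕ.* (2 ℕ.* b ℕ.* suc K) ≤⟨ ℕ.+-monoʳ-≤ (c₁ ℕ.* (B ℕ.* suc (suc K)))
          (ℕ.*-monoʳ-≤ c₁ (ℕ.*-mono-≤ doubling (ℕ.n≤1+n (suc K)))) ⟩
      c₁ ℕ.* (B ℕ.* suc (suc K)) ℕ.+ c₁ ℕ.* (B ℕ.* suc (suc K)) ≡⟨ lemma′ c₁ (B ℕ.* suc (suc K)) ⟩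
      2 ℕ.* c₁ ℕ.* (B ℕ.* suc (suc K))  ∎
      where
      open ℕ.≤-Reasoning
      B b : ℕ
      B = 2 ℕ.^ (suc K ℕ.* d)
      b = 2 ℕ.^ (K ℕ.* d)
      doubling : 2 ℕ.* b ℕ.≤ B
      doubling = ℕ.^-monoʳ-≤ 2 {suc (K ℕ.* d)} {suc K ℕ.* d} (ℕ.s≤s (ℕ.m≤n+m (K ℕ.* d) d₀))
      lemma : ∀ c b k → 2 ℕ.* c ℕ.* (b ℕ.* k) ≡ c ℕ.* (2 ℕ.* b ℕ.* k)
      lemma = solve-∀
      lemma′ : ∀ c x → c ℕ.* x ℕ.+ c ℕ.* x ≡ 2 ℕ.* c ℕ.* x
      lemma′ = solve-∀

    -- 128 comes from 2 ^ K ≤ 128 T, and 10 · 2 from `exponent-bound` with a = 7, as 128 = 2 ^ 7.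
    growth-constant : Carrier
    growth-constant = fromℕ (suc (2 ℕ.* c₁)) * (fromℕ 128 ^ d * (fromℕ 10 * fromℕ 2))

    0<growth-constant : 0# < growth-constant
    0<growth-constant = *-pos (0<fromℕ-suc (2 ℕ.* c₁)) (*-pos (^-pos d (0<fromℕ-suc 127)) (*-pos (0<fromℕ-suc 9) 0<2))

    module _ {T : Carrier} (32≤T : fromℕ 32 ≤ T) where

      private
        0≤T : 0# ≤ T
        0≤T = ≤-trans (fromℕ-nonneg 32) 32≤T

        size : ∃[ K ] fromℕ 16 * T ≤ 2^ᴿ K × 2^ᴿ K ≤ fromℕ 4 * (fromℕ 16 * T) + 1#
        size = log₂ (fromℕ 16 * T) (*-nonneg (fromℕ-nonneg 16) 0≤T)

        K : ℕ
        K = proj₁ size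

        2^K≤ : 2^ᴿ K ≤ fromℕ 128 * T
        2^K≤ = begin
          2^ᴿ K  ≤⟨ proj₂ (proj₂ size) ⟩
          fromℕ 4 * (fromℕ 16 * T) + 1#  ≤⟨ +-mono-≤ ≤-refl (≤-trans (1≤fromℕ {64} (ℕ.s≤s ℕ.z≤n))
                                                  (≤-trans (≈⇒≤ (≈-sym (*-identityʳ (fromℕ 64)))) (*-monoˡ-≤
                                                      (fromℕ-nonneg 64) (≤-trans (1≤fromℕ {32}
                                                      (ℕ.s≤s ℕ.z≤n)) 32≤T)))) ⟩
          fromℕ 4 * (fromℕ 16 * T) + fromℕ 64 * T  ≈⟨ solve 1 (λ t → con (+ 4) :* (con (+ 16) :* t) :+ con
              (+ 64) :* t := con (+ 128) :* t) ≈-refl T ⟩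
          fromℕ 128 * T  ∎
          where open Reasoning

        -- The exponent 9 = 7 + 2 is the one that `exponent-bound` demands for a = 7; the threshold
        -- 32 for T is 2 ^ 9 / 16.
        2^9≤ : 2^ᴿ 9 ≤ 2^ᴿ K
        2^9≤ = begin
          fromℕ 512  ≈⟨ fromℕ-* 16 32 ⟩
          fromℕ 16 * fromℕ 32  ≤⟨ *-monoˡ-≤ (fromℕ-nonneg 16) 32≤T ⟩
          fromℕ 16 * T  ≤⟨ proj₁ (proj₂ size) ⟩
          2^ᴿ K  ∎
          where open Reasoning

        -- A retained point has a coordinate of size at least scale k / 64 = 2 ^ k / 16; in the ball
        -- this is at most T, so 2 ^ k ≤ 16 T ≤ 2 ^ K.
        level≤K : ∀ {k x z} → Large (fromℕ 64) 1# z → x ≋ (λ i → scale k * z i) → Ball d T x → k ℕ.≤ K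
        level≤K {k} {x} {z} (i , σ , σ≤1 , 1≤) x≋ (_ , x≤T) = 2^-mono-cancel k K (begin
          2^ᴿ k  ≤⟨ *-cancelˡ-≤ (0<fromℕ-suc 3) (begin
              fromℕ 4 * 2^ᴿ k  ≈⟨ solve 1 (λ x → con (+ 4) :* x := con (+ 2) :* (con (+ 2) :* x)) ≈-refl (2^ᴿ k) ⟩
              fromℕ 2 * (fromℕ 2 * 2^ᴿ k)  ≈⟨ ≈-trans (2^[1+n] (suc k)) (*-congˡ (2^[1+n] k)) ⟨
              scale k  ≈⟨ *-identityʳ (scale k) ⟨
              scale k * 1#  ≤⟨ *-monoˡ-≤ (fromℕ-nonneg (2 ℕ.^ (2 ℕ.+ k))) 1≤ ⟩
              scale k * (fromℕ 64 * (σ * z i))  ≈⟨ solve 3 (λ m s z → m :* (con (+ 64) :* (s :* z)) := con (+ 64) :*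
                  (s :* (m :* z :- con (+ 0)))) ≈-refl (scale k) σ (z i) ⟩
              fromℕ 64 * (σ * (scale k * z i - 0#))  ≤⟨ *-monoˡ-≤ (fromℕ-nonneg 64) (proj₁ (abs-* σ≤1 (abs-cong
                  (+-congʳ (x≋ i)) (coordinate≤dist {x = x} {y = λ _ → 0#} 0≤T x≤T i)))) ⟩
              fromℕ 64 * (1# * T)  ≈⟨ solve 1 (λ t → con (+ 64) :* (con (+ 1) :* t) := con (+ 4) :* (con (+ 16) :* t))
                  ≈-refl T ⟩
              fromℕ 4 * (fromℕ 16 * T)  ∎) ⟩
          fromℕ 16 * T  ≤⟨ proj₁ (proj₂ size) ⟩
          2^ᴿ K  ∎)
          where open Reasoning

      ball-card : ∀ {ℓ} → IsLn T ℓ → Card≤ (Ball d T ∩ forest) (growth-constant * (T ^ d * ℓ))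
      ball-card {ℓ} ln = levels K , covered , (begin
        fromℕ (length (levels K))  ≤⟨ fromℕ-mono-≤ (ℕ.≤-trans (length-levels K) (ℕ.*-monoˡ-≤ (2 ℕ.^
            (K ℕ.* d) ℕ.* suc K) (ℕ.n≤1+n (2 ℕ.* c₁)))) ⟩
        fromℕ (c ℕ.* (2 ℕ.^ (K ℕ.* d) ℕ.* suc K))  ≈⟨ ≈-trans (fromℕ-* c (2 ℕ.^ (K ℕ.* d) ℕ.* suc K)) (*-congˡ
            (≈-trans (fromℕ-* (2 ℕ.^ (K ℕ.* d)) (suc K)) (*-congʳ
                                                                           (≈-trans (≈-reflexive (≡.cong fromℕ (≡.sym
                                                                               (ℕ.^-*-assoc 2 K d)))) (fromℕ-^
                                                                               (2 ℕ.^ K) d))))) ⟩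
        fromℕ c * (2^ᴿ K ^ d * fromℕ (suc K))  ≤⟨ *-monoˡ-≤ (fromℕ-nonneg c) (*-mono-≤ (^-nonneg d (fromℕ-nonneg
            (2 ℕ.^ K))) (≤-trans (fromℕ-nonneg (suc K)) sucK≤)
                                                                           (^-mono-≤ d (fromℕ-nonneg (2 ℕ.^ K)) 2^K≤) sucK≤) ⟩
        fromℕ c * ((fromℕ 128 * T) ^ d * (fromℕ 10 * (fromℕ 2 * ℓ)))  ≈⟨ *-congˡ (*-congʳ (^-distrib-*
            (fromℕ 128) T d)) ⟩
        fromℕ c * ((fromℕ 128 ^ d * T ^ d) * (fromℕ 10 * (fromℕ 2 * ℓ)))
          ≈⟨ solve 6 (λ c a t u v l → c :* ((a :* t) :* (u :* (v :* l))) := (c :* (a :* (u :* v))) :* (t :* l)) ≈-refl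
              (fromℕ c) (fromℕ 128 ^ d) (T ^ d) (fromℕ 10) (fromℕ 2) ℓ ⟩
        growth-constant * (T ^ d * ℓ)  ∎)
        where
        open Reasoning
        c : ℕ
        c = suc (2 ℕ.* c₁)
        sucK≤ : fromℕ (suc K) ≤ fromℕ 10 * (fromℕ 2 * ℓ)
        sucK≤ = exponent-bound 7 K ln 2^9≤ 2^K≤
        covered : ∀ x → (Ball d T ∩ forest) x → Any (x ≋_) (levels K)
        covered x (x∈Ball , k , any) = scaled-level⊆levels (ℕ.≤⇒≤′ (k≤K (Any.satisfied any))) (Any.map⁺
            (Any.map proj₂ any))
          where
          k≤K : (∃[ z ] Large (fromℕ 64) 1# z × x ≋ (λ i → scale k * z i)) → k ℕ.≤ K
          k≤K (z , large , x≋) = level≤K {k} {x} {z} large x≋ x∈Ball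

    growth : HasGrowthRate (T^ d lnT) forest
    growth = growth-constant , 0<growth-constant , fromℕ 32 , λ { T 32≤T v (ℓ , ln , v≈) →
      enlarge (≈⇒≤ (*-congˡ (≈-sym v≈))) (ball-card 32≤T ln) }
      where
      enlarge : ∀ {A : PointSet d} {r s} → r ≤ s → Card≤ A r → Card≤ A s
      enlarge r≤s (xs , covers , le) = xs , covers , ≤-trans le r≤s

    -- As 4 = 2 ^ 2, `ln-lower` with q = 0 gives ln T ≥ 1/2 from T = 4 on.
    superpolynomial : (T^ d lnT) ≫T^ d
    superpolynomial = ½ᴿ , recip-pos _ _ , fromℕ 4 , λ { T 4≤T v (ℓ , ln , v≈) → bound T 4≤T ln v≈ }
      where
      open Reasoning
      bound : ∀ T {v ℓ} → fromℕ 4 ≤ T → IsLn T ℓ → v ≈ T ^ d * ℓ → ½ᴿ * T ^ d ≤ v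
      bound T {v} {ℓ} 4≤T ln v≈ = begin
        ½ᴿ * T ^ d  ≈⟨ *-comm ½ᴿ (T ^ d) ⟩
        T ^ d * ½ᴿ  ≤⟨ *-monoˡ-≤ (^-nonneg d (≤-trans (fromℕ-nonneg 4) 4≤T)) ½≤ℓ ⟩
        T ^ d * ℓ  ≈⟨ v≈ ⟨
        v  ∎
        where
        ½≤ℓ : ½ᴿ ≤ ℓ
        ½≤ℓ = *-cancelˡ-≤ 0<2 (≤-trans (≈⇒≤ (≈-trans 2*½ (≈-sym fromℕ-1))) (ln-lower 0 {T} {ℓ} ln 4≤T))

    isOpticalForest : IsOpticalForest (T^ d lnT) forest
    isOpticalForest = record
      { respects = forest-respects
      ; g≫T^d    = superpolynomial
      ; growth   = growth
      ; visible  = C , <-≤-trans 0<1 (1≤fromℕ (ℕ.≤-trans (ℕ.s≤s ℕ.z≤n) 16≤C)) , visible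
      }

open import Defs

theorem1p0p2 : ∀ (d : ℕ) → 2 ℕ.≤ d →
    (∃[ C ] 0# < C × ∃[ ε₀ ] 0# < ε₀ × ε₀ < 1# ×
    (∀ ε (0<ε : 0# < ε) → ∃[ N ]
    IsNet (𝓑′ d) ε N ×
    (ε ≤ ε₀ → ∀ ℓ → IsLn (recip ε 0<ε) ℓ → Card≤ N (C * recip ε 0<ε * ℓ))))
    ×
    (∃[ F ] IsOpticalForest {d} (T^ d lnT) F)
theorem1p0p2 (suc (suc d₁)) _ =
  (fromℕ N.constant , N.0<constant , N.ε₀ , N.0<ε₀ , N.ε₀<1 , N.epsilon-net) ,
  (F.forest , G.isOpticalForest)
  where
  module P = Proof CauchyReals.ℝ-numbers
  module N = P.EpsilonNet (suc d₁)
  module F = P.OpticalForest d₁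
  module G = P.ForestGrowth d₁
theorem1p0p2 (suc zero) (ℕ.s≤s ())
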